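{- Let $m \ge 2$, let $f \in \mathbb{R}[x_1,\dots,x_m]$ be a form of degree $n$, and let $\mathcal{Z}$ be a nonempty $\mathrm{SL}_m(\mathbb{Z})$-invariant subset of $\mathbb{Z}^m\setminus\{\vec 0\}$. If $f(\mathcal{Z})$ is discrete in $\mathbb{R}$, then $f$ is $\mathbb{Q}$-equivalent to a form in $n$ variables.
   Context: A form of degree $n$ in $m$ variables is a homogeneous polynomial $f(\vec x)\in\mathbb{R}[\vec x]$, $\vec x=(x_1,\dots,x_m)$, which factors as $f(\vec x)=l_1(\vec x)\cdots l_n(\vec x)$ with $l_1,\dots,l_n$ linear forms with complex coefficients that are linearly independent over $\mathbb{C}$ (so $n\le m$). The group $G=\mathrm{SL}_m(\mathbb{R})$ acts on $\mathbb{R}^m$ in the usual way and on $\mathbb{R}[\vec x]$ by $(gp)(\vec x)=p(g^{ -1}\vec x)$. If $g\in \mathrm{SL}_m(\mathbb{Q})$, the forms $f$ and $gf$ are called $\mathbb{Q}$-equivalent. $f$ is said to be $\mathbb{Q}$-equivalent to a form in $n$ variables if there is $g\in\mathrm{SL}_m(\mathbb{Q})$ with $(gf)(x_1,\dots,x_m)=(gf)(x_1,\dots,x_n,0,\dots,0)$. A subset of $\mathbb{R}$ is called discrete in $\mathbb{R}$ if it has no accumulation point in $\mathbb{R}$ (i.e. it is closed and discrete). -}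

module Defs where

open import Algebra.Bundles.Raw using (RawRing; RawSemiring)
import Algebra.Definitions.RawSemiring as RawSemiringDefinitions
open import Data.Bool.Base using (if_then_else_)
open import Data.Fin.Base using (Fin; zero; suc; toℕ; punchIn)
import Data.Fin.Properties as Fin
open import Data.Integer.Base as ℤ using (ℤ)
open import Data.List.Base as List using (List; []; _∷_; [_]; _++_)
open import Data.Nat.Base as ℕ using (ℕ; zero; suc)
import Data.Nat.Properties as ℕ
open import Data.Product.Base using (Σ-syntax; ∃-syntax; _×_; _,_)
open import Data.Rational.Base as ℚ using (ℚ; 0ℚ; 1ℚ; ½; ∣_∣; positive)
import Data.Rational.Properties as ℚ
import Data.Rational.Solver as ℚSolver
open import Data.Vec.Base as Vec using (Vec; lookup; tabulate; replicate; zipWith)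
import Data.Vec.Properties as Vec
open import Level using (0ℓ)
open import Relation.Binary.PropositionalEquality
  using (_≡_; refl; sym; trans; cong; subst)
open import Relation.Nullary using (¬_; does)
open import Relation.Unary using (Pred)

------------------------------------------------------------------------
-- Real numbers: Cauchy sequences of rationals

Cauchy : (ℕ → ℚ) → Set
Cauchy x = ∀ ε → 0ℚ ℚ.< ε →
  ∃[ N ] (∀ {m n} → N ℕ.≤ m → N ℕ.≤ n → ∣ x m ℚ.- x n ∣ ℚ.< ε)

record ℝ : Set where
  constructor mkℝ
  field
    seq    : ℕ → ℚ
    cauchy : Cauchy seq

open ℝ public

infix 4 _≈ℝ_ _<ℝ_

_≈ℝ_ : ℝ → ℝ → Set
x ≈ℝ y = ∀ ε → 0ℚ ℚ.< ε →
  ∃[ N ] (∀ {n} → N ℕ.≤ n → ∣ seq x n ℚ.- seq y n ∣ ℚ.< ε)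

-- The gap ε must be uniform in n, for otherwise (1/(n+1))ₙ, a sequence
-- representing 0, would count as positive.
_<ℝ_ : ℝ → ℝ → Set
x <ℝ y = ∃[ ε ] 0ℚ ℚ.< ε ×
  (∃[ N ] (∀ {n} → N ℕ.≤ n → seq x n ℚ.+ ε ℚ.≤ seq y n))

private
  module _ where
    open ℚSolver.+-*-Solver

    difference-of-sums : ∀ x y z w →
      (x ℚ.+ y) ℚ.- (z ℚ.+ w) ≡ (x ℚ.- z) ℚ.+ (y ℚ.- w)
    difference-of-sums = solve 4 (λ x y z w →
      (x :+ y) :- (z :+ w) := (x :- z) :+ (y :- w)) refl

    difference-of-products : ∀ x y z w →
      x ℚ.* y ℚ.- z ℚ.* w ≡ x ℚ.* (y ℚ.- w) ℚ.+ w ℚ.* (x ℚ.- z)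
    difference-of-products = solve 4 (λ x y z w →
      x :* y :- z :* w := x :* (y :- w) :+ w :* (x :- z)) refl

    add-difference : ∀ x y → x ≡ y ℚ.+ (x ℚ.- y)
    add-difference = solve 2 (λ x y → x := y :+ (x :- y)) refl

    swap-factors : ∀ s e t → s ℚ.* (e ℚ.* t) ≡ e ℚ.* (s ℚ.* t)
    swap-factors = solve 3 (λ s e t → s :* (e :* t) := e :* (s :* t)) refl

  half-pos : ∀ {ε} → 0ℚ ℚ.< ε → 0ℚ ℚ.< ε ℚ.* ½
  half-pos {ε} 0<ε = ℚ.positive⁻¹ (ε ℚ.* ½)
    where instance
      _ = positive 0<ε
      _ = ℚ.pos*pos⇒pos ε ½

  half+half : ∀ ε → ε ℚ.* ½ ℚ.+ ε ℚ.* ½ ≡ ε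
  half+half ε = trans (sym (ℚ.*-distribˡ-+ ε ½ ½)) (ℚ.*-identityʳ ε)

  constant-cauchy : ∀ p → Cauchy (λ _ → p)
  constant-cauchy p ε 0<ε = 0 , λ _ _ →
    subst (ℚ._< ε) (sym (cong ∣_∣ (ℚ.+-inverseʳ p))) 0<ε

  +-cauchy : ∀ a b → Cauchy a → Cauchy b → Cauchy (λ n → a n ℚ.+ b n)
  +-cauchy a b ca cb ε 0<ε
    with N₁ , a-close ← ca (ε ℚ.* ½) (half-pos 0<ε)
       | N₂ , b-close ← cb (ε ℚ.* ½) (half-pos 0<ε) =
    N₁ ℕ.⊔ N₂ , λ {m} {n} p q → begin-strict
      ∣ (a m ℚ.+ b m) ℚ.- (a n ℚ.+ b n) ∣
        ≡⟨ cong ∣_∣ (difference-of-sums (a m) (b m) (a n) (b n)) ⟩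
      ∣ (a m ℚ.- a n) ℚ.+ (b m ℚ.- b n) ∣
        ≤⟨ ℚ.∣p+q∣≤∣p∣+∣q∣ (a m ℚ.- a n) (b m ℚ.- b n) ⟩
      ∣ a m ℚ.- a n ∣ ℚ.+ ∣ b m ℚ.- b n ∣
        <⟨ ℚ.+-mono-< (a-close (ℕ.m⊔n≤o⇒m≤o N₁ N₂ p) (ℕ.m⊔n≤o⇒m≤o N₁ N₂ q))
                      (b-close (ℕ.m⊔n≤o⇒n≤o N₁ N₂ p) (ℕ.m⊔n≤o⇒n≤o N₁ N₂ q)) ⟩
      ε ℚ.* ½ ℚ.+ ε ℚ.* ½
        ≡⟨ half+half ε ⟩
      ε ∎
    where
    open ℚ.≤-Reasoning

  neg-cauchy : ∀ a → Cauchy a → Cauchy (λ n → ℚ.- a n)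
  neg-cauchy a ca ε 0<ε with N , close ← ca ε 0<ε =
    N , λ {m} {n} p q → subst (ℚ._< ε)
      (trans (sym (ℚ.∣-p∣≡∣p∣ (a m ℚ.- a n)))
             (cong ∣_∣ (ℚ.neg-distrib-+ (a m) (ℚ.- a n))))
      (close p q)

  eventually-bounded : ∀ {a} → Cauchy a →
    ∃[ A ] 0ℚ ℚ.< A × (∃[ N ] (∀ {n} → N ℕ.≤ n → ∣ a n ∣ ℚ.≤ A))
  eventually-bounded {a} ca with N , close ← ca 1ℚ (ℚ.positive⁻¹ 1ℚ) =
    ∣ a N ∣ ℚ.+ 1ℚ ,
    ℚ.+-mono-≤-< (ℚ.0≤∣p∣ (a N)) (ℚ.positive⁻¹ 1ℚ) ,
    N , λ {n} p → begin
      ∣ a n ∣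
        ≡⟨ cong ∣_∣ (add-difference (a n) (a N)) ⟩
      ∣ a N ℚ.+ (a n ℚ.- a N) ∣
        ≤⟨ ℚ.∣p+q∣≤∣p∣+∣q∣ (a N) (a n ℚ.- a N) ⟩
      ∣ a N ∣ ℚ.+ ∣ a n ℚ.- a N ∣
        ≤⟨ ℚ.+-monoʳ-≤ ∣ a N ∣ (ℚ.<⇒≤ (close p ℕ.≤-refl)) ⟩
      ∣ a N ∣ ℚ.+ 1ℚ ∎
    where
    open ℚ.≤-Reasoning

  *-bound : ∀ {p q A δ} → 0ℚ ℚ.< A → ∣ p ∣ ℚ.≤ A → ∣ q ∣ ℚ.< δ →
            ∣ p ℚ.* q ∣ ℚ.< A ℚ.* δ
  *-bound {p} {q} {A} {δ} 0<A p≤A q<δ = begin-strict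
    ∣ p ℚ.* q ∣       ≡⟨ ℚ.∣p*q∣≡∣p∣*∣q∣ p q ⟩
    ∣ p ∣ ℚ.* ∣ q ∣   ≤⟨ ℚ.*-monoʳ-≤-nonNeg ∣ q ∣ {{ℚ.∣-∣-nonNeg q}} p≤A ⟩
    A ℚ.* ∣ q ∣       <⟨ ℚ.*-monoʳ-<-pos A {{positive 0<A}} q<δ ⟩
    A ℚ.* δ           ∎
    where open ℚ.≤-Reasoning

  divide : ∀ {A B ε} → 0ℚ ℚ.< A → 0ℚ ℚ.< B → 0ℚ ℚ.< ε →
           ∃[ δ ] 0ℚ ℚ.< δ × (A ℚ.+ B) ℚ.* δ ≡ ε
  divide {A} {B} {ε} 0<A 0<B 0<ε =
    ε ℚ.* t , ℚ.positive⁻¹ (ε ℚ.* t) {{ℚ.pos*pos⇒pos ε {{positive 0<ε}} t {{t-pos}}}} ,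
    trans (swap-factors S ε t)
      (trans (cong (ε ℚ.*_) (ℚ.*-inverseʳ S {{S≢0}})) (ℚ.*-identityʳ ε))
    where
    S : ℚ
    S = A ℚ.+ B
    S-pos : ℚ.Positive S
    S-pos = ℚ.pos+pos⇒pos A {{positive 0<A}} B {{positive 0<B}}
    S≢0 : ℚ.NonZero S
    S≢0 = ℚ.pos⇒nonZero S {{S-pos}}
    t : ℚ
    t = ℚ.1/_ S {{S≢0}}
    t-pos : ℚ.Positive t
    t-pos = ℚ.1/pos⇒pos S {{S-pos}}

  product-close : ∀ {x y z w A B δ ε} → 0ℚ ℚ.< A → 0ℚ ℚ.< B →
    (A ℚ.+ B) ℚ.* δ ≡ ε → ∣ x ∣ ℚ.≤ A → ∣ w ∣ ℚ.≤ B →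
    ∣ x ℚ.- z ∣ ℚ.< δ → ∣ y ℚ.- w ∣ ℚ.< δ →
    ∣ x ℚ.* y ℚ.- z ℚ.* w ∣ ℚ.< ε
  product-close {x} {y} {z} {w} {A} {B} {δ} {ε} 0<A 0<B total x≤A w≤B xz yw =
    begin-strict
      ∣ x ℚ.* y ℚ.- z ℚ.* w ∣
        ≡⟨ cong ∣_∣ (difference-of-products x y z w) ⟩
      ∣ x ℚ.* (y ℚ.- w) ℚ.+ w ℚ.* (x ℚ.- z) ∣
        ≤⟨ ℚ.∣p+q∣≤∣p∣+∣q∣ (x ℚ.* (y ℚ.- w)) (w ℚ.* (x ℚ.- z)) ⟩
      ∣ x ℚ.* (y ℚ.- w) ∣ ℚ.+ ∣ w ℚ.* (x ℚ.- z) ∣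
        <⟨ ℚ.+-mono-< (*-bound {x} {y ℚ.- w} 0<A x≤A yw)
                      (*-bound {w} {x ℚ.- z} 0<B w≤B xz) ⟩
      A ℚ.* δ ℚ.+ B ℚ.* δ
        ≡⟨ ℚ.*-distribʳ-+ δ A B ⟨
      (A ℚ.+ B) ℚ.* δ
        ≡⟨ total ⟩
      ε ∎
    where open ℚ.≤-Reasoning

  *-cauchy : ∀ a b → Cauchy a → Cauchy b → Cauchy (λ n → a n ℚ.* b n)
  *-cauchy a b ca cb ε 0<ε =
    let A , 0<A , N₁ , a≤A = eventually-bounded ca
        B , 0<B , N₂ , b≤B = eventually-bounded cb
        δ , 0<δ , total    = divide 0<A 0<B 0<ε
        N₃ , a-close       = ca δ 0<δ
        N₄ , b-close       = cb δ 0<δ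
    in combine 0<A 0<B total N₁ a≤A N₂ b≤B N₃ a-close N₄ b-close
    where
    combine : ∀ {A B δ} → 0ℚ ℚ.< A → 0ℚ ℚ.< B → (A ℚ.+ B) ℚ.* δ ≡ ε →
      ∀ N₁ → (∀ {n} → N₁ ℕ.≤ n → ∣ a n ∣ ℚ.≤ A) →
      ∀ N₂ → (∀ {n} → N₂ ℕ.≤ n → ∣ b n ∣ ℚ.≤ B) →
      ∀ N₃ → (∀ {m n} → N₃ ℕ.≤ m → N₃ ℕ.≤ n → ∣ a m ℚ.- a n ∣ ℚ.< δ) →
      ∀ N₄ → (∀ {m n} → N₄ ℕ.≤ m → N₄ ℕ.≤ n → ∣ b m ℚ.- b n ∣ ℚ.< δ) →
      ∃[ N ] (∀ {m n} → N ℕ.≤ m → N ℕ.≤ n →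
        ∣ a m ℚ.* b m ℚ.- a n ℚ.* b n ∣ ℚ.< ε)
    combine 0<A 0<B total N₁ a≤A N₂ b≤B N₃ a-close N₄ b-close =
      (N₁ ℕ.⊔ N₂) ℕ.⊔ (N₃ ℕ.⊔ N₄) , λ {m} {n} p q →
        let p₁₂ = ℕ.m⊔n≤o⇒m≤o (N₁ ℕ.⊔ N₂) (N₃ ℕ.⊔ N₄) p
            p₃₄ = ℕ.m⊔n≤o⇒n≤o (N₁ ℕ.⊔ N₂) (N₃ ℕ.⊔ N₄) p
            q₁₂ = ℕ.m⊔n≤o⇒m≤o (N₁ ℕ.⊔ N₂) (N₃ ℕ.⊔ N₄) q
            q₃₄ = ℕ.m⊔n≤o⇒n≤o (N₁ ℕ.⊔ N₂) (N₃ ℕ.⊔ N₄) q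
        in product-close {a m} {b m} {a n} {b n} 0<A 0<B total
             (a≤A (ℕ.m⊔n≤o⇒m≤o N₁ N₂ p₁₂)) (b≤B (ℕ.m⊔n≤o⇒n≤o N₁ N₂ q₁₂))
             (a-close (ℕ.m⊔n≤o⇒m≤o N₃ N₄ p₃₄) (ℕ.m⊔n≤o⇒m≤o N₃ N₄ q₃₄))
             (b-close (ℕ.m⊔n≤o⇒n≤o N₃ N₄ p₃₄) (ℕ.m⊔n≤o⇒n≤o N₃ N₄ q₃₄))

fromℚ : ℚ → ℝ
fromℚ p = mkℝ (λ _ → p) (constant-cauchy p)

fromℤ : ℤ → ℝ
fromℤ z = fromℚ (z ℚ./ 1)

infixl 6 _+ℝ_ _-ℝ_
infixl 7 _*ℝ_
infix  8 -ℝ_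

_+ℝ_ : ℝ → ℝ → ℝ
x +ℝ y = mkℝ (λ n → seq x n ℚ.+ seq y n)
  (+-cauchy (seq x) (seq y) (cauchy x) (cauchy y))

_*ℝ_ : ℝ → ℝ → ℝ
x *ℝ y = mkℝ (λ n → seq x n ℚ.* seq y n)
  (*-cauchy (seq x) (seq y) (cauchy x) (cauchy y))

-ℝ_ : ℝ → ℝ
-ℝ x = mkℝ (λ n → ℚ.- seq x n) (neg-cauchy (seq x) (cauchy x))

_-ℝ_ : ℝ → ℝ → ℝ
x -ℝ y = x +ℝ (-ℝ y)

0ℝ 1ℝ : ℝ
0ℝ = fromℚ 0ℚ
1ℝ = fromℚ 1ℚ

ℝ-rawRing : RawRing 0ℓ 0ℓ
ℝ-rawRing = record
  { Carrier = ℝ ; _≈_ = _≈ℝ_ ; _+_ = _+ℝ_ ; _*_ = _*ℝ_ ; -_ = -ℝ_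
  ; 0# = 0ℝ ; 1# = 1ℝ }

AccumulationPoint : Pred ℝ 0ℓ → ℝ → Set
AccumulationPoint S x = ∀ ε → 0ℝ <ℝ ε →
  ∃[ y ] S y × ¬ (y ≈ℝ x) × (x -ℝ ε <ℝ y) × (y <ℝ x +ℝ ε)

DiscreteInℝ : Pred ℝ 0ℓ → Set
DiscreteInℝ S = ∀ x → ¬ AccumulationPoint S x

------------------------------------------------------------------------
-- Complex numbers

record ℂ : Set where
  constructor _+i_
  field
    re im : ℝ

open ℂ public

realℂ : ℝ → ℂ
realℂ x = x +i 0ℝ

ℂ-rawRing : RawRing 0ℓ 0ℓ
ℂ-rawRing = record
  { Carrier = ℂ
  ; _≈_ = λ z w → (re z ≈ℝ re w) × (im z ≈ℝ im w)
  ; _+_ = λ z w → (re z +ℝ re w) +i (im z +ℝ im w)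
  ; _*_ = λ z w → (re z *ℝ re w -ℝ im z *ℝ im w) +i
                  (re z *ℝ im w +ℝ im z *ℝ re w)
  ; -_  = λ z → (-ℝ re z) +i (-ℝ im z)
  ; 0#  = 0ℝ +i 0ℝ
  ; 1#  = 1ℝ +i 0ℝ
  }

------------------------------------------------------------------------
-- Linear algebra

Matrix : Set → ℕ → Set
Matrix A m = Fin m → Fin m → A

module LinearAlgebra (R : RawRing 0ℓ 0ℓ) where
  open RawRing R
  open RawSemiringDefinitions rawSemiring using (sum)

  infixl 7 _*ᴹ_
  infix  4 _≈ᴹ_

  _*ᴹ_ : ∀ {m} → Matrix Carrier m → Matrix Carrier m → Matrix Carrier m
  (A *ᴹ B) i k = sum λ j → A i j * B j k

  1ᴹ : ∀ {m} → Matrix Carrier m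
  1ᴹ i j = if does (i Fin.≟ j) then 1# else 0#

  _≈ᴹ_ : ∀ {m} → Matrix Carrier m → Matrix Carrier m → Set
  A ≈ᴹ B = ∀ i j → A i j ≈ B i j

  _*ⱽ_ : ∀ {m} → Matrix Carrier m → Vec Carrier m → Vec Carrier m
  A *ⱽ v = tabulate λ i → sum λ j → A i j * lookup v j

  alternate : ℕ → Carrier → Carrier
  alternate zero    x = x
  alternate (suc k) x = - alternate k x

  -- Laplace expansion along the first row.
  det : ∀ {m} → Matrix Carrier m → Carrier
  det {zero}  A = 1#
  det {suc m} A = sum λ j →
    alternate (toℕ j) (A zero j * det (λ i k → A (suc i) (punchIn j k)))

  LinearlyIndependent : ∀ {n m} → (Fin n → Fin m → Carrier) → Set
  LinearlyIndependent {n} l = ∀ (c : Fin n → Carrier) →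
    (∀ j → sum (λ i → c i * l i j) ≈ 0#) → ∀ i → c i ≈ 0#

-- The inverse is carried along as data so that g⁻¹ need not be given by
-- a formula; it is determined by the matrix.
record SL (R : RawRing 0ℓ 0ℓ) (m : ℕ) : Set where
  open RawRing R
  open LinearAlgebra R
  field
    matrix   : Matrix Carrier m
    inverse  : Matrix Carrier m
    inverseˡ : inverse *ᴹ matrix ≈ᴹ 1ᴹ
    inverseʳ : matrix *ᴹ inverse ≈ᴹ 1ᴹ
    det≈1    : det matrix ≈ 1#

SLℤ SLℚ : ℕ → Set
SLℤ = SL ℤ.+-*-rawRing
SLℚ = SL ℚ.+-*-rawRing

------------------------------------------------------------------------
-- Polynomials

-- (c , α) is the term c·x₀^α₀⋯x₍ₘ₋₁₎^α₍ₘ₋₁₎, and a list of terms stands for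
-- its sum.  Exponent vectors may repeat and coefficients may be zero, so
-- polynomials are compared by _≈ₚ_ below, never by _≡_.
Poly : Set → ℕ → Set
Poly A m = List (A × Vec ℕ m)

mapCoefficients : ∀ {A B m} → (A → B) → Poly A m → Poly B m
mapCoefficients φ = List.map λ (c , α) → φ c , α

-- φ is applied to the coefficients, and xs is substituted for the variables.
evaluateIn : ∀ {A m} (S : RawSemiring 0ℓ 0ℓ) →
             (φ : A → RawSemiring.Carrier S) (xs : Fin m → RawSemiring.Carrier S) →
             Poly A m → RawSemiring.Carrier S
evaluateIn S φ xs = List.foldr
  (λ (c , α) acc → φ c * product (λ i → xs i ^ lookup α i) + acc) 0#
  where
  open RawSemiring S
  open RawSemiringDefinitions S using (product; _^_)

module Polynomials (R : RawRing 0ℓ 0ℓ) where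
  open RawRing R

  constant : ∀ {m} → Carrier → Poly Carrier m
  constant c = [ c , replicate _ 0 ]

  var : ∀ {m} → Fin m → Poly Carrier m
  var i = [ 1# , tabulate (λ j → if does (i Fin.≟ j) then 1 else 0) ]

  coefficient : ∀ {m} → Poly Carrier m → Vec ℕ m → Carrier
  coefficient []            α = 0#
  coefficient ((c , β) ∷ p) α =
    (if does (Vec.≡-dec ℕ._≟_ β α) then c else 0#) + coefficient p α

  infix 4 _≈ₚ_
  _≈ₚ_ : ∀ {m} → Poly Carrier m → Poly Carrier m → Set
  p ≈ₚ q = ∀ α → coefficient p α ≈ coefficient q α

  poly-rawSemiring : ℕ → RawSemiring 0ℓ 0ℓ
  poly-rawSemiring m = record
    { Carrier = Poly Carrier m
    ; _≈_ = _≈ₚ_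
    ; _+_ = _++_
    ; _*_ = List.cartesianProductWith
              (λ (c , α) (d , β) → c * d , zipWith ℕ._+_ α β)
    ; 0#  = []
    ; 1#  = constant 1#
    }

  evaluate : ∀ {m} → Poly Carrier m → (Fin m → Carrier) → Carrier
  evaluate p xs = evaluateIn rawSemiring (λ c → c) xs p

  substitute : ∀ {m k} → (Fin m → Poly Carrier k) → Poly Carrier m → Poly Carrier k
  substitute = evaluateIn (poly-rawSemiring _) constant

  linearForm : ∀ {m} → (Fin m → Carrier) → Poly Carrier m
  linearForm {m} a = sum λ j → constant (a j) P.* var j
    where
    module P = RawSemiring (poly-rawSemiring m)
    open RawSemiringDefinitions (poly-rawSemiring m) using (sum)

  productₚ : ∀ {m n} → (Fin n → Poly Carrier m) → Poly Carrier m
  productₚ {m} = RawSemiringDefinitions.product (poly-rawSemiring m)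

  Homogeneous : ∀ {m} → ℕ → Poly Carrier m → Set
  Homogeneous n p = ∀ α → coefficient p α ≉ 0# → Vec.sum α ≡ n

  -- p(x₀,…,x₍ₘ₋₁₎) = p(x₀,…,x₍ₙ₋₁₎,0,…,0)
  InFirstVariables : ∀ {m} → ℕ → Poly Carrier m → Set
  InFirstVariables n p =
    p ≈ₚ substitute (λ i → if does (toℕ i ℕ.<? n) then var i else []) p

module ℝ[x] = Polynomials ℝ-rawRing
module ℂ[x] = Polynomials ℂ-rawRing

------------------------------------------------------------------------
-- Decomposable forms

IsForm : ∀ {m} → ℕ → Poly ℝ m → Set
IsForm {m} n f =
  ℝ[x].Homogeneous n f ×
  Σ[ l ∈ (Fin n → Fin m → ℂ) ]
    LinearAlgebra.LinearlyIndependent ℂ-rawRing l ×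
    mapCoefficients realℂ f ℂ[x].≈ₚ ℂ[x].productₚ (λ i → ℂ[x].linearForm (l i))

-- (g · p)(x) = p(g⁻¹x)
_·_ : ∀ {m} → SLℚ m → Poly ℝ m → Poly ℝ m
g · p = ℝ[x].substitute
  (λ i → ℝ[x].linearForm (λ j → fromℚ (SL.inverse g i j))) p

ℚ-EquivalentToFormIn : ∀ {m} → ℕ → Poly ℝ m → Set
ℚ-EquivalentToFormIn {m} n f = Σ[ g ∈ SLℚ m ] ℝ[x].InFirstVariables n (g · f)

SLℤ-Invariant : ∀ {m} → Pred (Vec ℤ m) 0ℓ → Set
SLℤ-Invariant {m} 𝒵 = ∀ (g : SLℤ m) {z} → 𝒵 z → 𝒵 (SL.matrix g *ⱽ z)
  where open LinearAlgebra ℤ.+-*-rawRing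

image : ∀ {m} → Poly ℝ m → Pred (Vec ℤ m) 0ℓ → Pred ℝ 0ℓ
image f 𝒵 y = ∃[ z ] 𝒵 z × ℝ[x].evaluate f (λ i → fromℤ (lookup z i)) ≈ℝ y

{-# OPTIONS --safe #-}

-- Write F(x) = ∏ Lᵢ(x) for the factored form.  It suffices to find integer vectors in the
-- common kernel of the Lᵢ: whenever the first k > n columns of the coefficient matrix are
-- the only nonzero ones, an integer kernel vector supported on the first k coordinates is
-- moved by elementary operations to a multiple of the k-th unit vector, which removes a column.
--
-- Counting dimensions gives a complex kernel vector, and since F is real (conjugating a
-- translation that preserves F gives another one) a real one, w.  Dirichlet approximation
-- yields integer vectors v close to multiples of w, so that all Lᵢ(v) are small; suppose none
-- of them lies in the kernel.  If wⱼ = 0 for some j, then vⱼ = 0, and for p in the orbit with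
-- pⱼ ≠ 0 and all Lᵢ(p) ≠ 0 the vectors p + r pⱼ v, 0 ≤ r ≤ n, lie in the orbit; one of them
-- has a value different from F(p), since ∏ (Lᵢ(p) + t pⱼ Lᵢ(v)) is not constant in t, and so
-- F(p) is an accumulation point.  A rational relation among the entries of w reduces to this
-- case.  If there is none, the primitive parts of the v give values that tend to 0 without
-- vanishing, because Lᵢ(v) = 0 implies φ(v) = 0 for some rational φ ≠ 0, whereas φ(w) ≠ 0.
module Submission where

open import Defs
open import Algebra.Bundles using (CommutativeRing)
open import Algebra.Bundles.Raw using (RawRing)
import Algebra.Definitions.RawSemiring
import Algebra.Properties.CommutativeMonoid.Sum
import Algebra.Properties.Ring
import Algebra.Properties.Semiring.Sum
import Algebra.Solver.Ring
open import Algebra.Solver.Ring.AlmostCommutativeRing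
  using (fromCommutativeRing; _-Raw-AlmostCommutative⟶_)
open import Algebra.Structures using (IsCommutativeRing)
open import Data.Bool.Base using (if_then_else_)
open import Data.Empty using (⊥; ⊥-elim)
open import Data.Fin.Base as Fin using
  (Fin; zero; suc; toℕ; fromℕ<; inject₁; punchIn; punchOut; splitAt; _↑ˡ_; _↑ʳ_; funToFin; finToFun)
import Data.Fin.Properties as Fin
open import Data.Integer.Base as ℤ using (ℤ; 0ℤ)
import Data.Integer.DivMod as ℤ
import Data.Integer.Properties as ℤ
open import Data.List.Base as List using (List; []; _∷_; _++_; [_]; length)
open import Data.Maybe.Base as Maybe using ()
open import Data.Nat.Base as ℕ using (ℕ; zero; suc)
open import Data.Nat.Induction using (<-wellFounded)
import Data.Nat.Properties as ℕ
open import Data.Product.Base using (_×_; _,_; proj₁; proj₂; ∃-syntax; Σ-syntax)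
import Data.Rational.Properties as ℚ
import Data.Rational.Solver
import Data.Rational.Unnormalised.Base as ℚᵘ
import Data.Rational.Unnormalised.Properties as ℚᵘ
open import Data.Sum.Base as Sum using (_⊎_; inj₁; inj₂; [_,_]′)
open import Data.Unit.Base using (⊤; tt)
open import Data.Vec.Base as Vec using (Vec; []; _∷_; lookup; replicate; zipWith; tabulate)
import Data.Vec.Functional as F
open import Data.Vec.Functional using (updateAt; insertAt)
open import Data.Vec.Functional.Properties
  using (updateAt-updates; updateAt-minimal; insertAt-lookup; insertAt-punchIn)
import Data.Vec.Properties as Vec
open import Function.Base using (_∘_; const; id)
open import Induction.WellFounded using (Acc; acc)
open import Level using (0ℓ)
open import Relation.Binary.Definitions using (tri<; tri≈; tri>)
open import Relation.Binary.PropositionalEquality as ≡ using (_≡_; _≢_)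
import Relation.Binary.Reasoning.Setoid
open import Relation.Nullary using (¬_; Dec; yes; no; does)
open import Relation.Nullary.Decidable using (dec⇒maybe; ¬?; _×-dec_)
open import Relation.Unary using (Pred)

-- Every change of coordinates is a list of integer elementary operations, so inverse, transpose and
-- determinant 1 come with the list instead of from general matrix theory, and one list can be read
-- over the integers, the rationals and the complex numbers alike. The final `g` is such a list read
-- over the rationals. The type of an operation names the set of coordinates it may touch, which
-- keeps columns already cleared at zero.
--
-- The kernel vector must be real because multiples of it are approximated by integer vectors. That
-- its conjugate lies in the kernel is not formal: conjugation may permute and rescale the factors,
-- and only the product F is known to be invariant. Likewise only the values of F, not those of
-- single factors, are known to be discrete, so smallness of the Lᵢ(v) says nothing until a value of
-- F is exhibited that really differs from the limit.
--
-- Linear independence enters through the Lᵢ being nonzero: then their zero hyperplanes cannot cover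
-- the orbit. The core argument runs over any ring with the structure collected in `Setting`; Cauchy
-- sequences appear only where ℝ and ℂ are fitted to it.

IsCommutative : RawRing 0ℓ 0ℓ → Set
IsCommutative R = IsCommutativeRing _≈_ _+_ _*_ -_ 0# 1#
  where open RawRing R

bundle : (R : RawRing 0ℓ 0ℓ) → IsCommutative R → CommutativeRing 0ℓ 0ℓ
bundle R isCommutativeRing = record { isCommutativeRing = isCommutativeRing }

-- Elementary operations, and the index maps of minors.

-- Adds coefficient times the entry source to the entry target.
record Op {m} (S : Fin m → Set) : Set where
  constructor mkOp
  field
    source target : Fin m
    source∈ : S source
    target∈ : S target
    distinct : source ≢ target
    coefficient : ℤ

module _ {m} {S : Fin m → Set} where

  -- Transpose and inverse of the elementary matrix. Both reverse the order of a product, hence the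
  -- appending in the list versions.
  _ᵀ _⁻ : Op S → Op S
  (mkOp s t s∈ t∈ s≢t c) ᵀ = mkOp t s t∈ s∈ (s≢t ∘ ≡.sym) c
  (mkOp s t s∈ t∈ s≢t c) ⁻ = mkOp s t s∈ t∈ s≢t (ℤ.- c)

  _ᵀ* _⁻* : List (Op S) → List (Op S)
  [] ᵀ* = []
  (o ∷ os) ᵀ* = os ᵀ* ++ [ o ᵀ ]
  [] ⁻* = []
  (o ∷ os) ⁻* = os ⁻* ++ [ o ⁻ ]

-- Serves the induction in `det-adjacent`: a pair of equal adjacent columns stays such a pair in a
-- minor that omits a third column.
punchIn-adjacent : ∀ {m} (j : Fin (suc (suc m))) (e : Fin (suc m)) →
  j ≢ inject₁ e → j ≢ suc e →
  ∃[ e′ ] punchIn j (inject₁ e′) ≡ inject₁ e × punchIn j (suc e′) ≡ suc e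
punchIn-adjacent zero zero p q = ⊥-elim (p ≡.refl)
punchIn-adjacent zero (suc e) p q = e , ≡.refl , ≡.refl
punchIn-adjacent (suc zero) zero p q = ⊥-elim (q ≡.refl)
punchIn-adjacent {suc m} (suc (suc j)) zero p q = zero , ≡.refl , ≡.refl
punchIn-adjacent {suc m} (suc j) (suc e) p q =
  let e′ , x , y = punchIn-adjacent j e (p ∘ ≡.cong suc) (q ∘ ≡.cong suc)
  in suc e′ , ≡.cong suc x , ≡.cong suc y

-- Compares the minors that omit one of two adjacent columns: they differ only in that each keeps
-- the column the other omits. If these columns are equal, so are the minors.
punchIn-skip : ∀ {m} (e : Fin m) (k : Fin m) →
  punchIn (inject₁ e) k ≡ punchIn (suc e) k ⊎
  (punchIn (inject₁ e) k ≡ suc e × punchIn (suc e) k ≡ inject₁ e)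
punchIn-skip zero zero = inj₂ (≡.refl , ≡.refl)
punchIn-skip zero (suc k) = inj₁ ≡.refl
punchIn-skip (suc e) zero = inj₁ ≡.refl
punchIn-skip (suc e) (suc k) with punchIn-skip e k
... | inj₁ x = inj₁ (≡.cong suc x)
... | inj₂ (x , y) = inj₂ (≡.cong suc x , ≡.cong suc y)

-- Lets a column update commute with passing to a minor, as the inductive step of `det-column`
-- requires.
updateAt-punchIn : ∀ {A : Set} {m} (x : Fin (suc m) → A) (d j : Fin (suc m)) (j≢d : j ≢ d) f k →
  updateAt x d f (punchIn j k) ≡ updateAt (x ∘ punchIn j) (punchOut j≢d) f k
updateAt-punchIn x d j j≢d f k with k Fin.≟ punchOut j≢d
... | yes ≡.refl rewrite Fin.punchIn-punchOut j≢d =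
  ≡.trans (updateAt-updates d x)
    (≡.sym (≡.trans (updateAt-updates (punchOut j≢d) (x ∘ punchIn j))
      (≡.cong (f ∘ x) (Fin.punchIn-punchOut j≢d))))
... | no k≢ = ≡.trans
  (updateAt-minimal (punchIn j k) d x
    (λ e → k≢ (Fin.punchIn-injective j k _ (≡.trans e (≡.sym (Fin.punchIn-punchOut j≢d))))))
  (≡.sym (updateAt-minimal k (punchOut j≢d) (x ∘ punchIn j) k≢))

-- Linear algebra over a commutative ring that receives the integers.

module LinearAlgebraOver (R : CommutativeRing 0ℓ 0ℓ)
  (morphism : ℤ.+-*-rawRing -Raw-AlmostCommutative⟶ fromCommutativeRing R) where

  open Op
  open CommutativeRing R hiding (zero)
  open _-Raw-AlmostCommutative⟶_ morphism public
    using (+-homo; *-homo; -‿homo; 0-homo; 1-homo) renaming (⟦_⟧ to ι)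
  open Algebra.Properties.Ring ring using (-0#≈0#)
  open Algebra.Properties.Semiring.Sum semiring
  open LinearAlgebra rawRing

  ι-cong : ∀ {a b} → a ≡ b → ι a ≈ ι b
  ι-cong e = reflexive (≡.cong ι e)

  module Solver = Algebra.Solver.Ring ℤ.+-*-rawRing (fromCommutativeRing R) morphism
    (λ x y → Maybe.map ι-cong (dec⇒maybe (x ℤ.≟ y)))

  open import Relation.Binary.Reasoning.Setoid setoid

  sum-cong : ∀ {n} {f g : Fin n → Carrier} → (∀ i → f i ≈ g i) → sum f ≈ sum g
  sum-cong = sum-cong-≋

  sum-0 : ∀ {n} {f : Fin n → Carrier} → (∀ i → f i ≈ 0#) → sum f ≈ 0#
  sum-0 {n} e = trans (sum-cong e) (sum-replicate-zero n)

  ⟨_,_⟩ : ∀ {m} → (Fin m → Carrier) → (Fin m → Carrier) → Carrier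
  ⟨ φ , x ⟩ = sum λ j → φ j * x j

  ⟨⟩-cong : ∀ {m} {φ ψ x y : Fin m → Carrier} → (∀ i → φ i ≈ ψ i) → (∀ i → x i ≈ y i) → ⟨ φ , x ⟩ ≈ ⟨ ψ , y ⟩
  ⟨⟩-cong p q = sum-cong λ i → *-cong (p i) (q i)

  ⟨⟩-congʳ : ∀ {m} {φ x y : Fin m → Carrier} → (∀ i → x i ≈ y i) → ⟨ φ , x ⟩ ≈ ⟨ φ , y ⟩
  ⟨⟩-congʳ = ⟨⟩-cong λ _ → refl

  ⟨⟩-comm : ∀ {m} (φ x : Fin m → Carrier) → ⟨ φ , x ⟩ ≈ ⟨ x , φ ⟩
  ⟨⟩-comm φ x = sum-cong λ i → *-comm (φ i) (x i)

  ⟨⟩-+ʳ : ∀ {m} (φ x y : Fin m → Carrier) → ⟨ φ , (λ i → x i + y i) ⟩ ≈ ⟨ φ , x ⟩ + ⟨ φ , y ⟩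
  ⟨⟩-+ʳ {m} φ x y = trans (sum-cong {m} λ i → distribˡ (φ i) (x i) (y i))
    (∑-distrib-+ (λ i → φ i * x i) (λ i → φ i * y i))

  ⟨⟩-*ʳ : ∀ {m} (φ : Fin m → Carrier) c x → ⟨ φ , (λ i → c * x i) ⟩ ≈ c * ⟨ φ , x ⟩
  ⟨⟩-*ʳ {m} φ c x = trans
    (sum-cong {m} λ i → solve 3 (λ a b d → a :* (b :* d) := b :* (a :* d)) refl (φ i) c (x i))
    (sym (*-distribˡ-sum c (λ i → φ i * x i)))
    where open Solver

  ⟨⟩-*ˡ : ∀ {m} c (φ x : Fin m → Carrier) → c * ⟨ φ , x ⟩ ≈ ⟨ (λ i → c * φ i) , x ⟩
  ⟨⟩-*ˡ {m} c φ x = trans (*-distribˡ-sum c (λ i → φ i * x i)) (sum-cong {m} λ i → sym (*-assoc c (φ i) (x i)))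

  ⟨⟩-updateAt : ∀ {m} (φ x : Fin m → Carrier) d a →
    ⟨ updateAt φ d (_+ a) , x ⟩ ≈ ⟨ φ , x ⟩ + a * x d
  ⟨⟩-updateAt φ x zero a = solve 4 (λ p a x s → (p :+ a) :* x :+ s := p :* x :+ s :+ a :* x) refl
    (φ zero) a (x zero) _
    where open Solver
  ⟨⟩-updateAt φ x (suc d) a = trans (+-congˡ (⟨⟩-updateAt (φ ∘ suc) (x ∘ suc) d a)) (sym (+-assoc _ _ _))

  1ᴹ-diagonal : ∀ {m} (i : Fin m) → 1ᴹ i i ≈ 1#
  1ᴹ-diagonal i with i Fin.≟ i
  ... | yes _ = refl
  ... | no i≢i = ⊥-elim (i≢i ≡.refl)

  ⟨1ᴹ,⟩ : ∀ {m} (i : Fin m) x → ⟨ 1ᴹ i , x ⟩ ≈ x i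
  ⟨1ᴹ,⟩ {suc m} zero x = trans (+-cong (*-identityˡ _) (sum-0 {m} λ j → zeroˡ (x (suc j)))) (+-identityʳ _)
  ⟨1ᴹ,⟩ (suc i) x = trans (+-cong (zeroˡ _) (⟨1ᴹ,⟩ i (x ∘ suc))) (+-identityˡ _)

  ⟨,1ᴹ⟩ : ∀ {m} (x : Fin m → Carrier) k → ⟨ x , (λ j → 1ᴹ j k) ⟩ ≈ x k
  ⟨,1ᴹ⟩ {suc m} x zero = trans (+-cong (*-identityʳ _) (sum-0 {m} λ j → zeroʳ (x (suc j)))) (+-identityʳ _)
  ⟨,1ᴹ⟩ x (suc k) = trans (+-cong (zeroʳ _) (⟨,1ᴹ⟩ (x ∘ suc) k)) (+-identityˡ _)

  -- Elementary operations

  module _ {m} {S : Fin m → Set} where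

    act : Op S → (Fin m → Carrier) → Fin m → Carrier
    act o x = updateAt x (target o) (_+ ι (coefficient o) * x (source o))

    acts : List (Op S) → (Fin m → Carrier) → Fin m → Carrier
    acts [] x = x
    acts (o ∷ os) x = acts os (act o x)

    act-target : ∀ o x → act o x (target o) ≡ x (target o) + ι (coefficient o) * x (source o)
    act-target o x = updateAt-updates (target o) x

    act-other : ∀ o x {k} → k ≢ target o → act o x k ≡ x k
    act-other o x {k} k≢t = updateAt-minimal k (target o) x k≢t

    act-cong : ∀ o {x y} → (∀ i → x i ≈ y i) → ∀ i → act o x i ≈ act o y i
    act-cong o {x} {y} e i with i Fin.≟ target o
    ... | yes ≡.refl rewrite act-target o x | act-target o y = +-cong (e _) (*-congˡ (e _))
    ... | no i≢ rewrite act-other o x i≢ | act-other o y i≢ = e i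

    acts-cong : ∀ os {x y} → (∀ i → x i ≈ y i) → ∀ i → acts os x i ≈ acts os y i
    acts-cong [] e = e
    acts-cong (o ∷ os) e = acts-cong os (act-cong o e)

    acts-++ : ∀ os ps x i → acts (os ++ ps) x i ≡ acts ps (acts os x) i
    acts-++ [] ps x i = ≡.refl
    acts-++ (o ∷ os) ps x i = acts-++ os ps (act o x) i

    -- The source differs from the target, so it is unchanged and the same multiple is subtracted
    -- again.
    act-⁻ : ∀ o x i → act (o ⁻) (act o x) i ≈ x i
    act-⁻ o x i with i Fin.≟ target o
    ... | yes ≡.refl rewrite act-target (o ⁻) (act o x) | act-target o x | act-other o x (distinct o) =
      trans (+-congˡ (*-congʳ (-‿homo (coefficient o))))
        (solve 3 (λ a c b → a :+ c :* b :+ :- c :* b := a) refl (x (target o)) (ι (coefficient o)) (x (source o)))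
      where open Solver
    ... | no i≢ rewrite act-other (o ⁻) (act o x) i≢ | act-other o x i≢ = refl

    acts-⁻ : ∀ os x i → acts (os ⁻*) (acts os x) i ≈ x i
    acts-⁻ [] x i = refl
    acts-⁻ (o ∷ os) x i = begin
      acts (os ⁻* ++ [ o ⁻ ]) (acts os (act o x)) i
        ≡⟨ acts-++ (os ⁻*) [ o ⁻ ] _ i ⟩
      act (o ⁻) (acts (os ⁻*) (acts os (act o x))) i
        ≈⟨ act-cong (o ⁻) (acts-⁻ os (act o x)) i ⟩
      act (o ⁻) (act o x) i
        ≈⟨ act-⁻ o x i ⟩
      x i ∎

    ⁻-act : ∀ o x i → act o (act (o ⁻) x) i ≈ x i
    ⁻-act o x i with i Fin.≟ target o
    ... | yes ≡.refl rewrite act-target o (act (o ⁻) x) | act-target (o ⁻) x | act-other (o ⁻) x (distinct o) =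
      trans (+-congʳ (+-congˡ (*-congʳ (-‿homo (coefficient o)))))
        (solve 3 (λ a c b → a :+ :- c :* b :+ c :* b := a) refl (x (target o)) (ι (coefficient o)) (x (source o)))
      where open Solver
    ... | no i≢ rewrite act-other o (act (o ⁻) x) i≢ | act-other (o ⁻) x i≢ = refl

    ⁻-acts : ∀ os x i → acts os (acts (os ⁻*) x) i ≈ x i
    ⁻-acts [] x i = refl
    ⁻-acts (o ∷ os) x i = begin
      acts os (act o (acts (os ⁻* ++ [ o ⁻ ]) x)) i
        ≈⟨ acts-cong os (act-cong o (λ j → reflexive (acts-++ (os ⁻*) [ o ⁻ ] x j))) i ⟩
      acts os (act o (act (o ⁻) (acts (os ⁻*) x))) i
        ≈⟨ acts-cong os (⁻-act o _) i ⟩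
      acts os (acts (os ⁻*) x) i
        ≈⟨ ⁻-acts os x i ⟩
      x i ∎

    act-sum : ∀ {n} o (a : Fin n → Carrier) (x : Fin n → Fin m → Carrier) i →
      act o (λ k → sum λ j → a j * x j k) i ≈ sum λ j → a j * act o (x j) i
    act-sum {n} o a x i with i Fin.≟ target o
    ... | yes ≡.refl rewrite act-target o (λ k → sum λ j → a j * x j k) = begin
      X + c * sum (λ j → a j * x j (source o))
        ≈⟨ +-congˡ (*-distribˡ-sum c (λ j → a j * x j (source o))) ⟩
      X + sum (λ j → c * (a j * x j (source o)))
        ≈⟨ ∑-distrib-+ (λ j → a j * x j (target o)) (λ j → c * (a j * x j (source o))) ⟨
      sum (λ j → a j * x j (target o) + c * (a j * x j (source o)))
        ≈⟨ sum-cong (λ j → trans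
             (solve 4 (λ a x c y → a :* x :+ c :* (a :* y) := a :* (x :+ c :* y)) refl
               (a j) (x j (target o)) c (x j (source o)))
             (*-congˡ (reflexive (≡.sym (act-target o (x j)))))) ⟩
      sum (λ j → a j * act o (x j) (target o)) ∎
      where
      open Solver
      c = ι (coefficient o)
      X = sum λ j → a j * x j (target o)
    ... | no i≢ rewrite act-other o (λ k → sum λ j → a j * x j k) i≢ =
      sum-cong λ j → *-congˡ (reflexive (≡.sym (act-other o (x j) i≢)))

    acts-sum : ∀ {n} os (a : Fin n → Carrier) (x : Fin n → Fin m → Carrier) i →
      acts os (λ k → sum λ j → a j * x j k) i ≈ sum λ j → a j * acts os (x j) i
    acts-sum [] a x i = refl
    acts-sum (o ∷ os) a x i = trans (acts-cong os (act-sum o a x) i) (acts-sum os a (act o ∘ x) i)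

    act-* : ∀ o a x i → act o (λ k → a * x k) i ≈ a * act o x i
    act-* o a x i = begin
      act o (λ k → a * x k) i            ≈⟨ act-cong o (λ k → sym (+-identityʳ _)) i ⟩
      act o (λ k → a * x k + 0#) i       ≈⟨ act-sum {1} o (const a) (const x) i ⟩
      a * act o x i + 0#                 ≈⟨ +-identityʳ _ ⟩
      a * act o x i ∎

    acts-* : ∀ os a x i → acts os (λ k → a * x k) i ≈ a * acts os x i
    acts-* [] a x i = refl
    acts-* (o ∷ os) a x i = trans (acts-cong os (act-* o a x) i) (acts-* os a (act o x) i)

    acts-0 : ∀ os {x} → (∀ i → x i ≈ 0#) → ∀ i → acts os x i ≈ 0#
    acts-0 os {x} e i = begin
      acts os x i                ≈⟨ acts-cong os (λ k → trans (e k) (sym (zeroˡ 0#))) i ⟩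
      acts os (λ k → 0# * 0#) i  ≈⟨ acts-* os 0# (const 0#) i ⟩
      0# * acts os (const 0#) i  ≈⟨ zeroˡ _ ⟩
      0# ∎

    -- The reason for the index `S` of an operation: columns outside `S` that have been cleared
    -- remain zero.
    acts-outside : ∀ os x {k} → ¬ S k → acts os x k ≡ x k
    acts-outside [] x k∉ = ≡.refl
    acts-outside (o ∷ os) x k∉ = ≡.trans (acts-outside os (act o x) k∉)
      (act-other o x λ { ≡.refl → k∉ (target∈ o) })

    -- Both sides exceed ⟨ φ , x ⟩ by the coefficient times φ at the source times x at the target.
    act-adjoint : ∀ o φ x → ⟨ act o φ , x ⟩ ≈ ⟨ φ , act (o ᵀ) x ⟩
    act-adjoint o φ x = begin
      ⟨ act o φ , x ⟩
        ≈⟨ ⟨⟩-updateAt φ x (target o) _ ⟩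
      ⟨ φ , x ⟩ + c * φ (source o) * x (target o)
        ≈⟨ +-cong (⟨⟩-comm φ x) (solve 3 (λ c a b → c :* a :* b := c :* b :* a) refl c _ _) ⟩
      ⟨ x , φ ⟩ + c * x (target o) * φ (source o)
        ≈⟨ ⟨⟩-updateAt x φ (source o) _ ⟨
      ⟨ act (o ᵀ) x , φ ⟩
        ≈⟨ ⟨⟩-comm _ φ ⟩
      ⟨ φ , act (o ᵀ) x ⟩ ∎
      where
      open Solver
      c = ι (coefficient o)

    acts-adjoint : ∀ os φ x → ⟨ acts os φ , x ⟩ ≈ ⟨ φ , acts (os ᵀ*) x ⟩
    acts-adjoint [] φ x = refl
    acts-adjoint (o ∷ os) φ x = begin
      ⟨ acts os (act o φ) , x ⟩            ≈⟨ acts-adjoint os (act o φ) x ⟩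
      ⟨ act o φ , acts (os ᵀ*) x ⟩         ≈⟨ act-adjoint o φ _ ⟩
      ⟨ φ , act (o ᵀ) (acts (os ᵀ*) x) ⟩   ≈⟨ ⟨⟩-congʳ (λ i → reflexive (acts-++ (os ᵀ*) [ o ᵀ ] x i)) ⟨
      ⟨ φ , acts (os ᵀ* ++ [ o ᵀ ]) x ⟩ ∎

    -- The rows are the images of the unit vectors, so `acts os` multiplies row vectors by this
    -- matrix from the right. On columns the matrix acts through the transposed list.
    matrixOf : List (Op S) → Matrix Carrier m
    matrixOf os i = acts os (1ᴹ i)

    acts-matrixOf : ∀ os x k → sum (λ j → x j * matrixOf os j k) ≈ acts os x k
    acts-matrixOf os x k = trans (sym (acts-sum os x 1ᴹ k)) (acts-cong os (⟨,1ᴹ⟩ x) k)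

  ⟨matrixOf,⟩ : ∀ {m} {S : Fin m → Set} (os : List (Op S)) x i → ⟨ matrixOf os i , x ⟩ ≈ acts (os ᵀ*) x i
  ⟨matrixOf,⟩ os x i = trans (acts-adjoint os (1ᴹ i) x) (⟨1ᴹ,⟩ i (acts (os ᵀ*) x))

  ⁻*-*ˡ : ∀ {m} {S : Fin m → Set} (os : List (Op S)) → matrixOf (os ⁻*) *ᴹ matrixOf os ≈ᴹ 1ᴹ
  ⁻*-*ˡ os i k = trans (acts-matrixOf os (matrixOf (os ⁻*) i) k) (⁻-acts os (1ᴹ i) k)

  ⁻*-*ʳ : ∀ {m} {S : Fin m → Set} (os : List (Op S)) → matrixOf os *ᴹ matrixOf (os ⁻*) ≈ᴹ 1ᴹ
  ⁻*-*ʳ os i k = trans (acts-matrixOf (os ⁻*) (matrixOf os i) k) (acts-⁻ os (1ᴹ i) k)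

  -- Determinants

  alternate-cong : ∀ k {x y} → x ≈ y → alternate k x ≈ alternate k y
  alternate-cong zero e = e
  alternate-cong (suc k) e = -‿cong (alternate-cong k e)

  alternate-+* : ∀ k c x y → alternate k (x + c * y) ≈ alternate k x + c * alternate k y
  alternate-+* zero c x y = refl
  alternate-+* (suc k) c x y = trans (-‿cong (alternate-+* k c x y))
    (solve 3 (λ x c y → :- (x :+ c :* y) := :- x :+ c :* :- y) refl _ c _)
    where open Solver

  alternate-0 : ∀ k {x} → x ≈ 0# → alternate k x ≈ 0#
  alternate-0 zero e = e
  alternate-0 (suc k) e = trans (-‿cong (alternate-0 k e)) -0#≈0#

  minor : ∀ {m} → Matrix Carrier (suc m) → Fin (suc m) → Matrix Carrier m
  minor A j i k = A (suc i) (punchIn j k)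

  det-cong : ∀ {m} {A B : Matrix Carrier m} → A ≈ᴹ B → det A ≈ det B
  det-cong {zero} e = refl
  det-cong {suc m} e = sum-cong λ j → alternate-cong (toℕ j)
    (*-cong (e zero j) (det-cong λ i k → e (suc i) (punchIn j k)))

  det-1ᴹ : ∀ m → det (1ᴹ {m}) ≈ 1#
  det-1ᴹ zero = refl
  det-1ᴹ (suc m) = trans
    (+-cong (trans (*-identityˡ _) (det-1ᴹ m))
      (sum-0 {m} λ j → alternate-0 (toℕ (suc j)) (zeroˡ (det (minor 1ᴹ (suc j))))))
    (+-identityʳ _)

  -- Induction along the first row: the minor without column d does not see the change, and each
  -- other minor undergoes the same change in one column.
  det-column : ∀ {m} (A : Matrix Carrier m) d c (a : Fin m → Carrier) →
    det (λ i → updateAt (A i) d (_+ c * a i)) ≈ det A + c * det (λ i → updateAt (A i) d (const (a i)))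
  det-column {suc m} A d c a = begin
    sum (λ j → alternate (toℕ j) (A₊ zero j * det (minor A₊ j)))
      ≈⟨ sum-cong (λ j → trans (alternate-cong (toℕ j) (term j)) (alternate-+* (toℕ j) c _ _)) ⟩
    sum (λ j → T j + c * T₌ j)
      ≈⟨ ∑-distrib-+ T (λ j → c * T₌ j) ⟩
    sum T + sum (λ j → c * T₌ j)
      ≈⟨ +-congˡ (*-distribˡ-sum c T₌) ⟨
    sum T + c * sum T₌ ∎
    where
    open Solver
    A₊ A₌ : Matrix Carrier (suc m)
    A₊ i = updateAt (A i) d (_+ c * a i)
    A₌ i = updateAt (A i) d (const (a i))
    T T₌ : Fin (suc m) → Carrier
    T j = alternate (toℕ j) (A zero j * det (minor A j))
    T₌ j = alternate (toℕ j) (A₌ zero j * det (minor A₌ j))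
    term : ∀ j → A₊ zero j * det (minor A₊ j) ≈ A zero j * det (minor A j) + c * (A₌ zero j * det (minor A₌ j))
    term j with j Fin.≟ d
    ... | yes ≡.refl = begin
      A₊ zero d * det (minor A₊ d)
        ≈⟨ *-cong (reflexive (updateAt-updates d (A zero))) (det-cong (same (λ i → _+ c * a i))) ⟩
      (A zero d + c * a zero) * det (minor A d)
        ≈⟨ solve 4 (λ x c y z → (x :+ c :* y) :* z := x :* z :+ c :* (y :* z)) refl _ c _ _ ⟩
      A zero d * det (minor A d) + c * (a zero * det (minor A d))
        ≈⟨ +-congˡ (*-congˡ (*-cong (reflexive (updateAt-updates d (A zero))) (det-cong (same (λ i → const (a i)))))) ⟨
      A zero d * det (minor A d) + c * (A₌ zero d * det (minor A₌ d)) ∎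
      where
      same : ∀ (f : Fin (suc m) → Carrier → Carrier) → minor (λ i → updateAt (A i) d (f i)) d ≈ᴹ minor A d
      same f i k = reflexive (updateAt-minimal (punchIn d k) d (A (suc i)) (Fin.punchInᵢ≢i d k))
    ... | no j≢d = begin
      A₊ zero j * det (minor A₊ j)
        ≈⟨ *-cong (reflexive (updateAt-minimal j d (A zero) j≢d))
             (trans (det-cong (λ i k → reflexive (updateAt-punchIn (A (suc i)) d j j≢d _ k)))
                    (det-column (minor A j) (punchOut j≢d) c (a ∘ suc))) ⟩
      A zero j * (det (minor A j) + c * det (λ i → updateAt (minor A j i) (punchOut j≢d) (const (a (suc i)))))
        ≈⟨ solve 4 (λ x y c z → x :* (y :+ c :* z) := x :* y :+ c :* (x :* z)) refl _ _ c _ ⟩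
      A zero j * det (minor A j) + c * (A zero j * det (λ i → updateAt (minor A j i) (punchOut j≢d) (const (a (suc i)))))
        ≈⟨ +-congˡ (*-congˡ (*-cong (reflexive (updateAt-minimal j d (A zero) j≢d))
             (det-cong (λ i k → reflexive (updateAt-punchIn (A (suc i)) d j j≢d _ k))))) ⟨
      A zero j * det (minor A j) + c * (A₌ zero j * det (minor A₌ j)) ∎

  sum-adjacent : ∀ {m} (e : Fin m) (t : Fin (suc m) → Carrier) →
    (∀ j → j ≢ inject₁ e → j ≢ suc e → t j ≈ 0#) → t (inject₁ e) + t (suc e) ≈ 0# → sum t ≈ 0#
  sum-adjacent zero t off on = begin
    t zero + (t (suc zero) + sum (λ j → t (suc (suc j))))
      ≈⟨ +-congˡ (+-congˡ (sum-0 λ j → off (suc (suc j)) (λ ()) (λ ()))) ⟩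
    t zero + (t (suc zero) + 0#)
      ≈⟨ +-congˡ (+-identityʳ _) ⟩
    t zero + t (suc zero)
      ≈⟨ on ⟩
    0# ∎
  sum-adjacent (suc e) t off on = trans
    (+-cong (off zero (λ ()) (λ ()))
      (sum-adjacent e (t ∘ suc) (λ j p q → off (suc j) (p ∘ Fin.suc-injective) (q ∘ Fin.suc-injective)) on))
    (+-identityʳ _)

  -- In the expansion along the first row the minors that keep both columns vanish by induction. The
  -- two remaining minors are equal and carry opposite signs.
  det-adjacent : ∀ {m} (A : Matrix Carrier (suc m)) (e : Fin m) →
    (∀ i → A i (inject₁ e) ≈ A i (suc e)) → det A ≈ 0#
  det-adjacent {suc m} A e equal = sum-adjacent e _ off on
    where
    off : ∀ j → j ≢ inject₁ e → j ≢ suc e → alternate (toℕ j) (A zero j * det (minor A j)) ≈ 0#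
    off j p q = alternate-0 (toℕ j) (trans (*-congˡ (vanish m A e j p q equal)) (zeroʳ _))
      where
      vanish : ∀ m (A : Matrix Carrier (suc (suc m))) e j → j ≢ inject₁ e → j ≢ suc e →
        (∀ i → A i (inject₁ e) ≈ A i (suc e)) → det (minor A j) ≈ 0#
      vanish m A e j p q equal with punchIn-adjacent j e p q
      -- In the case left out no third column exists, and `e′` would lie in `Fin 0`.
      vanish (suc m) A e j p q equal | e′ , x , y = det-adjacent (minor A j) e′ λ i →
        trans (reflexive (≡.cong (A (suc i)) x)) (trans (equal (suc i)) (reflexive (≡.cong (A (suc i)) (≡.sym y))))
    minors : minor A (inject₁ e) ≈ᴹ minor A (suc e)
    minors i k with punchIn-skip e k
    ... | inj₁ x = reflexive (≡.cong (A (suc i)) x)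
    ... | inj₂ (x , y) = trans (reflexive (≡.cong (A (suc i)) x))
      (trans (sym (equal (suc i))) (reflexive (≡.cong (A (suc i)) (≡.sym y))))
    on : alternate (toℕ (inject₁ e)) (A zero (inject₁ e) * det (minor A (inject₁ e))) +
         alternate (toℕ (suc e)) (A zero (suc e) * det (minor A (suc e))) ≈ 0#
    on rewrite Fin.toℕ-inject₁ e = trans
      (+-congʳ (alternate-cong (toℕ e) (*-cong (equal zero) (det-cong minors))))
      (-‿inverseʳ _)

  Shear : ∀ {m} → Fin m → Fin m → Set
  Shear {m} s d = ∀ c (A : Matrix Carrier m) →
    det (λ i → updateAt (A i) d (_+ c * A i s)) ≈ det A

  -- By `det-column` the change is c times a determinant whose columns s and d agree.
  shear-of-equal-columns : ∀ {m} {s d : Fin m} → s ≢ d →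
    (∀ (A : Matrix Carrier m) → (∀ i → A i s ≈ A i d) → det A ≈ 0#) → Shear s d
  shear-of-equal-columns {s = s} {d} s≢d vanish c A = begin
    det (λ i → updateAt (A i) d (_+ c * A i s))
      ≈⟨ det-column A d c (λ i → A i s) ⟩
    det A + c * det (λ i → updateAt (A i) d (const (A i s)))
      ≈⟨ +-congˡ (*-congˡ (vanish _ λ i → reflexive (≡.trans
           (updateAt-minimal s d (A i) s≢d) (≡.sym (updateAt-updates d (A i)))))) ⟩
    det A + c * 0#
      ≈⟨ +-congˡ (zeroʳ c) ⟩
    det A + 0#
      ≈⟨ +-identityʳ _ ⟩
    det A ∎

  -- The shear from s to d is the commutator of the shears from s to u and from u to d.
  shear-trans : ∀ {m} {s u d : Fin m} → s ≢ u → u ≢ d → s ≢ d → Shear s u → Shear u d → Shear s d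
  shear-trans {m} {s} {u} {d} s≢u u≢d s≢d S₁ S₂ c A = begin
    det (λ i → updateAt (A i) d (_+ c * A i s))
      ≈⟨ det-cong (λ i k → sym (entry i k)) ⟩
    det A₄   ≈⟨ S₂ (- 1#) A₃ ⟩
    det A₃   ≈⟨ S₁ (- c) A₂ ⟩
    det A₂   ≈⟨ S₂ 1# A₁ ⟩
    det A₁   ≈⟨ S₁ c A ⟩
    det A    ∎
    where
    open Solver
    A₁ A₂ A₃ A₄ : Matrix Carrier m
    A₁ i = updateAt (A i) u (_+ c * A i s)
    A₂ i = updateAt (A₁ i) d (_+ 1# * A₁ i u)
    A₃ i = updateAt (A₂ i) u (_+ - c * A₂ i s)
    A₄ i = updateAt (A₃ i) d (_+ - 1# * A₃ i u)
    d≢u = u≢d ∘ ≡.sym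
    A₁u : ∀ i → A₁ i u ≡ A i u + c * A i s
    A₁u i = updateAt-updates u (A i)
    A₂s : ∀ i → A₂ i s ≡ A i s
    A₂s i = ≡.trans (updateAt-minimal s d (A₁ i) s≢d) (updateAt-minimal s u (A i) s≢u)
    A₂u : ∀ i → A₂ i u ≡ A i u + c * A i s
    A₂u i = ≡.trans (updateAt-minimal u d (A₁ i) u≢d) (A₁u i)
    A₂d : ∀ i → A₂ i d ≡ A i d + 1# * (A i u + c * A i s)
    A₂d i = ≡.trans (updateAt-updates d (A₁ i))
      (≡.cong₂ (λ x y → x + 1# * y) (updateAt-minimal d u (A i) d≢u) (A₁u i))
    A₃u : ∀ i → A₃ i u ≡ A i u + c * A i s + - c * A i s
    A₃u i = ≡.trans (updateAt-updates u (A₂ i)) (≡.cong₂ (λ x y → x + - c * y) (A₂u i) (A₂s i))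
    A₄d : ∀ i → A₄ i d ≡ A i d + 1# * (A i u + c * A i s) + - 1# * (A i u + c * A i s + - c * A i s)
    A₄d i = ≡.trans (updateAt-updates d (A₃ i))
      (≡.cong₂ (λ x y → x + - 1# * y) (≡.trans (updateAt-minimal d u (A₂ i) d≢u) (A₂d i)) (A₃u i))
    entry : ∀ i k → A₄ i k ≈ updateAt (A i) d (_+ c * A i s) k
    entry i k with k Fin.≟ d
    ... | yes ≡.refl rewrite A₄d i | updateAt-updates d {_+ c * A i s} (A i) =
      -- Replacing `1#` by the image of the integer 1 lets the solver treat it as a constant.
      trans (+-cong (+-congˡ (*-congʳ (sym 1-homo))) (*-congʳ (-‿cong (sym 1-homo))))
        (solve 4 (λ x u c s → x :+ con (ℤ.+ 1) :* (u :+ c :* s) :+ :- con (ℤ.+ 1) :* (u :+ c :* s :+ :- c :* s)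
          := x :+ c :* s) refl (A i d) (A i u) c (A i s))
    ... | no k≢d rewrite updateAt-minimal k d {_+ - 1# * A₃ i u} (A₃ i) k≢d
                       | updateAt-minimal k d {_+ c * A i s} (A i) k≢d with k Fin.≟ u
    ...   | yes ≡.refl rewrite A₃u i =
      solve 3 (λ u c s → u :+ c :* s :+ :- c :* s := u) refl (A i u) c (A i s)
    ...   | no k≢u rewrite updateAt-minimal k u {_+ - c * A₂ i s} (A₂ i) k≢u
                         | updateAt-minimal k d {_+ 1# * A₁ i u} (A₁ i) k≢d
                         | updateAt-minimal k u {_+ c * A i s} (A i) k≢u = refl

  inject₁≢suc : ∀ {m} (e : Fin m) → inject₁ e ≢ suc e
  inject₁≢suc (suc e) p = inject₁≢suc e (Fin.suc-injective p)

  shear-up : ∀ {m} (e : Fin m) → Shear (inject₁ e) (suc e)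
  shear-up e = shear-of-equal-columns (inject₁≢suc e) λ A → det-adjacent A e

  shear-down : ∀ {m} (e : Fin m) → Shear (suc e) (inject₁ e)
  shear-down e = shear-of-equal-columns (inject₁≢suc e ∘ ≡.sym) λ A equal → det-adjacent A e (sym ∘ equal)

  -- Equal columns are known to kill the determinant only when adjacent. Distant pairs are reached
  -- by induction on the position of d, through its left neighbour and `shear-trans`.
  shear-far : ∀ {m} n (s d : Fin (suc m)) → toℕ d ≡ n → s Fin.< d → Shear s d × Shear d s
  shear-far (suc n) s (suc d) e (ℕ.s≤s s≤d) with s Fin.≟ inject₁ d
  ... | yes ≡.refl = shear-up d , shear-down d
  ... | no s≢ =
    let up , down = shear-far n s (inject₁ d) (≡.trans (Fin.toℕ-inject₁ d) (ℕ.suc-injective e)) s<inject₁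
    in shear-trans s≢ (inject₁≢suc d) s≢suc up (shear-up d) ,
       shear-trans (inject₁≢suc d ∘ ≡.sym) (s≢ ∘ ≡.sym) (s≢suc ∘ ≡.sym) (shear-down d) down
    where
    s<inject₁ : s Fin.< inject₁ d
    s<inject₁ = ℕ.≤∧≢⇒< (≡.subst (toℕ s ℕ.≤_) (≡.sym (Fin.toℕ-inject₁ d)) s≤d) (s≢ ∘ Fin.toℕ-injective)
    s≢suc : s ≢ suc d
    s≢suc ≡.refl = ℕ.<-irrefl ≡.refl s≤d

  shear : ∀ {m} (s d : Fin m) → s ≢ d → Shear s d
  shear {suc m} s d s≢d with ℕ.<-cmp (toℕ s) (toℕ d)
  ... | tri< s<d _ _ = proj₁ (shear-far (toℕ d) s d ≡.refl s<d)
  ... | tri≈ _ s≡d _ = ⊥-elim (s≢d (Fin.toℕ-injective s≡d))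
  ... | tri> _ _ d<s = proj₂ (shear-far (toℕ s) d s ≡.refl d<s)

  det-acts : ∀ {m} {S : Fin m → Set} (os : List (Op S)) (A : Matrix Carrier m) →
    det (λ i → acts os (A i)) ≈ det A
  det-acts [] A = refl
  det-acts (o ∷ os) A = trans (det-acts os _)
    (shear (source o) (target o) (distinct o) (ι (coefficient o)) A)

  -- The list supplies `inverse` and not `matrix`, because the action on polynomials substitutes
  -- `inverse`.
  toSL : ∀ {m} {S : Fin m → Set} → List (Op S) → SL rawRing m
  toSL {m} os = record
    { matrix = matrixOf (os ⁻*) ; inverse = matrixOf os
    ; inverseˡ = ⁻*-*ʳ os ; inverseʳ = ⁻*-*ˡ os
    ; det≈1 = trans (det-acts (os ⁻*) 1ᴹ) (det-1ᴹ m) }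

-- Polynomials: evaluation, coefficients, divided differences.

module PolynomialsOver (R : CommutativeRing 0ℓ 0ℓ)
  (morphism : ℤ.+-*-rawRing -Raw-AlmostCommutative⟶ fromCommutativeRing R) where

  open CommutativeRing R hiding (zero)
  open LinearAlgebraOver R morphism hiding (sum-cong; sum-0)
  open Polynomials rawRing
  open RawRing rawRing using (rawSemiring)
  open Algebra.Definitions.RawSemiring rawSemiring using (sum; product; _^_)
  module ∏ = Algebra.Properties.CommutativeMonoid.Sum *-commutativeMonoid
  module P {m} = Algebra.Definitions.RawSemiring (poly-rawSemiring m)
  open Algebra.Properties.Ring ring using (-0#≈0#)
  open import Relation.Binary.Reasoning.Setoid setoid

  product-cong : ∀ {n} {f g : Fin n → Carrier} → (∀ i → f i ≈ g i) → product f ≈ product g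
  product-cong = ∏.sum-cong-≋

  product-zero : ∀ {n} (f : Fin n → Carrier) i → f i ≈ 0# → product f ≈ 0#
  product-zero f zero e = trans (*-congʳ e) (zeroˡ _)
  product-zero f (suc i) e = trans (*-congˡ (product-zero (f ∘ suc) i e)) (zeroʳ _)

  ^-cong : ∀ {x y} k → x ≈ y → x ^ k ≈ y ^ k
  ^-cong zero e = refl
  ^-cong (suc k) e = *-cong e (^-cong k e)

  ^-+ : ∀ x k l → x ^ (k ℕ.+ l) ≈ x ^ k * x ^ l
  ^-+ x zero l = sym (*-identityˡ _)
  ^-+ x (suc k) l = trans (*-congˡ (^-+ x k l)) (sym (*-assoc _ _ _))

  monomial : ∀ {m} → (Fin m → Carrier) → Vec ℕ m → Carrier
  monomial xs α = product λ i → xs i ^ lookup α i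

  monomial-0 : ∀ {m} (xs : Fin m → Carrier) → monomial xs (replicate m 0) ≈ 1#
  monomial-0 {zero} xs = refl
  monomial-0 {suc m} xs = trans (*-identityˡ _) (monomial-0 (xs ∘ suc))

  monomial-+ : ∀ {m} (xs : Fin m → Carrier) α β →
    monomial xs (zipWith ℕ._+_ α β) ≈ monomial xs α * monomial xs β
  monomial-+ {m} xs α β = trans
    (product-cong {m} λ i → trans
      (reflexive (≡.cong (xs i ^_) (Vec.lookup-zipWith ℕ._+_ i α β)))
      (^-+ (xs i) (lookup α i) (lookup β i)))
    (∏.∑-distrib-+ (λ i → xs i ^ lookup α i) (λ i → xs i ^ lookup β i))

  monomial-var : ∀ {m} (xs : Fin m → Carrier) (i : Fin m) →
    monomial xs (tabulate λ j → if does (i Fin.≟ j) then 1 else 0) ≈ xs i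
  monomial-var {suc m} xs zero = trans (*-cong (*-identityʳ (xs zero)) (trans
    (product-cong {m} (λ i → reflexive (≡.cong (xs (suc i) ^_) (Vec.lookup∘tabulate (const 0) i))))
    (ones m))) (*-identityʳ _)
    where
    ones : ∀ m → product {m} (const 1#) ≈ 1#
    ones zero = refl
    ones (suc m) = trans (*-identityˡ _) (ones m)
  monomial-var {suc m} xs (suc i) = trans (*-identityˡ _) (monomial-var (xs ∘ suc) i)

  evaluate-++ : ∀ {m} (p q : Poly Carrier m) xs → evaluate (p ++ q) xs ≈ evaluate p xs + evaluate q xs
  evaluate-++ [] q xs = sym (+-identityˡ _)
  evaluate-++ (_ ∷ p) q xs = trans (+-congˡ (evaluate-++ p q xs)) (sym (+-assoc _ _ _))

  private
    _*ₚ_ : ∀ {m} → Poly Carrier m → Poly Carrier m → Poly Carrier m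
    p *ₚ q = List.cartesianProductWith (λ (c , α) (d , β) → c * d , zipWith ℕ._+_ α β) p q

    evaluate-term* : ∀ {m} c α (q : Poly Carrier m) xs →
      evaluate (List.map (λ (d , β) → c * d , zipWith ℕ._+_ α β) q) xs ≈ (c * monomial xs α) * evaluate q xs
    evaluate-term* c α [] xs = sym (zeroʳ _)
    evaluate-term* c α ((d , β) ∷ q) xs = trans
      (+-cong (*-congˡ (monomial-+ xs α β)) (evaluate-term* c α q xs))
      (solve 5 (λ c d a b e → (c :* d) :* (a :* b) :+ (c :* a) :* e := (c :* a) :* (d :* b :+ e)) refl
        c d _ _ _)
      where open Solver

  evaluate-* : ∀ {m} (p q : Poly Carrier m) xs → evaluate (p *ₚ q) xs ≈ evaluate p xs * evaluate q xs
  evaluate-* [] q xs = sym (zeroˡ _)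
  evaluate-* ((c , α) ∷ p) q xs = trans (evaluate-++ (List.map _ q) _ xs)
    (trans (+-cong (evaluate-term* c α q xs) (evaluate-* p q xs)) (sym (distribʳ _ _ _)))

  evaluate-constant : ∀ {m} c (xs : Fin m → Carrier) → evaluate (constant c) xs ≈ c
  evaluate-constant c xs = trans (+-identityʳ _) (trans (*-congˡ (monomial-0 xs)) (*-identityʳ c))

  evaluate-var : ∀ {m} (i : Fin m) xs → evaluate (var i) xs ≈ xs i
  evaluate-var i xs = trans (+-identityʳ _) (trans (*-identityˡ _) (monomial-var xs i))

  evaluate-^ : ∀ {m} (p : Poly Carrier m) k xs → evaluate (p P.^ k) xs ≈ evaluate p xs ^ k
  evaluate-^ p zero xs = evaluate-constant 1# xs
  evaluate-^ p (suc k) xs = trans (evaluate-* p (p P.^ k) xs) (*-congˡ (evaluate-^ p k xs))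

  evaluate-product : ∀ {m n} (t : Fin n → Poly Carrier m) xs →
    evaluate (P.product t) xs ≈ product λ i → evaluate (t i) xs
  evaluate-product {n = zero} t xs = evaluate-constant 1# xs
  evaluate-product {n = suc n} t xs = trans (evaluate-* (t zero) _ xs) (*-congˡ (evaluate-product (t ∘ suc) xs))

  evaluate-linearForm : ∀ {m} (a : Fin m → Carrier) xs → evaluate (linearForm a) xs ≈ ⟨ a , xs ⟩
  evaluate-linearForm {m} a xs = go (λ j → constant (a j) *ₚ var j)
      (λ j → trans (evaluate-* (constant (a j)) (var j) xs) (*-cong (evaluate-constant (a j) xs) (evaluate-var j xs)))
    where
    go : ∀ {n} (t : Fin n → Poly Carrier m) {f : Fin n → Carrier} → (∀ j → evaluate (t j) xs ≈ f j) →
      evaluate (P.sum t) xs ≈ sum f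
    go {zero} t e = refl
    go {suc n} t e = trans (evaluate-++ (t zero) _ xs) (+-cong (e zero) (go (t ∘ suc) (e ∘ suc)))

  evaluate-substitute : ∀ {m k} (σ : Fin m → Poly Carrier k) p ys →
    evaluate (substitute σ p) ys ≈ evaluate p (λ i → evaluate (σ i) ys)
  evaluate-substitute σ [] ys = refl
  evaluate-substitute {m} σ ((c , α) ∷ p) ys = trans
    (evaluate-++ (constant c *ₚ P.product (λ i → σ i P.^ lookup α i)) (substitute σ p) ys)
    (+-cong
      (trans (evaluate-* (constant c) (P.product λ i → σ i P.^ lookup α i) ys)
        (*-cong (evaluate-constant c ys)
          (trans (evaluate-product (λ i → σ i P.^ lookup α i) ys)
            (product-cong {m} λ i → evaluate-^ (σ i) (lookup α i) ys))))
      (evaluate-substitute σ p ys))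

  evaluate-cong : ∀ {m} (p : Poly Carrier m) {xs ys} → (∀ i → xs i ≈ ys i) → evaluate p xs ≈ evaluate p ys
  evaluate-cong [] e = refl
  evaluate-cong {m} ((c , α) ∷ p) e =
    +-cong (*-congˡ (product-cong {m} λ i → ^-cong (lookup α i) (e i))) (evaluate-cong p e)

  coefficient-++ : ∀ {m} (p q : Poly Carrier m) α → coefficient (p ++ q) α ≈ coefficient p α + coefficient q α
  coefficient-++ [] q α = sym (+-identityˡ _)
  coefficient-++ (_ ∷ p) q α = trans (+-congˡ (coefficient-++ p q α)) (sym (+-assoc _ _ _))

  negate : ∀ {m} → Poly Carrier m → Poly Carrier m
  negate = mapCoefficients (-_)

  coefficient-negate : ∀ {m} (p : Poly Carrier m) α → coefficient (negate p) α ≈ - coefficient p α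
  coefficient-negate [] α = sym -0#≈0#
  coefficient-negate ((c , β) ∷ p) α with Vec.≡-dec ℕ._≟_ β α
  ... | yes _ = trans (+-congˡ (coefficient-negate p α)) (solve 2 (λ x y → :- x :+ :- y := :- (x :+ y)) refl _ _)
    where open Solver
  ... | no _ = trans (+-congˡ (coefficient-negate p α))
    (trans (+-identityˡ _) (-‿cong (sym (+-identityˡ _))))

  evaluate-negate : ∀ {m} (p : Poly Carrier m) xs → evaluate (negate p) xs ≈ - evaluate p xs
  evaluate-negate [] xs = sym -0#≈0#
  evaluate-negate ((c , β) ∷ p) xs = trans (+-congˡ (evaluate-negate p xs))
    (solve 3 (λ c x y → (:- c) :* x :+ :- y := :- (c :* x :+ y)) refl c _ _)
    where open Solver

  remove : ∀ {m} → Vec ℕ m → Poly Carrier m → Poly Carrier m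
  remove α [] = []
  remove α ((c , β) ∷ p) = if does (Vec.≡-dec ℕ._≟_ β α) then remove α p else (c , β) ∷ remove α p

  length-remove : ∀ {m} α (p : Poly Carrier m) → length (remove α p) ℕ.≤ length p
  length-remove α [] = ℕ.z≤n
  length-remove α ((c , β) ∷ p) with Vec.≡-dec ℕ._≟_ β α
  ... | yes _ = ℕ.m≤n⇒m≤1+n (length-remove α p)
  ... | no _ = ℕ.s≤s (length-remove α p)

  evaluate-remove : ∀ {m} α (p : Poly Carrier m) xs →
    evaluate p xs ≈ coefficient p α * monomial xs α + evaluate (remove α p) xs
  evaluate-remove α [] xs = sym (trans (+-identityʳ _) (zeroˡ _))
  evaluate-remove α ((c , β) ∷ p) xs with Vec.≡-dec ℕ._≟_ β α
  ... | yes ≡.refl = trans (+-congˡ (evaluate-remove α p xs))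
    (solve 4 (λ c x y z → c :* x :+ (y :* x :+ z) := (c :+ y) :* x :+ z) refl c _ _ _)
    where open Solver
  ... | no _ = trans (+-congˡ (evaluate-remove α p xs))
    (trans (solve 3 (λ c x z → c :+ (x :+ z) := x :+ (c :+ z)) refl _ _ _)
      (+-congʳ (*-congʳ (sym (+-identityˡ _)))))
    where open Solver

  coefficient-remove : ∀ {m} α (p : Poly Carrier m) → p ≈ₚ [] → remove α p ≈ₚ []
  coefficient-remove α p e β with Vec.≡-dec ℕ._≟_ β α
  ... | yes ≡.refl = gone p
    where
    gone : ∀ p → coefficient (remove β p) β ≈ 0#
    gone [] = refl
    gone ((c , γ) ∷ p) with Vec.≡-dec ℕ._≟_ γ β in eq
    ... | yes _ = gone p
    ... | no _ rewrite eq = trans (+-identityˡ _) (gone p)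
  ... | no β≢α = trans (kept p) (e β)
    where
    kept : ∀ p → coefficient (remove α p) β ≈ coefficient p β
    kept [] = refl
    kept ((c , γ) ∷ p) with Vec.≡-dec ℕ._≟_ γ α
    ... | no _ = +-congˡ (kept p)
    ... | yes ≡.refl with Vec.≡-dec ℕ._≟_ γ β
    ...   | yes γ≡β = ⊥-elim (β≢α (≡.sym γ≡β))
    ...   | no _ = trans (kept p) (sym (+-identityˡ _))

  -- Terms with a common exponent vector may be scattered over the list. Removing all of them at
  -- once splits off a vanishing coefficient and shortens the list, whose length is bounded by `k`.
  evaluate-≈[] : ∀ {m} k (p : Poly Carrier m) → length p ℕ.≤ k → p ≈ₚ [] → ∀ xs → evaluate p xs ≈ 0#
  evaluate-≈[] k [] _ e xs = refl
  evaluate-≈[] (suc k) p@((c , α) ∷ p′) (ℕ.s≤s l) e xs = begin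
    evaluate p xs
      ≈⟨ evaluate-remove α p xs ⟩
    coefficient p α * monomial xs α + evaluate (remove α p) xs
      ≈⟨ +-cong (trans (*-congʳ (e α)) (zeroˡ _))
           (evaluate-≈[] k (remove α p) (ℕ.≤-trans shorter l) (coefficient-remove α p e) xs) ⟩
    0# + 0#
      ≈⟨ +-identityˡ 0# ⟩
    0# ∎
    where
    shorter : length (remove α p) ℕ.≤ length p′
    shorter with Vec.≡-dec ℕ._≟_ α α
    ... | yes _ = length-remove α p′
    ... | no α≢α = ⊥-elim (α≢α ≡.refl)

  evaluate-≈ₚ : ∀ {m} (p q : Poly Carrier m) → p ≈ₚ q → ∀ xs → evaluate p xs ≈ evaluate q xs
  evaluate-≈ₚ p q e xs = begin
    evaluate p xs
      ≈⟨ solve 2 (λ x y → x := (x :+ :- y) :+ y) refl _ _ ⟩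
    evaluate p xs + - evaluate q xs + evaluate q xs
      ≈⟨ +-congʳ (trans (+-congˡ (sym (evaluate-negate q xs))) (sym (evaluate-++ p (negate q) xs))) ⟩
    evaluate (p ++ negate q) xs + evaluate q xs
      ≈⟨ +-congʳ (evaluate-≈[] (length (p ++ negate q)) (p ++ negate q) ℕ.≤-refl
           (λ α → trans (coefficient-++ p (negate q) α)
             (trans (+-cong (e α) (coefficient-negate q α)) (-‿inverseʳ _))) xs) ⟩
    0# + evaluate q xs
      ≈⟨ +-identityˡ _ ⟩
    evaluate q xs ∎
    where open Solver

  -- Functions that agree with a polynomial of degree less than N; the
  -- quotient by t - r replaces coefficients.

  IsPoly : ℕ → (Carrier → Carrier) → Set
  IsPoly zero g = ∀ t → g t ≈ 0#
  IsPoly (suc N) g = ∀ r → ∃[ q ] IsPoly N q × (∀ t → g t ≈ g r + (t - r) * q t)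

  isPoly-weaken : ∀ N {g} → IsPoly N g → IsPoly (suc N) g
  isPoly-weaken zero e r = const 0# , (λ _ → refl) , λ t →
    trans (e t) (sym (trans (+-cong (e r) (zeroʳ _)) (+-identityˡ 0#)))
  isPoly-weaken (suc N) p r = let q , pq , e = p r in q , isPoly-weaken N pq , e

  isPoly-≤ : ∀ {M N g} → M ℕ.≤′ N → IsPoly M g → IsPoly N g
  isPoly-≤ (ℕ.≤′-reflexive ≡.refl) p = p
  isPoly-≤ (ℕ.≤′-step l) p = isPoly-weaken _ (isPoly-≤ l p)

  isPoly-const : ∀ N c → IsPoly (suc N) (const c)
  isPoly-const N c r = const 0# , zeros N , λ t → sym (trans (+-congˡ (zeroʳ _)) (+-identityʳ c))
    where
    zeros : ∀ N → IsPoly N (const 0#)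
    zeros zero _ = refl
    zeros (suc N) = isPoly-const N 0#

  isPoly-+ : ∀ N {g h} → IsPoly N g → IsPoly N h → IsPoly N (λ t → g t + h t)
  isPoly-+ zero p q t = trans (+-cong (p t) (q t)) (+-identityˡ 0#)
  isPoly-+ (suc N) p q r =
    let g′ , p′ , e = p r ; h′ , q′ , f = q r
    in _ , isPoly-+ N p′ q′ , λ t → trans (+-cong (e t) (f t))
      (solve 6 (λ a b c d x y → (a :+ (x :- y) :* c) :+ (b :+ (x :- y) :* d) := a :+ b :+ (x :- y) :* (c :+ d))
        refl _ _ _ _ t r)
    where open Solver

  -- Dividing the product by t - r leaves (a + t b) q(t) + b g(r); the first summand falls under the
  -- induction hypothesis and the second is constant.
  isPoly-linear* : ∀ N a b {g} → IsPoly N g → IsPoly (suc N) (λ t → (a + t * b) * g t)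
  isPoly-linear* zero a b p r = const 0# , (λ _ → refl) , λ t → trans (vanish t)
    (sym (trans (+-cong (vanish r) (zeroʳ _)) (+-identityˡ 0#)))
    where
    vanish : ∀ t → _ ≈ 0#
    vanish t = trans (*-congˡ (p t)) (zeroʳ _)
  isPoly-linear* (suc N) a b {g} p r =
    let q , pq , e = p r
    in _ , isPoly-+ (suc N) (isPoly-linear* N a b pq) (isPoly-const N (b * g r)) , λ t →
      trans (*-congˡ (e t))
        (solve 6 (λ a b g q t r → (a :+ t :* b) :* (g :+ (t :- r) :* q)
          := (a :+ r :* b) :* g :+ (t :- r) :* ((a :+ t :* b) :* q :+ b :* g)) refl a b (g r) (q t) t r)
    where open Solver

  isPoly-scale : ∀ N c {g} → IsPoly N g → IsPoly N (λ t → c * g t)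
  isPoly-scale zero c p t = trans (*-congˡ (p t)) (zeroʳ c)
  isPoly-scale (suc N) c p r =
    let q , pq , e = p r
    in _ , isPoly-scale N c pq , λ t → trans (*-congˡ (e t))
      (solve 5 (λ c g q t r → c :* (g :+ (t :- r) :* q) := c :* g :+ (t :- r) :* (c :* q)) refl c _ _ t r)
    where open Solver

  isPoly-cong : ∀ N {g h} → (∀ t → g t ≈ h t) → IsPoly N g → IsPoly N h
  isPoly-cong zero e p t = trans (sym (e t)) (p t)
  isPoly-cong (suc N) e p r =
    let q , pq , f = p r in q , pq , λ t → trans (sym (e t)) (trans (f t) (+-congʳ (e r)))

  isPoly-product : ∀ {n} (a b : Fin n → Carrier) → IsPoly (suc n) (λ t → product λ i → a i + t * b i)
  isPoly-product {zero} a b = isPoly-const 0 1#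
  isPoly-product {suc n} a b = isPoly-linear* (suc n) (a zero) (b zero) (isPoly-product (a ∘ suc) (b ∘ suc))

  -- Roots and identities of polynomials over a domain containing the integers.

  module Domain (domain : ∀ {x y} → x * y ≈ 0# → x ≈ 0# ⊎ y ≈ 0#)
    (ι-injective : ∀ {z} → ι z ≈ 0# → z ≡ 0ℤ) where

    1≉0 : ¬ 1# ≈ 0#
    1≉0 e with () ← ι-injective (trans 1-homo e)

    ι-difference : ∀ {a b} → ι a - ι b ≈ 0# → a ≡ b
    ι-difference {a} {b} e = ℤ.i-j≡0⇒i≡j a b (ι-injective
      (trans (+-homo a (ℤ.- b)) (trans (+-congˡ (-‿homo b)) e)))

    *≉0 : ∀ {x y} → ¬ x ≈ 0# → ¬ y ≈ 0# → ¬ x * y ≈ 0#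
    *≉0 x≉0 y≉0 e with domain e
    ... | inj₁ x≈0 = x≉0 x≈0
    ... | inj₂ y≈0 = y≉0 y≈0

    cancel : ∀ {x y} → ¬ x ≈ 0# → x * y ≈ 0# → y ≈ 0#
    cancel x≉0 e with domain e
    ... | inj₁ x≈0 = ⊥-elim (x≉0 x≈0)
    ... | inj₂ y≈0 = y≈0

    product≉0 : ∀ {n} (f : Fin n → Carrier) → (∀ i → ¬ f i ≈ 0#) → ¬ product f ≈ 0#
    product≉0 {zero} f p = 1≉0
    product≉0 {suc n} f p = *≉0 (p zero) (product≉0 (f ∘ suc) (p ∘ suc))

    -- Dividing out t - r for the first root r lowers `N`. The other roots pass to the quotient,
    -- since their differences from r are nonzero and cancel.
    isPoly-roots : ∀ N {g} → IsPoly N g → (r : Fin N → Carrier) →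
      (∀ {i j} → r i - r j ≈ 0# → i ≡ j) → (∀ i → g (r i) ≈ 0#) → ∀ t → g t ≈ 0#
    isPoly-roots zero p r distinct root t = p t
    isPoly-roots (suc N) p r distinct root t =
      let q , pq , e = p (r zero)
          q-root : ∀ i → q (r (suc i)) ≈ 0#
          q-root i = cancel (λ d → Fin.0≢1+n (≡.sym (distinct d)))
            (trans (sym (trans (e _) (trans (+-congʳ (root zero)) (+-identityˡ _)))) (root (suc i)))
      in trans (e t) (trans (+-cong (root zero)
           (trans (*-congˡ (isPoly-roots N pq (r ∘ suc) (Fin.suc-injective ∘ distinct) q-root t)) (zeroʳ _)))
           (+-identityˡ 0#))

    -- Rescaling by b i makes the root - a i / b i of the i-th factor available without division.
    product-moves : ∀ {n} (a b : Fin n → Carrier) → (∀ i → ¬ a i ≈ 0#) → ∀ i → ¬ b i ≈ 0# →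
      ¬ (∀ (r : Fin (suc n)) → product (λ j → a j + ι (ℤ.+ toℕ r) * b j) ≈ product a)
    product-moves {n} a b a≉0 i β≉0 constant-product = product≉0 (λ j → β * a j) (λ j → *≉0 β≉0 (a≉0 j)) (begin
      c
        ≈⟨ solve 2 (λ x c → c := x :+ :- (x :+ :- c)) refl (P′ (- a i)) c ⟩
      -- The argument - a i annihilates the i-th factor, whereas constancy would make the product
      -- equal to `c` there.
      P′ (- a i) + - (P′ (- a i) + - c)
        ≈⟨ +-cong (product-zero (λ j → β * a j + - a i * b j) i
             (trans (solve 2 (λ a b → b :* a :+ (:- a) :* b := con 0ℤ) refl (a i) β) 0-homo))
             (-‿cong (isPoly-roots (suc n) isPoly r distinct root (- a i))) ⟩
      0# + - 0#
        ≈⟨ -‿inverseʳ 0# ⟩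
      0# ∎)
      where
      open Solver
      β = b i
      c = product λ j → β * a j
      P′ : Carrier → Carrier
      P′ t = product λ j → β * a j + t * b j
      isPoly : IsPoly (suc n) (λ t → P′ t + - c)
      isPoly = isPoly-+ (suc n) (isPoly-product (λ j → β * a j) b) (isPoly-const n (- c))
      r : Fin (suc n) → Carrier
      -- At t = β k each factor is β times a factor from the hypothesis, so a power of β comes out.
      -- These n + 1 points suffice for degree n.
      r k = β * ι (ℤ.+ toℕ k)
      distinct : ∀ {k l} → r k - r l ≈ 0# → k ≡ l
      distinct {k} {l} e = Fin.toℕ-injective (ℤ.+-injective (ι-difference (cancel β≉0
        (trans (solve 3 (λ β x y → β :* (x :- y) := β :* x :- β :* y) refl β _ _) e))))
      scaled : ∀ (f : Fin n → Carrier) → product (λ j → β * f j) ≈ product {n} (const β) * product f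
      scaled f = ∏.∑-distrib-+ (const β) f
      root : ∀ k → P′ (r k) + - c ≈ 0#
      root k = begin
        P′ (r k) + - c
          ≈⟨ +-congʳ (product-cong {n} λ j → solve 4 (λ β a x b → β :* a :+ β :* x :* b := β :* (a :+ x :* b)) refl β (a j) _ (b j)) ⟩
        product (λ j → β * (a j + ι (ℤ.+ toℕ k) * b j)) + - c
          ≈⟨ +-cong (scaled λ j → a j + ι (ℤ.+ toℕ k) * b j) (-‿cong (scaled a)) ⟩
        product {n} (const β) * product (λ j → a j + ι (ℤ.+ toℕ k) * b j) + - (product {n} (const β) * product a)
          ≈⟨ +-congʳ (*-congˡ (constant-product k)) ⟩
        product {n} (const β) * product a + - (product {n} (const β) * product a)
          ≈⟨ -‿inverseʳ _ ⟩
        0# ∎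

    low : ∀ {m} → Poly Carrier (suc m) → Poly Carrier m
    low [] = []
    low ((c , zero ∷ α) ∷ p) = (c , α) ∷ low p
    low ((c , suc k ∷ α) ∷ p) = low p

    high : ∀ {m} → Poly Carrier (suc m) → Poly Carrier (suc m)
    high [] = []
    high ((c , zero ∷ α) ∷ p) = high p
    high ((c , suc k ∷ α) ∷ p) = (c , k ∷ α) ∷ high p

    evaluate-low-high : ∀ {m} (p : Poly Carrier (suc m)) x xs →
      evaluate p (x F.∷ xs) ≈ evaluate (low p) xs + x * evaluate (high p) (x F.∷ xs)
    evaluate-low-high [] x xs = sym (trans (+-identityˡ _) (zeroʳ x))
    evaluate-low-high ((c , zero ∷ α) ∷ p) x xs =
      trans (+-cong (*-congˡ (*-identityˡ _)) (evaluate-low-high p x xs)) (sym (+-assoc _ _ _))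
    evaluate-low-high ((c , suc k ∷ α) ∷ p) x xs = trans (+-congˡ (evaluate-low-high p x xs))
      (solve 6 (λ c x y z u v → c :* ((x :* y) :* z) :+ (u :+ x :* v) := u :+ x :* (c :* (y :* z) :+ v)) refl
        c x (x ^ k) (monomial xs α) _ _)
      where open Solver

    coefficient-low : ∀ {m} (p : Poly Carrier (suc m)) α → coefficient p (zero ∷ α) ≈ coefficient (low p) α
    coefficient-low [] α = refl
    coefficient-low ((c , zero ∷ β) ∷ p) α = +-congˡ (coefficient-low p α)
    coefficient-low ((c , suc k ∷ β) ∷ p) α = trans (+-identityˡ _) (coefficient-low p α)

    coefficient-high : ∀ {m} (p : Poly Carrier (suc m)) k α →
      coefficient p (suc k ∷ α) ≈ coefficient (high p) (k ∷ α)
    coefficient-high [] k α = refl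
    coefficient-high ((c , zero ∷ β) ∷ p) k α = trans (+-identityˡ _) (coefficient-high p k α)
    coefficient-high ((c , suc l ∷ β) ∷ p) k α = +-congˡ (coefficient-high p k α)

    isPoly-evaluate : ∀ {m} (p : Poly Carrier (suc m)) xs → ∃[ N ] IsPoly N (λ x → evaluate p (x F.∷ xs))
    isPoly-evaluate [] xs = 0 , λ _ → refl
    isPoly-evaluate ((c , k ∷ α) ∷ p) xs =
      let N , pN = isPoly-evaluate p xs
      in suc k ℕ.⊔ N ,
         isPoly-+ (suc k ℕ.⊔ N)
           (isPoly-≤ (ℕ.≤⇒≤′ (ℕ.m≤m⊔n (suc k) N))
             (isPoly-cong (suc k) (λ t → *-congˡ (*-comm _ _))
               (isPoly-scale (suc k) c (isPoly-scale (suc k) (monomial xs α) (power k)))))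
           (isPoly-≤ (ℕ.≤⇒≤′ (ℕ.m≤n⊔m (suc k) N)) pN)
      where
      power : ∀ k → IsPoly (suc k) (_^ k)
      power zero = isPoly-const 0 1#
      power (suc k) = isPoly-cong (suc (suc k))
        (λ t → *-congʳ (trans (+-identityˡ _) (*-identityʳ t)))
        (isPoly-linear* (suc k) 0# 1# (power k))

    -- Write p as low + x₀ high. At x₀ = 0 the low part vanishes, so x₀ high vanishes everywhere;
    -- then high has enough nonzero roots in x₀ to vanish too, and its exponent of x₀ is one
    -- smaller.
    vanishing⇒≈[] : ∀ {m} (p : Poly Carrier m) → (∀ xs → evaluate p xs ≈ 0#) → p ≈ₚ []
    vanishing⇒≈[] {zero} p e [] = trans (sym (only p)) (e λ ())
      where
      only : ∀ p → evaluate p (λ ()) ≈ coefficient p []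
      only [] = refl
      only ((c , []) ∷ p) = +-cong (*-identityʳ c) (only p)
    vanishing⇒≈[] {suc m} p e (zero ∷ α) = trans (coefficient-low p α)
      (vanishing⇒≈[] (low p) (λ xs → trans
        (sym (trans (evaluate-low-high p 0# xs) (trans (+-congˡ (zeroˡ _)) (+-identityʳ _))))
        (e (0# F.∷ xs))) α)
    vanishing⇒≈[] {suc m} p e (suc k ∷ α) = trans (coefficient-high p k α)
      (vanishing⇒≈[] (high p) (λ xs → trans (evaluate-cong (high p) {xs} {xs zero F.∷ (xs ∘ suc)} (λ { zero → refl ; (suc i) → refl }))
        (high-vanishes (xs ∘ suc) (xs zero))) (k ∷ α))
      where
      low-vanishes : ∀ xs → evaluate (low p) xs ≈ 0#
      low-vanishes xs = trans
        (sym (trans (evaluate-low-high p 0# xs) (trans (+-congˡ (zeroˡ _)) (+-identityʳ _))))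
        (e (0# F.∷ xs))
      high-vanishes : ∀ xs x → evaluate (high p) (x F.∷ xs) ≈ 0#
      high-vanishes xs =
        let N , pN = isPoly-evaluate (high p) xs
        -- The sample points are 1, ..., N: the factor x₀ can be cancelled only away from 0.
        in isPoly-roots N pN (λ i → ι (ℤ.+ suc (toℕ i)))
          (λ d → Fin.toℕ-injective (ℕ.suc-injective (ℤ.+-injective (ι-difference d))))
          (λ i → cancel (λ z → case-suc (ι-injective z))
            (trans (sym (trans (evaluate-low-high p _ xs) (trans (+-congʳ (low-vanishes xs)) (+-identityˡ _))))
              (e (ι (ℤ.+ suc (toℕ i)) F.∷ xs))))
        where
        case-suc : ∀ {n} → ¬ ℤ.+ suc n ≡ 0ℤ
        case-suc ()

    evaluate⇒≈ₚ : ∀ {m} (p q : Poly Carrier m) → (∀ xs → evaluate p xs ≈ evaluate q xs) → p ≈ₚ q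
    evaluate⇒≈ₚ p q e α = begin
      coefficient p α
        ≈⟨ solve 2 (λ x y → x := (x :+ :- y) :+ y) refl _ _ ⟩
      coefficient p α + - coefficient q α + coefficient q α
        ≈⟨ +-congʳ (trans (+-congˡ (sym (coefficient-negate q α))) (sym (coefficient-++ p (negate q) α))) ⟩
      coefficient (p ++ negate q) α + coefficient q α
        ≈⟨ +-congʳ (vanishing⇒≈[] (p ++ negate q) (λ xs → trans (evaluate-++ p (negate q) xs)
             (trans (+-cong (e xs) (evaluate-negate q xs)) (-‿inverseʳ _))) α) ⟩
      0# + coefficient q α
        ≈⟨ +-identityˡ _ ⟩
      coefficient q α ∎
      where open Solver

-- Euclid's algorithm on integer vectors.

module EuclideanAlgorithm where

  open import Data.Integer.Base using (1ℤ; -1ℤ; ∣_∣; +_; -[1+_])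
  open import Data.Nat.Base using (_<_)
  open import Relation.Binary.PropositionalEquality

  ℤ-identity : ℤ.+-*-rawRing -Raw-AlmostCommutative⟶ fromCommutativeRing ℤ.+-*-commutativeRing
  ℤ-identity = record
    { ⟦_⟧ = id ; +-homo = λ _ _ → refl ; *-homo = λ _ _ → refl ; -‿homo = λ _ → refl
    ; 0-homo = refl ; 1-homo = refl }

  module ℤLA = LinearAlgebraOver ℤ.+-*-commutativeRing ℤ-identity
  open ℤLA using (act; acts; acts-++; act-target; act-other; acts-outside)

  subtract-shrinks : ∀ m n → suc n ℕ.≤ m → m ℕ.∸ suc n < m
  subtract-shrinks (suc m) n _ = ℕ.s≤s (ℕ.m∸n≤m m n)

  -- The subtractive form of division: c is -1 if the signs agree and 1 otherwise.
  shrink : ∀ a b → b ≢ 0ℤ → ∣ b ∣ ℕ.≤ ∣ a ∣ → ∃[ c ] ∣ a ℤ.+ c ℤ.* b ∣ < ∣ a ∣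
  shrink a (+ zero) b≢0 _ = ⊥-elim (b≢0 refl)
  shrink (+ m) (+ suc n) _ n<m = -1ℤ ,
    subst (_< m) (sym (cong ∣_∣ (trans (cong (λ x → + m ℤ.+ x) (ℤ.-1*i≡-i (+ suc n))) (ℤ.⊖-≥ n<m)))) (subtract-shrinks m n n<m)
  shrink (+ m) -[1+ n ] _ n<m = 1ℤ ,
    subst (_< m) (sym (cong ∣_∣ (trans (cong (λ x → + m ℤ.+ x) (ℤ.*-identityˡ -[1+ n ])) (ℤ.⊖-≥ n<m)))) (subtract-shrinks m n n<m)
  shrink -[1+ m ] (+ suc n) _ n<m = 1ℤ ,
    subst (_< suc m) (sym (trans (cong (λ x → ∣ -[1+ m ] ℤ.+ x ∣) (ℤ.*-identityˡ (+ suc n)))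
      (trans (ℤ.∣m⊖n∣≡∣n⊖m∣ (suc n) (suc m)) (cong ∣_∣ (ℤ.⊖-≥ n<m))))) (subtract-shrinks (suc m) n n<m)
  shrink -[1+ m ] -[1+ n ] _ n<m = -1ℤ ,
    subst (_< suc m) (sym (trans (cong (λ x → ∣ -[1+ m ] ℤ.+ x ∣) (ℤ.-1*i≡-i -[1+ n ]))
      (trans (ℤ.∣m⊖n∣≡∣n⊖m∣ (suc n) (suc m)) (cong ∣_∣ (ℤ.⊖-≥ n<m))))) (subtract-shrinks (suc m) n n<m)

  size : ∀ {m} → (Fin m → ℤ) → ℕ
  size {zero} v = 0
  size {suc m} v = ∣ v zero ∣ ℕ.+ size (v ∘ suc)

  size-updateAt : ∀ {m} (v : Fin m → ℤ) d f → ∣ f (v d) ∣ < ∣ v d ∣ → size (updateAt v d f) < size v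
  size-updateAt v zero f l = ℕ.+-monoˡ-< _ l
  size-updateAt v (suc d) f l = ℕ.+-monoʳ-< ∣ v zero ∣ (size-updateAt (v ∘ suc) d f l)

  module _ {m} (S : Fin m → Set) (S? : ∀ k → Dec (S k)) where

    SupportedOn : (Fin m → ℤ) → Set
    SupportedOn v = ∀ k → ¬ S k → v k ≡ 0ℤ

    TwoNonzero : (Fin m → ℤ) → Set
    TwoNonzero v = ∃[ i ] ∃[ j ] i ≢ j × v i ≢ 0ℤ × v j ≢ 0ℤ

    private
      inside : ∀ {v} → SupportedOn v → ∀ {k} → v k ≢ 0ℤ → S k
      inside supp {k} vk≢0 with S? k
      ... | yes Sk = Sk
      ... | no ¬Sk = ⊥-elim (vk≢0 (supp k ¬Sk))

    abstract

      -- As long as two entries are nonzero, the smaller one reduces the larger one in absolute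
      -- value, which lowers `size`. Nonzero entries lie in `S`, and so do the operations between
      -- them.
      isolate : ∀ v → Acc _<_ (size v) → SupportedOn v →
        Σ[ os ∈ List (Op S) ] ¬ TwoNonzero (acts os v)
      isolate v (acc rec) supp
        with Fin.any? (λ i → Fin.any? (λ j → ¬? (i Fin.≟ j) ×-dec ¬? (v i ℤ.≟ 0ℤ) ×-dec ¬? (v j ℤ.≟ 0ℤ)))
      ... | no none = [] , none
      ... | yes (i , j , i≢j , vi≢0 , vj≢0) = pick (ℕ.≤-total ∣ v j ∣ ∣ v i ∣)
        where
        step : ∀ s t → s ≢ t → v s ≢ 0ℤ → v t ≢ 0ℤ → ∣ v s ∣ ℕ.≤ ∣ v t ∣ →
          Σ[ os ∈ List (Op S) ] ¬ TwoNonzero (acts os v)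
        step s t s≢t vs≢0 vt≢0 l =
          let c , smaller = shrink (v t) (v s) vs≢0 l
              o = mkOp s t (inside supp vs≢0) (inside supp vt≢0) s≢t c
              os , done = isolate (act o v) (rec (size-updateAt v t _ smaller))
                (λ k ¬Sk → trans (acts-outside (o ∷ []) v ¬Sk) (supp k ¬Sk))
          in o ∷ os , done
        pick : ∣ v j ∣ ℕ.≤ ∣ v i ∣ ⊎ ∣ v i ∣ ℕ.≤ ∣ v j ∣ → Σ[ os ∈ List (Op S) ] ¬ TwoNonzero (acts os v)
        pick (inj₁ l) = step j i (i≢j ∘ sym) vj≢0 vi≢0 l
        pick (inj₂ l) = step i j i≢j vi≢0 vj≢0 l

      -- `isolate` leaves open where the surviving entry sits; if it is not at t, two more
      -- operations carry it there.
      euclid : ∀ v → SupportedOn v → ∀ t → S t →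
        Σ[ os ∈ List (Op S) ] (∀ k → k ≢ t → acts os v k ≡ 0ℤ)
      euclid v supp t St with isolate v (<-wellFounded _) supp
      ... | os , one with Fin.any? (λ i → ¬? (i Fin.≟ t) ×-dec ¬? (acts os v i ℤ.≟ 0ℤ))
      ...   | no none = os , only
        where
        only : ∀ k → k ≢ t → acts os v k ≡ 0ℤ
        only k k≢t with acts os v k ℤ.≟ 0ℤ
        ... | yes e = e
        ... | no ne = ⊥-elim (none (k , k≢t , ne))
      ...   | yes (i , i≢t , wi≢0) = os ++ o₁ ∷ o₂ ∷ [] , λ k k≢t → trans (acts-++ os _ v k) (moved k k≢t)
        where
        w : Fin m → ℤ
        w = acts os v
        Si : S i
        Si = inside (λ k ¬Sk → trans (acts-outside os v ¬Sk) (supp k ¬Sk)) wi≢0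
        o₁ o₂ : Op S
        -- The entries at i and t run through (w i, 0), (w i, w i), (0, w i).
        o₁ = mkOp i t Si St i≢t 1ℤ
        o₂ = mkOp t i St Si (i≢t ∘ sym) -1ℤ
        zero-elsewhere : ∀ k → k ≢ i → w k ≡ 0ℤ
        zero-elsewhere k k≢i with w k ℤ.≟ 0ℤ
        ... | yes e = e
        ... | no ne = ⊥-elim (one (k , i , k≢i , ne , wi≢0))
        moved : ∀ k → k ≢ t → act o₂ (act o₁ w) k ≡ 0ℤ
        moved k k≢t with k Fin.≟ i
        ... | yes refl = begin
          act o₂ (act o₁ w) i
            ≡⟨ act-target o₂ (act o₁ w) ⟩
          act o₁ w i ℤ.+ -1ℤ ℤ.* act o₁ w t
            ≡⟨ cong₂ (λ x y → x ℤ.+ -1ℤ ℤ.* y) (act-other o₁ w i≢t) (act-target o₁ w) ⟩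
          w i ℤ.+ -1ℤ ℤ.* (w t ℤ.+ 1ℤ ℤ.* w i)
            ≡⟨ cong (λ x → w i ℤ.+ -1ℤ ℤ.* (x ℤ.+ 1ℤ ℤ.* w i)) (zero-elsewhere t (i≢t ∘ sym)) ⟩
          w i ℤ.+ -1ℤ ℤ.* (0ℤ ℤ.+ 1ℤ ℤ.* w i)
            ≡⟨ solve 1 (λ x → x :+ con -1ℤ :* (con 0ℤ :+ con 1ℤ :* x) := con 0ℤ) refl (w i) ⟩
          0ℤ ∎
          where
          open ≡-Reasoning
          open ℤLA.Solver
        ... | no k≢i = trans (act-other o₂ (act o₁ w) k≢i) (trans (act-other o₁ w k≢t) (zero-elsewhere k k≢i))

open EuclideanAlgorithm using (module ℤLA; ℤ-identity; euclid)

-- Elementary operations under maps of rings.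

module ActsHomomorphism
  (R₁ : CommutativeRing 0ℓ 0ℓ) (φ₁ : ℤ.+-*-rawRing -Raw-AlmostCommutative⟶ fromCommutativeRing R₁)
  (R₂ : CommutativeRing 0ℓ 0ℓ) (φ₂ : ℤ.+-*-rawRing -Raw-AlmostCommutative⟶ fromCommutativeRing R₂)
  where

  private
    module A = CommutativeRing R₁
    module B = CommutativeRing R₂
    module L₁ = LinearAlgebraOver R₁ φ₁
    module L₂ = LinearAlgebraOver R₂ φ₂

  module _ (h : A.Carrier → B.Carrier)
    (h-shear : ∀ x c y → h (x A.+ L₁.ι c A.* y) B.≈ h x B.+ L₂.ι c B.* h y) where

    -- Compatibility with x + c y for integers c is all an operation asks of `h`. This covers the
    -- embeddings of ℤ and ℚ as well as conjugation.
    act-homo : ∀ {m} {S : Fin m → Set} (o : Op S) x i → h (L₁.act o x i) B.≈ L₂.act o (h ∘ x) i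
    act-homo o x i with i Fin.≟ Op.target o
    ... | yes ≡.refl rewrite L₁.act-target o x | L₂.act-target o (h ∘ x) =
      h-shear (x i) (Op.coefficient o) (x (Op.source o))
    ... | no i≢ rewrite L₁.act-other o x i≢ | L₂.act-other o (h ∘ x) i≢ = B.refl

    acts-homo : ∀ {m} {S : Fin m → Set} (os : List (Op S)) x i → h (L₁.acts os x i) B.≈ L₂.acts os (h ∘ x) i
    acts-homo [] x i = B.refl
    acts-homo (o ∷ os) x i = B.trans (acts-homo os (L₁.act o x) i) (L₂.acts-cong os (act-homo o x) i)

-- Axioms for the complex numbers.

-- What the argument uses of the complex numbers; Bounded z a stands for
-- |Re z| < a and |Im z| < a.
record Setting (rawRing : RawRing 0ℓ 0ℓ) : Set₁ where
  field
    isCommutativeRing : IsCommutative rawRing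
  commutativeRing : CommutativeRing 0ℓ 0ℓ
  commutativeRing = bundle rawRing isCommutativeRing
  field
    morphism : ℤ.+-*-rawRing -Raw-AlmostCommutative⟶ fromCommutativeRing commutativeRing
  open CommutativeRing commutativeRing using (_≈_; _+_; _*_; -_; _-_; 0#; 1#; Carrier)
  open _-Raw-AlmostCommutative⟶_ morphism renaming (⟦_⟧ to ι)
  field
    domain : ∀ {x y} → x * y ≈ 0# → x ≈ 0# ⊎ y ≈ 0#
    ι-injective : ∀ {z} → ι z ≈ 0# → z ≡ 0ℤ
    conj : Carrier → Carrier
    conj-cong : ∀ {x y} → x ≈ y → conj x ≈ conj y
    conj-+ : ∀ x y → conj (x + y) ≈ conj x + conj y
    conj-* : ∀ x y → conj (x * y) ≈ conj x * conj y
    conj-ι : ∀ z → conj (ι z) ≈ ι z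
    conj-involutive : ∀ x → conj (conj x) ≈ x
    𝕚 : Carrier
    conj-𝕚 : conj 𝕚 ≈ - 𝕚
    𝕚*𝕚 : 𝕚 * 𝕚 ≈ - 1#
    Bounded : Carrier → ℕ → Set
    bounded-cong : ∀ {x y a} → x ≈ y → Bounded x a → Bounded y a
    bounded-≤ : ∀ {x a b} → a ℕ.≤ b → Bounded x a → Bounded x b
    bounded-+ : ∀ {x y a b} → Bounded x a → Bounded y b → Bounded (x + y) (a ℕ.+ b)
    bounded-neg : ∀ {x a} → Bounded x a → Bounded (- x) a
    bounded-* : ∀ {x y a b} → Bounded x a → Bounded y b → Bounded (x * y) (2 ℕ.* (a ℕ.* b))
    bounded : ∀ x → ∃[ a ] Bounded x a
    bounded-ι : ∀ {z a} → ℤ.∣ z ∣ ℕ.< a → Bounded (ι z) a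
    bounded-ι⁻¹ : ∀ {z} → Bounded (ι z) 1 → z ≡ 0ℤ
    bounded-shrink : ∀ {a b x c} → a ℕ.≤ b → Bounded (ι (ℤ.+ b) * x) c → Bounded (ι (ℤ.+ a) * x) c
    bounded-divide : ∀ {a x b} → Bounded (ι (ℤ.+ suc a) * x) (suc a ℕ.* b) → Bounded x b
    archimedean : ∀ {x a} → (∀ K → Bounded (ι (ℤ.+ suc K) * x) a) → x ≈ 0#
    dirichlet : ∀ {m} (w : Fin m → Carrier) → (∀ i → conj (w i) ≈ w i) → ∀ K →
      Σ[ t ∈ ℕ ] Σ[ v ∈ (Fin m → ℤ) ] (∀ i → Bounded (ι (ℤ.+ suc K) * (ι (ℤ.+ suc t) * w i - ι (v i))) 4)

Eventually : (ℕ → Set) → Set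
Eventually P = ∃[ K₀ ] (∀ K → K₀ ℕ.≤ K → P K)

eventually-× : ∀ {P Q} → Eventually P → Eventually Q → Eventually (λ K → P K × Q K)
eventually-× (K₁ , p) (K₂ , q) = K₁ ℕ.⊔ K₂ , λ K l →
  p K (ℕ.m⊔n≤o⇒m≤o K₁ K₂ l) , q K (ℕ.m⊔n≤o⇒n≤o K₁ K₂ l)

eventually-all : ∀ {n} {P : Fin n → ℕ → Set} → (∀ i → Eventually (P i)) → Eventually (λ K → ∀ i → P i K)
eventually-all {zero} p = 0 , λ _ _ ()
eventually-all {suc n} p with eventually-× (p zero) (eventually-all (p ∘ suc))
... | K₀ , q = K₀ , λ { K l zero → proj₁ (q K l) ; K l (suc i) → proj₂ (q K l) i }

-- Integer points in the kernel of the linear forms.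

module Argument {rawRing : RawRing 0ℓ 0ℓ} (setting : Setting rawRing) (em : {P : Set} → Dec P) where

  open import Data.Nat.Base using (_≤_; _<_; _⊔_)
  open Setting setting hiding (isCommutativeRing)
  open CommutativeRing commutativeRing hiding (zero; rawRing)
  open LinearAlgebraOver commutativeRing morphism
  open PolynomialsOver commutativeRing morphism using (product-cong; product-zero)
  open PolynomialsOver.Domain commutativeRing morphism domain ι-injective
  open LinearAlgebra rawRing using (1ᴹ)
  open RawRing rawRing using (rawSemiring)
  open Algebra.Definitions.RawSemiring rawSemiring using (sum; product)
  open Algebra.Properties.Ring ring using (-0#≈0#; -‿involutive)
  module ∑ = Algebra.Properties.CommutativeMonoid.Sum +-commutativeMonoid
  module ∏ = Algebra.Properties.CommutativeMonoid.Sum *-commutativeMonoid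
  open import Relation.Binary.Reasoning.Setoid setoid

  abstract
    by-contradiction : {P : Set} → ¬ ¬ P → P
    by-contradiction {P} ¬¬p with em {P}
    ... | yes p = p
    ... | no ¬p = ⊥-elim (¬¬p ¬p)

    ¬∀⇒∃¬ : {A : Set} {P : A → Set} → ¬ (∀ a → P a) → ∃[ a ] ¬ P a
    ¬∀⇒∃¬ ¬all = by-contradiction λ none → ¬all λ a → by-contradiction λ ¬pa → none (a , ¬pa)

  -- Linear algebra

  ⟨⟩-remove : ∀ {m} (φ x : Fin (suc m) → Carrier) j →
    ⟨ φ , x ⟩ ≈ φ j * x j + ⟨ φ ∘ punchIn j , x ∘ punchIn j ⟩
  ⟨⟩-remove φ x j = ∑.sum-remove {i = j} (λ k → φ k * x k)

  -- Gaussian elimination without division: with pivot p the other forms are multiplied by p before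
  -- the column is cleared, and a solution of the smaller system is multiplied by p before the pivot
  -- coordinate is solved for.
  kernel : ∀ n m → n < m → (Λ : Fin n → Fin m → Carrier) →
    ∃[ c ] (¬ ∀ j → c j ≈ 0#) × (∀ i → ⟨ Λ i , c ⟩ ≈ 0#)
  kernel zero (suc m) _ Λ = const 1# , (λ z → 1≉0 (z zero)) , λ ()
  kernel (suc n) (suc m) (ℕ.s≤s n<m) Λ with em {∀ j → Λ zero j ≈ 0#}
  ... | yes Λ₀≈0 =
    let c , c≉0 , Λc≈0 = kernel n (suc m) (ℕ.m≤n⇒m≤1+n n<m) (Λ ∘ suc)
    in c , c≉0 , λ
      { zero → sum-0 {suc m} λ j → trans (*-congʳ (Λ₀≈0 j)) (zeroˡ (c j))
      ; (suc i) → Λc≈0 i }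
  ... | no Λ₀≉0 with ¬∀⇒∃¬ Λ₀≉0
  ...   | j , pivot≉0 = c , c≉0 , vanish
    where
    open Solver
    p = Λ zero j
    Λ₀ : Fin m → Carrier
    Λ₀ = Λ zero ∘ punchIn j
    reduced : Fin n → Fin m → Carrier
    reduced i k = p * Λ (suc i) (punchIn j k) + - Λ (suc i) j * Λ₀ k
    IH = kernel n m n<m reduced
    d = proj₁ IH
    s = ⟨ Λ₀ , d ⟩
    c : Fin (suc m) → Carrier
    c = insertAt (λ k → p * d k) j (- s)
    c≉0 : ¬ (∀ k → c k ≈ 0#)
    c≉0 c≈0 = proj₁ (proj₂ IH) λ k → cancel pivot≉0
      (trans (reflexive (≡.sym (insertAt-punchIn (λ k → p * d k) j (- s) k))) (c≈0 (punchIn j k)))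
    expand : ∀ i → ⟨ Λ i , c ⟩ ≈ Λ i j * - s + p * ⟨ Λ i ∘ punchIn j , d ⟩
    expand i = trans (⟨⟩-remove (Λ i) c j) (+-cong
      (*-congˡ (reflexive (insertAt-lookup (λ k → p * d k) j (- s))))
      (trans (⟨⟩-congʳ {m} (λ k → reflexive (insertAt-punchIn (λ k → p * d k) j (- s) k)))
        (⟨⟩-*ʳ (Λ i ∘ punchIn j) p d)))
    vanish : ∀ i → ⟨ Λ i , c ⟩ ≈ 0#
    vanish zero = trans (expand zero) (trans (solve 2 (λ p s → p :* :- s :+ p :* s := con 0ℤ) refl p s) 0-homo)
    vanish (suc i) = begin
      ⟨ Λ (suc i) , c ⟩
        ≈⟨ expand (suc i) ⟩
      q * - s + p * ⟨ Λ′ , d ⟩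
        ≈⟨ solve 4 (λ q s p x → q :* :- s :+ p :* x := p :* x :+ (:- q) :* s) refl q s p _ ⟩
      p * ⟨ Λ′ , d ⟩ + - q * ⟨ Λ₀ , d ⟩
        ≈⟨ +-cong (trans (*-congˡ (⟨⟩-comm Λ′ d)) (sym (⟨⟩-*ʳ d p Λ′)))
                  (trans (*-congˡ (⟨⟩-comm Λ₀ d)) (sym (⟨⟩-*ʳ d (- q) Λ₀))) ⟩
      ⟨ d , (λ k → p * Λ′ k) ⟩ + ⟨ d , (λ k → - q * Λ₀ k) ⟩
        ≈⟨ ⟨⟩-+ʳ d (λ k → p * Λ′ k) (λ k → - q * Λ₀ k) ⟨
      ⟨ d , reduced i ⟩
        ≈⟨ ⟨⟩-comm d (reduced i) ⟩
      ⟨ reduced i , d ⟩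
        ≈⟨ proj₂ (proj₂ IH) i ⟩
      0# ∎
      where
      q = Λ (suc i) j
      Λ′ : Fin m → Carrier
      Λ′ = Λ (suc i) ∘ punchIn j

  ι⟨⟩ : ∀ {m} (φ v : Fin m → ℤ) → ι (ℤLA.⟨ φ , v ⟩) ≈ ⟨ ι ∘ φ , ι ∘ v ⟩
  ι⟨⟩ {zero} φ v = 0-homo
  ι⟨⟩ {suc m} φ v = trans (+-homo _ _) (+-cong (*-homo _ _) (ι⟨⟩ (φ ∘ suc) (v ∘ suc)))

  -- A linear form that vanishes at some integer point outside the hyperplane
  -- x₀ = 0 reduces to one variable less; otherwise x₀ itself serves as φ.
  integer-form : ∀ m (l : Fin m → Carrier) → ¬ (∀ j → l j ≈ 0#) →
    ∃[ φ ] (¬ ∀ j → φ j ≡ 0ℤ) × (∀ v → ⟨ l , ι ∘ v ⟩ ≈ 0# → ⟨ ι ∘ φ , ι ∘ v ⟩ ≈ 0#)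
  integer-form zero l l≉0 = ⊥-elim (l≉0 λ ())
  integer-form (suc m) l l≉0
    with em {Σ[ v ∈ (Fin (suc m) → ℤ) ] v zero ≢ 0ℤ × ⟨ l , ι ∘ v ⟩ ≈ 0#}
  ... | no none = e₀ , (λ z → one≢0 (z zero)) , λ v lv≈0 → trans
      (+-cong (trans (*-congʳ 1-homo) (*-identityˡ _)) (sum-0 {m} λ j → trans (*-congʳ 0-homo) (zeroˡ _)))
      (trans (+-identityʳ _) (trans (ι-cong (by-contradiction λ v₀≢0 → none (v , v₀≢0 , lv≈0))) 0-homo))
    where
    one≢0 : ℤ.1ℤ ≢ 0ℤ
    one≢0 ()
    e₀ : Fin (suc m) → ℤ
    e₀ zero = ℤ.1ℤ
    e₀ (suc _) = 0ℤ
  ... | yes (v , v₀≢0 , lv≈0) = φ , φ≢0 , kills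
    where
    open Solver
    l′ : Fin m → Carrier
    l′ = l ∘ suc
    v′ : Fin m → ℤ
    v′ = v ∘ suc
    l′≉0 : ¬ (∀ j → l′ j ≈ 0#)
    l′≉0 l′≈0 = l≉0 λ
      { zero → cancel (v₀≢0 ∘ ι-injective) (trans (*-comm _ _) (trans
          (sym (trans (+-congˡ (sum-0 {m} λ j → trans (*-congʳ (l′≈0 j)) (zeroˡ _))) (+-identityʳ _))) lv≈0))
      ; (suc j) → l′≈0 j }
    IH = integer-form m l′ l′≉0
    φ′ = proj₁ IH
    φ : Fin (suc m) → ℤ
    -- This makes φ(x) equal to φ′(y), where y is the tail of v₀ x - x₀ v. The coordinate 0 of that
    -- combination cancels, so l(x) = l(v) = 0 yields l′(y) = 0.
    φ zero = ℤ.- ℤLA.⟨ φ′ , v′ ⟩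
    φ (suc j) = v zero ℤ.* φ′ j
    φ≢0 : ¬ (∀ j → φ j ≡ 0ℤ)
    φ≢0 φ≡0 = proj₁ (proj₂ IH) λ j →
      [ (λ e → ⊥-elim (v₀≢0 e)) , (λ e → e) ]′ (ℤ.i*j≡0⇒i≡0∨j≡0 (v zero) (φ≡0 (suc j)))
    kills : ∀ x → ⟨ l , ι ∘ x ⟩ ≈ 0# → ⟨ ι ∘ φ , ι ∘ x ⟩ ≈ 0#
    kills x lx≈0 = begin
      ι (φ zero) * ι (x zero) + ⟨ ι ∘ φ ∘ suc , ιx′ ⟩
        ≈⟨ +-cong (*-congʳ (trans (-‿homo _) (-‿cong (ι⟨⟩ φ′ v′))))
             (trans (⟨⟩-cong {m} (λ j → *-homo (v zero) (φ′ j)) (λ _ → refl))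
               (trans (⟨⟩-comm _ ιx′) (trans (⟨⟩-*ʳ ιx′ v₀ ιφ′) (*-congˡ (⟨⟩-comm ιx′ ιφ′))))) ⟩
      - ⟨ ιφ′ , ιv′ ⟩ * x₀ + v₀ * ⟨ ιφ′ , ιx′ ⟩
        ≈⟨ combine ιφ′ ⟩
      ⟨ ιφ′ , ι ∘ y ⟩
        ≈⟨ proj₂ (proj₂ IH) y (trans (sym (combine l′)) (trans
             (solve 6 (λ a b x v p q → (:- a) :* x :+ v :* b
               := v :* (p :* x :+ b) :+ :- (x :* (p :* v :+ a))) refl
                 ⟨ l′ , ιv′ ⟩ ⟨ l′ , ιx′ ⟩ x₀ v₀ (l zero) (l zero))
             (trans (+-cong (trans (*-congˡ lx≈0) (zeroʳ _)) (-‿cong (trans (*-congˡ lv≈0) (zeroʳ _))))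
               (-‿inverseʳ 0#)))) ⟩
      0# ∎
      where
      x₀ = ι (x zero)
      v₀ = ι (v zero)
      ιφ′ ιx′ ιv′ : Fin m → Carrier
      ιφ′ = ι ∘ φ′
      ιx′ = ι ∘ x ∘ suc
      ιv′ = ι ∘ v′
      y : Fin m → ℤ
      y j = ℤ.- x zero ℤ.* v′ j ℤ.+ v zero ℤ.* x (suc j)
      combine : ∀ (ψ : Fin m → Carrier) → - ⟨ ψ , ιv′ ⟩ * x₀ + v₀ * ⟨ ψ , ιx′ ⟩ ≈ ⟨ ψ , ι ∘ y ⟩
      combine ψ = begin
        - ⟨ ψ , ιv′ ⟩ * x₀ + v₀ * ⟨ ψ , ιx′ ⟩
          ≈⟨ +-congʳ (solve 2 (λ a x → (:- a) :* x := (:- x) :* a) refl ⟨ ψ , ιv′ ⟩ x₀) ⟩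
        - x₀ * ⟨ ψ , ιv′ ⟩ + v₀ * ⟨ ψ , ιx′ ⟩
          ≈⟨ +-cong (⟨⟩-*ʳ ψ (- x₀) ιv′) (⟨⟩-*ʳ ψ v₀ ιx′) ⟨
        ⟨ ψ , (λ j → - x₀ * ιv′ j) ⟩ + ⟨ ψ , (λ j → v₀ * ιx′ j) ⟩
          ≈⟨ ⟨⟩-+ʳ ψ (λ j → - x₀ * ιv′ j) (λ j → v₀ * ιx′ j) ⟨
        ⟨ ψ , (λ j → - x₀ * ιv′ j + v₀ * ιx′ j) ⟩
          ≈⟨ ⟨⟩-congʳ {m} (λ j → trans (+-homo _ _) (+-cong
               (trans (*-homo _ _) (*-congʳ (-‿homo _))) (*-homo _ _))) ⟨
        ⟨ ψ , ι ∘ y ⟩ ∎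

  -- Sequences that are O(1/K)

  O : (ℕ → Carrier) → Set
  O e = ∃[ a ] (∀ K → Bounded (ι (ℤ.+ suc K) * e K) a)

  O-cong : ∀ {e f} → (∀ K → e K ≈ f K) → O e → O f
  O-cong eq (a , p) = a , λ K → bounded-cong (*-congˡ (eq K)) (p K)

  O-+ : ∀ {e f} → O e → O f → O (λ K → e K + f K)
  O-+ (a , p) (b , q) = a ℕ.+ b , λ K → bounded-cong (sym (distribˡ _ _ _)) (bounded-+ (p K) (q K))

  O-neg : ∀ {e} → O e → O (λ K → - e K)
  O-neg (a , p) = a , λ K → bounded-cong
    (solve 2 (λ x y → :- (x :* y) := x :* :- y) refl _ _) (bounded-neg (p K))
    where open Solver

  O-* : ∀ {e} (b : ℕ → Carrier) B → (∀ K → Bounded (b K) B) → O e → O (λ K → b K * e K)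
  O-* b B q (a , p) = _ , λ K → bounded-cong
    (solve 3 (λ b x y → b :* (x :* y) := x :* (b :* y)) refl (b K) _ _) (bounded-* (q K) (p K))
    where open Solver

  O-scale : ∀ {e} c → O e → O (λ K → c * e K)
  O-scale c = O-* (const c) (proj₁ (bounded c)) (λ _ → proj₂ (bounded c))

  O-0 : O (const 0#)
  O-0 = 1 , λ K → bounded-cong (trans 0-homo (sym (zeroʳ _))) (bounded-ι (ℕ.s≤s ℕ.z≤n))

  O-⟨⟩ : ∀ {m} (φ : Fin m → Carrier) {x : ℕ → Fin m → Carrier} →
    (∀ i → O (λ K → x K i)) → O (λ K → ⟨ φ , x K ⟩)
  O-⟨⟩ {zero} φ p = O-0
  O-⟨⟩ {suc m} φ p = O-+ (O-scale (φ zero) (p zero)) (O-⟨⟩ (φ ∘ suc) (p ∘ suc))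

  bounded-unscale : ∀ {a x b} → Bounded (ι (ℤ.+ suc a) * x) b → Bounded x b
  bounded-unscale p = bounded-cong (trans (*-congʳ 1-homo) (*-identityˡ _)) (bounded-shrink (ℕ.s≤s ℕ.z≤n) p)

  O-bounded : ∀ {e} → O e → ∃[ a ] (∀ K → Bounded (e K) a)
  O-bounded (a , p) = a , bounded-unscale ∘ p

  -- If (K + 1) e is bounded by a, then for K ≥ (a + 1)(K₀ + 1) so is (a + 1)(K₀ + 1) e, and a + 1
  -- can be divided out.
  O-small : ∀ {e} → O e → ∀ K₀ → Eventually (λ K → Bounded (ι (ℤ.+ suc K₀) * e K) 1)
  O-small {e} (a , p) K₀ = suc a ℕ.* suc K₀ , λ K l → bounded-divide {a = a}
    (bounded-≤ (ℕ.≤-trans (ℕ.n≤1+n a) (ℕ.≤-reflexive (≡.sym (ℕ.*-identityʳ (suc a)))))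
      (bounded-cong
        (trans (*-congʳ (trans (ι-cong (ℤ.pos-* (suc a) (suc K₀))) (*-homo _ _))) (*-assoc _ _ _))
        (bounded-shrink (ℕ.m≤n⇒m≤1+n l) (p K))))

  -- Telescoping: (a + e) P - a Q = a (P - Q) + P e, where P is bounded because P - Q is.
  O-product : ∀ {n} (a : Fin n → Carrier) {e : ℕ → Fin n → Carrier} → (∀ i → O (λ K → e K i)) →
    O (λ K → product (λ i → a i + e K i) - product a)
  O-product {zero} a p = O-cong (λ K → sym (-‿inverseʳ 1#)) O-0
  O-product {suc n} a {e} p =
    let D = O-product (a ∘ suc) (p ∘ suc)
        A , bound = O-bounded D
        B , bound₀ = bounded (product (a ∘ suc))
        P = λ K → product (λ i → a (suc i) + e K (suc i))
    in O-cong (λ K → solve 4 (λ a e P Q → a :* (P :- Q) :+ P :* e := (a :+ e) :* P :- a :* Q) refl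
              (a zero) (e K zero) (P K) (product (a ∘ suc)))
      (O-+ (O-scale (a zero) D)
        (O-* P (A ℕ.+ B) (λ K → bounded-cong
          (solve 2 (λ P Q → (P :- Q) :+ Q := P) refl (P K) (product (a ∘ suc)))
          (bounded-+ (bound K) bound₀)) (p zero)))
    where open Solver

  module Approximation {m} (w : Fin m → Carrier) (w-real : ∀ i → conj (w i) ≈ w i) where

    t : ℕ → ℕ
    t K = proj₁ (dirichlet w w-real K)

    v : ℕ → Fin m → ℤ
    v K = proj₁ (proj₂ (dirichlet w w-real K))

    δ : ℕ → Fin m → Carrier
    δ K i = ι (ℤ.+ suc (t K)) * w i - ι (v K i)

    O-δ : ∀ i → O (λ K → δ K i)
    O-δ i = 4 , λ K → proj₂ (proj₂ (dirichlet w w-real K)) i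

    ⟨,δ⟩ : ∀ (φ : Fin m → Carrier) K → ⟨ φ , δ K ⟩ ≈ ι (ℤ.+ suc (t K)) * ⟨ φ , w ⟩ - ⟨ φ , ι ∘ v K ⟩
    ⟨,δ⟩ φ K = begin
      ⟨ φ , δ K ⟩
        ≈⟨ ⟨⟩-congʳ {m} (λ i → +-congˡ (solve 1 (λ x → :- x := con (ℤ.- ℤ.1ℤ) :* x) refl (ι (v K i)))) ⟩
      ⟨ φ , (λ i → T * w i + ι (ℤ.- ℤ.1ℤ) * ι (v K i)) ⟩
        ≈⟨ ⟨⟩-+ʳ φ (λ i → T * w i) (λ i → ι (ℤ.- ℤ.1ℤ) * ι (v K i)) ⟩
      ⟨ φ , (λ i → T * w i) ⟩ + ⟨ φ , (λ i → ι (ℤ.- ℤ.1ℤ) * ι (v K i)) ⟩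
        ≈⟨ +-cong (⟨⟩-*ʳ φ T w) (⟨⟩-*ʳ φ (ι (ℤ.- ℤ.1ℤ)) (ι ∘ v K)) ⟩
      T * ⟨ φ , w ⟩ + ι (ℤ.- ℤ.1ℤ) * ⟨ φ , ι ∘ v K ⟩
        ≈⟨ +-congˡ (solve 1 (λ x → :- x := con (ℤ.- ℤ.1ℤ) :* x) refl ⟨ φ , ι ∘ v K ⟩) ⟨
      T * ⟨ φ , w ⟩ - ⟨ φ , ι ∘ v K ⟩ ∎
      where
      open Solver
      T = ι (ℤ.+ suc (t K))

    -- If φ(w) = 0, then φ(v) is minus φ of the approximation error.
    O-pairing : ∀ (φ : Fin m → Carrier) → ⟨ φ , w ⟩ ≈ 0# → O (λ K → ⟨ φ , ι ∘ v K ⟩)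
    O-pairing φ φw≈0 = O-cong
      (λ K → trans (-‿cong (trans (⟨,δ⟩ φ K) (trans (+-congʳ (trans (*-congˡ φw≈0) (zeroʳ _))) (+-identityˡ _))))
        (-‿involutive _))
      (O-neg (O-⟨⟩ φ O-δ))

    -- If φ(v) = 0, then a positive integer multiple of φ(w) is φ of the error. That bounds φ(w)
    -- itself by a constant over K + 1, which fails for large K.
    pairing≉0 : ∀ (φ : Fin m → Carrier) → ¬ ⟨ φ , w ⟩ ≈ 0# → Eventually (λ K → ¬ ⟨ φ , ι ∘ v K ⟩ ≈ 0#)
    pairing≉0 φ φw≉0 =
      let a , bound = O-⟨⟩ φ O-δ
          K₀ , unbounded = ¬∀⇒∃¬ (λ all → φw≉0 (archimedean {a = a} all))
      in K₀ , λ K l φv≈0 → unbounded (bounded-shrink (ℕ.s≤s l) (bounded-unscale {a = t K} (bounded-cong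
        (trans (*-congˡ (trans (⟨,δ⟩ φ K) (trans (+-congˡ (trans (-‿cong φv≈0) -0#≈0#)) (+-identityʳ _))))
          (solve 3 (λ x y z → x :* (y :* z) := y :* (x :* z)) refl _ _ _)) (bound K))))
      where open Solver

    -- The entry is an integer and tends to 0, so it is eventually below 1 in absolute value.
    entry≡0 : ∀ i → w i ≈ 0# → Eventually (λ K → v K i ≡ 0ℤ)
    entry≡0 i wi≈0 with O-small (O-pairing (1ᴹ i) (trans (⟨1ᴹ,⟩ i w) wi≈0)) 0
    ... | K₀ , small = K₀ , λ K l → bounded-ι⁻¹
      (bounded-cong (⟨1ᴹ,⟩ i (ι ∘ v K)) (bounded-unscale {a = 0} (small K l)))

    entry≢0 : ∀ i → ¬ w i ≈ 0# → Eventually (λ K → v K i ≢ 0ℤ)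
    entry≢0 i wi≉0 with pairing≉0 (1ᴹ i) (λ e → wi≉0 (trans (sym (⟨1ᴹ,⟩ i w)) e))
    ... | K₀ , p = K₀ , λ K l e → p K l (trans (⟨1ᴹ,⟩ i (ι ∘ v K)) (trans (ι-cong e) 0-homo))

  -- Two distinct zeros would force b = 0 and then a = 0. Excluded middle tells whether there is a
  -- zero s₀ to be passed.
  affine≉0 : ∀ a b → ¬ (a ≈ 0# × b ≈ 0#) → Eventually (λ s → ¬ a + ι (ℤ.+ s) * b ≈ 0#)
  affine≉0 a b nontrivial with em {∃[ s ] a + ι (ℤ.+ s) * b ≈ 0#}
  ... | no none = 0 , λ s _ e → none (s , e)
  ... | yes (s₀ , e₀) = suc s₀ , λ s l e → nontrivial (both s l e)
    where
    open Solver
    both : ∀ s → s₀ < s → a + ι (ℤ.+ s) * b ≈ 0# → a ≈ 0# × b ≈ 0#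
    both s l e = trans (sym (trans (+-congˡ (trans (*-congˡ b≈0) (zeroʳ _))) (+-identityʳ a))) e₀ , b≈0
      where
      b≈0 : b ≈ 0#
      b≈0 = cancel (λ d → ℕ.<⇒≢ l (≡.sym (ℤ.+-injective (ι-difference {ℤ.+ s} {ℤ.+ s₀} d))))
        (trans (solve 4 (λ a b x y → (x :- y) :* b := (a :+ x :* b) :- (a :+ y :* b)) refl a b _ _)
          (trans (+-cong e (-‿cong e₀)) (-‿inverseʳ 0#)))

  O-shift : ∀ {e} K₀ → O e → O (λ K → e (K₀ ℕ.+ K))
  O-shift K₀ (a , p) = a , λ K → bounded-shrink (ℕ.s≤s (ℕ.m≤n+m K K₀)) (p (K₀ ℕ.+ K))

  bounded-unscaleℤ : ∀ {x a} z → z ≢ 0ℤ → Bounded (ι z * x) a → Bounded x a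
  bounded-unscaleℤ (ℤ.+ zero) z≢0 p = ⊥-elim (z≢0 ≡.refl)
  bounded-unscaleℤ (ℤ.+ suc n) z≢0 p = bounded-unscale p
  bounded-unscaleℤ ℤ.-[1+ n ] z≢0 p = bounded-unscale {a = n} (bounded-cong
    (trans (-‿cong (*-congʳ (-‿homo (ℤ.+ suc n))))
      (solve 2 (λ y x → :- ((:- y) :* x) := y :* x) refl _ _))
    (bounded-neg p))
    where open Solver

  ⟨⟩-single : ∀ {m} (φ : Fin m → Carrier) (v : Fin m → ℤ) k → (∀ j → j ≢ k → v j ≡ 0ℤ) →
    ⟨ φ , ι ∘ v ⟩ ≈ ι (v k) * φ k
  ⟨⟩-single {m} φ v k only = begin
    ⟨ φ , ι ∘ v ⟩
      ≈⟨ ⟨⟩-congʳ {m} entry ⟩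
    ⟨ φ , (λ j → ι (v k) * 1ᴹ j k) ⟩
      ≈⟨ ⟨⟩-*ʳ φ (ι (v k)) (λ j → 1ᴹ j k) ⟩
    ι (v k) * ⟨ φ , (λ j → 1ᴹ j k) ⟩
      ≈⟨ *-congˡ (⟨,1ᴹ⟩ φ k) ⟩
    ι (v k) * φ k ∎
    where
    entry : ∀ j → ι (v j) ≈ ι (v k) * 1ᴹ j k
    entry j with j Fin.≟ k
    ... | yes ≡.refl = sym (*-identityʳ _)
    ... | no j≢k = trans (trans (ι-cong (only j j≢k)) 0-homo) (sym (zeroʳ _))

  module ι-Acts = ActsHomomorphism ℤ.+-*-commutativeRing ℤ-identity commutativeRing morphism
  module conj-Acts = ActsHomomorphism commutativeRing morphism commutativeRing morphism

  ι-acts : ∀ {m} {S : Fin m → Set} (os : List (Op S)) v i → ι (ℤLA.acts os v i) ≈ acts os (ι ∘ v) i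
  ι-acts = ι-Acts.acts-homo ι λ x c y → trans (+-homo _ _) (+-congˡ (*-homo _ _))

  conj-acts : ∀ {m} {S : Fin m → Set} (os : List (Op S)) x i → conj (acts os x i) ≈ acts os (conj ∘ x) i
  conj-acts = conj-Acts.acts-homo conj λ x c y →
    trans (conj-+ _ _) (+-congˡ (trans (conj-* _ _) (*-congʳ (conj-ι c))))

  acts-adjointʳ : ∀ {m} {S : Fin m → Set} (os : List (Op S)) φ x →
    ⟨ acts (os ᵀ*) φ , x ⟩ ≈ ⟨ φ , acts os x ⟩
  acts-adjointʳ os φ x = trans (⟨⟩-comm _ x)
    (trans (sym (acts-adjoint os x φ)) (⟨⟩-comm _ φ))

  conj-0 : conj 0# ≈ 0#
  conj-0 = trans (conj-cong (sym 0-homo)) (trans (conj-ι 0ℤ) 0-homo)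

  Everywhere : ∀ {m} → Fin m → Set
  Everywhere _ = ⊤

  everywhere : ∀ {m} (k : Fin m) → Dec (Everywhere k)
  everywhere _ = yes tt

  euclid-everywhere : ∀ {m} (v : Fin m → ℤ) t →
    Σ[ os ∈ List (Op Everywhere) ] (∀ k → k ≢ t → ℤLA.acts os v k ≡ 0ℤ)
  euclid-everywhere v t = euclid Everywhere everywhere v (λ k ¬⊤ → ⊥-elim (¬⊤ tt)) t tt

  ⟦_⟧ : ∀ {n m} → (Fin n → Fin m → Carrier) → (Fin m → Carrier) → Carrier
  ⟦ l ⟧ x = product λ i → ⟨ l i , x ⟩

  ⟦⟧-cong : ∀ {n m} (l : Fin n → Fin m → Carrier) {x y} → (∀ k → x k ≈ y k) → ⟦ l ⟧ x ≈ ⟦ l ⟧ y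
  ⟦⟧-cong {n} {m} l e = product-cong {n} λ i → ⟨⟩-congʳ {m} e

  -- Orbits under elementary operations, and the values of the form on them.

  module Orbit {m} (Z : (Fin m → ℤ) → Set)
    (Z-nonempty : ∃[ z ] Z z) (Z-nonzero : ∀ {z} → Z z → ¬ (∀ i → z i ≡ 0ℤ))
    (Z-resp : ∀ {y z} → (∀ i → y i ≡ z i) → Z y → Z z)
    (Z-act : ∀ {S : Fin m → Set} (o : Op S) {z} → Z z → Z (ℤLA.act o z)) where

    Z-acts : ∀ {S : Fin m → Set} (os : List (Op S)) {z} → Z z → Z (ℤLA.acts os z)
    Z-acts [] Zz = Zz
    Z-acts (o ∷ os) Zz = Z-acts os (Z-act o Zz)

    -- The map x ↦ x + xⱼ u is unimodular when uⱼ = 0. It is carried out one coordinate at a time;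
    -- `cut c` is u with the coordinates from c on replaced by 0.
    Z-shear : ∀ {p} j (u : Fin m → ℤ) → Z p → u j ≡ 0ℤ → Z (λ k → p k ℤ.+ u k ℤ.* p j)
    Z-shear {p} j u Zp uj≡0 = Z-resp
      (λ k → ≡.cong (λ c → p k ℤ.+ c ℤ.* p j) (cut-below m k (Fin.toℕ<n k))) (go m ℕ.≤-refl)
      where
      cut : ℕ → Fin m → ℤ
      cut c k with toℕ k ℕ.<? c
      ... | yes _ = u k
      ... | no _ = 0ℤ
      cut-below : ∀ c k → toℕ k < c → cut c k ≡ u k
      cut-below c k l with toℕ k ℕ.<? c
      ... | yes _ = ≡.refl
      ... | no ¬l = ⊥-elim (¬l l)
      cut-above : ∀ c k → ¬ toℕ k < c → cut c k ≡ 0ℤ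
      cut-above c k ¬l with toℕ k ℕ.<? c
      ... | yes l = ⊥-elim (¬l l)
      ... | no _ = ≡.refl
      cut-j : ∀ c → cut c j ≡ 0ℤ
      cut-j c with toℕ j ℕ.<? c
      ... | yes _ = uj≡0
      ... | no _ = ≡.refl
      y : ℕ → Fin m → ℤ
      y c k = p k ℤ.+ cut c k ℤ.* p j
      -- The entry at j never changes, so each operation adds a multiple of the same number.
      yj : ∀ c → y c j ≡ p j
      yj c = ≡.trans (≡.cong (λ x → p j ℤ.+ x ℤ.* p j) (cut-j c)) (ℤ.+-identityʳ (p j))
      stays : ∀ c k → toℕ k ≢ c → cut c k ≡ cut (suc c) k
      stays c k k≢c with toℕ k ℕ.<? c
      ... | yes l = ≡.sym (cut-below (suc c) k (ℕ.m≤n⇒m≤1+n l))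
      ... | no ¬l = ≡.sym (cut-above (suc c) k λ l → ¬l (ℕ.≤∧≢⇒< (ℕ.≤-pred l) k≢c))
      go : ∀ c → c ≤ m → Z (y c)
      go zero _ = Z-resp (λ k → ≡.sym (ℤ.+-identityʳ (p k))) Zp
      go (suc c) c<m with fromℕ< c<m Fin.≟ j
      ... | yes ≡.refl = Z-resp same (go c (ℕ.<⇒≤ c<m))
        where
        same : ∀ k → y c k ≡ y (suc c) k
        same k with k Fin.≟ j
        ... | yes ≡.refl = ≡.trans (yj c) (≡.sym (yj (suc c)))
        ... | no k≢j = ≡.cong (λ x → p k ℤ.+ x ℤ.* p j) (stays c k λ e →
          k≢j (Fin.toℕ-injective (≡.trans e (≡.sym (Fin.toℕ-fromℕ< c<m)))))
      ... | no i≢j = Z-resp moved (Z-act o (go c (ℕ.<⇒≤ c<m)))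
        where
        i = fromℕ< c<m
        toℕi : toℕ i ≡ c
        toℕi = Fin.toℕ-fromℕ< c<m
        o : Op Everywhere
        o = mkOp j i tt tt (i≢j ∘ ≡.sym) (u i)
        moved : ∀ k → ℤLA.act o (y c) k ≡ y (suc c) k
        moved k with k Fin.≟ i
        ... | no k≢i = ≡.trans (ℤLA.act-other o (y c) k≢i)
          (≡.cong (λ x → p k ℤ.+ x ℤ.* p j) (stays c k λ e →
            k≢i (Fin.toℕ-injective (≡.trans e (≡.sym toℕi)))))
        ... | yes ≡.refl = ≡.trans (ℤLA.act-target o (y c)) (≡.trans
          (≡.cong₂ (λ a b → a ℤ.+ u i ℤ.* b)
            (≡.trans (≡.cong (λ x → p i ℤ.+ x ℤ.* p j)
              (cut-above c i λ l → ℕ.<-irrefl toℕi l)) (ℤ.+-identityʳ (p i)))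
            (yj c))
          (≡.cong (λ x → p i ℤ.+ x ℤ.* p j)
            (≡.sym (cut-below (suc c) i (ℕ.s≤s (ℕ.≤-reflexive toℕi))))))

    -- Finitely many hyperplanes do not cover the orbit. If p avoids all but the first, add s pⱼ to
    -- a coordinate k where the first form has a nonzero coefficient, with j ≠ k and pⱼ ≠ 0: each
    -- form excludes only finitely many s. Such a j exists, since otherwise the first form vanishing
    -- at p would force p = 0.
    generic : ∀ N (Λ : Fin N → Fin m → Carrier) → (∀ i → ¬ (∀ j → Λ i j ≈ 0#)) →
      ∃[ p ] Z p × (∀ i → ¬ ⟨ Λ i , ι ∘ p ⟩ ≈ 0#)
    generic zero Λ Λ≉0 = proj₁ Z-nonempty , proj₂ Z-nonempty , λ ()
    generic (suc N) Λ Λ≉0 with generic N (Λ ∘ suc) (Λ≉0 ∘ suc)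
    ... | p , Zp , p-good with em {⟨ Λ zero , ι ∘ p ⟩ ≈ 0#}
    ...   | no Λ₀p≉0 = p , Zp , λ { zero → Λ₀p≉0 ; (suc i) → p-good i }
    ...   | yes Λ₀p≈0 with ¬∀⇒∃¬ (Λ≉0 zero)
    ...     | k , Λ₀k≉0 with em {∃[ j ] j ≢ k × p j ≢ 0ℤ}
    ...       | no none = ⊥-elim (Z-nonzero Zp p≡0)
      where
      off : ∀ j → j ≢ k → p j ≡ 0ℤ
      off j j≢k = by-contradiction λ pj≢0 → none (j , j≢k , pj≢0)
      p≡0 : ∀ j → p j ≡ 0ℤ
      p≡0 j with j Fin.≟ k
      ... | no j≢k = off j j≢k
      ... | yes ≡.refl = ι-injective (cancel Λ₀k≉0
        (trans (*-comm _ _) (trans (sym (⟨⟩-single (Λ zero) p k off)) Λ₀p≈0)))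
    ...       | yes (j , j≢k , pj≢0) =
      let s₀ , good = eventually-all eventually-good
      in ℤLA.act (o s₀) p , Z-act (o s₀) Zp , λ i e → good s₀ ℕ.≤-refl i (trans (sym (shifted i s₀)) e)
      where
      o : ℕ → Op Everywhere
      o s = mkOp j k tt tt j≢k (ℤ.+ s)
      shifted : ∀ i s → ⟨ Λ i , ι ∘ ℤLA.act (o s) p ⟩ ≈ ⟨ Λ i , ι ∘ p ⟩ + ι (ℤ.+ s) * (ι (p j) * Λ i k)
      shifted i s = begin
        ⟨ Λ i , ι ∘ ℤLA.act (o s) p ⟩
          ≈⟨ ⟨⟩-congʳ {m} (ι-acts (o s ∷ []) p) ⟩
        ⟨ Λ i , act (o s) (ι ∘ p) ⟩
          ≈⟨ ⟨⟩-comm (Λ i) _ ⟩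
        ⟨ act (o s) (ι ∘ p) , Λ i ⟩
          ≈⟨ ⟨⟩-updateAt (ι ∘ p) (Λ i) k _ ⟩
        ⟨ ι ∘ p , Λ i ⟩ + ι (ℤ.+ s) * ι (p j) * Λ i k
          ≈⟨ +-cong (⟨⟩-comm (ι ∘ p) (Λ i)) (*-assoc _ _ _) ⟩
        ⟨ Λ i , ι ∘ p ⟩ + ι (ℤ.+ s) * (ι (p j) * Λ i k) ∎
      eventually-good : ∀ i → Eventually (λ s → ¬ ⟨ Λ i , ι ∘ p ⟩ + ι (ℤ.+ s) * (ι (p j) * Λ i k) ≈ 0#)
      eventually-good zero = affine≉0 _ _ λ (_ , e) → *≉0 (pj≢0 ∘ ι-injective) Λ₀k≉0 e
      eventually-good (suc i) = affine≉0 _ _ λ (e , _) → p-good i e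

    -- The hypotheses in a shape that survives a change of basis. Conjugation invariance is asked of
    -- the product, not of the forms, and limits may be complex.
    record Config {n} (l : Fin n → Fin m → Carrier) : Set where
      field
        nonzero : ∀ i → ¬ (∀ j → l i j ≈ 0#)
        real : ∀ x → ⟦ l ⟧ (conj ∘ x) ≈ conj (⟦ l ⟧ x)
        discrete : ∀ x → ¬ (∀ K → ∃[ z ] Z z × ¬ (⟦ l ⟧ (ι ∘ z) ≈ x) ×
          Bounded (ι (ℤ.+ suc K) * (⟦ l ⟧ (ι ∘ z) - x)) 1)

    module _ {n} {l : Fin n → Fin m → Carrier} (config : Config l) where

      open Config config

      no-approach : ∀ x (z : ℕ → Fin m → ℤ) → (∀ K → Z (z K)) → (∀ K → ¬ (⟦ l ⟧ (ι ∘ z K) ≈ x)) →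
        O (λ K → ⟦ l ⟧ (ι ∘ z K) - x) → ⊥
      no-approach x z Zz z≉x small = discrete x λ K →
        let K₁ , p = O-small small K
        in z K₁ , Zz K₁ , z≉x K₁ , p K₁ ℕ.≤-refl

      -- The new product at x is the old one at the image of x under the transposed list, and this
      -- image of an orbit point is again in the orbit.
      transported : ∀ {S : Fin m → Set} (os : List (Op S)) → Config (λ i → acts os (l i))
      transported os = record
        { nonzero = λ i e → nonzero i λ j → trans (sym (acts-⁻ os (l i) j)) (acts-0 (os ⁻*) e j)
        ; real = λ x → trans (moved (conj ∘ x)) (trans
            (⟦⟧-cong l λ k → sym (conj-acts (os ᵀ*) x k))
            (trans (real (acts (os ᵀ*) x)) (conj-cong (sym (moved x)))))
        ; discrete = λ x approach → discrete x λ K →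
            let z , Zz , z≉x , close = approach K
                same = trans (moved (ι ∘ z)) (⟦⟧-cong l λ k → sym (ι-acts (os ᵀ*) z k))
            in ℤLA.acts (os ᵀ*) z , Z-acts (os ᵀ*) Zz , (λ e → z≉x (trans same e)) ,
               bounded-cong (*-congˡ (+-congʳ same)) close
        }
        where
        moved : ∀ x → ⟦ (λ i → acts os (l i)) ⟧ x ≈ ⟦ l ⟧ (acts (os ᵀ*) x)
        moved x = product-cong {n} λ i → acts-adjoint os (l i) x

      -- For an integer point p and an integer r, F(p + r c̄) is the conjugate of F(p + r c) = F(p),
      -- and F(p) is its own conjugate. So F is constant along c̄ at these points; by
      -- `product-moves` this is impossible if some l i(c̄) ≠ 0, once p is chosen with all l i(p) ≠
      -- 0.
      conj-kernel : ∀ c → (∀ i → ⟨ l i , c ⟩ ≈ 0#) → ∀ i → ⟨ l i , conj ∘ c ⟩ ≈ 0#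
      conj-kernel c lc≈0 i = by-contradiction λ b≉0 → product-moves a b p-good i b≉0 (λ r → begin
        product (λ i → a i + ι (ℤ.+ toℕ r) * b i)
          ≈⟨ product-cong {n} (λ i → sym (translate (l i) (ι (ℤ.+ toℕ r)) (conj ∘ c))) ⟩
        ⟦ l ⟧ (λ k → ι (p k) + ι (ℤ.+ toℕ r) * conj (c k))
          ≈⟨ ⟦⟧-cong l (λ k → sym (trans (conj-+ _ _)
               (+-cong (conj-ι _) (trans (conj-* _ _) (*-congʳ (conj-ι _)))))) ⟩
        ⟦ l ⟧ (conj ∘ (λ k → ι (p k) + ι (ℤ.+ toℕ r) * c k))
          ≈⟨ real _ ⟩
        conj (⟦ l ⟧ (λ k → ι (p k) + ι (ℤ.+ toℕ r) * c k))
          ≈⟨ conj-cong (product-cong {n} λ i → trans (translate (l i) (ι (ℤ.+ toℕ r)) c)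
               (trans (+-congˡ (trans (*-congˡ (lc≈0 i)) (zeroʳ _))) (+-identityʳ _))) ⟩
        conj (⟦ l ⟧ (ι ∘ p))
          ≈⟨ real (ι ∘ p) ⟨
        ⟦ l ⟧ (conj ∘ ι ∘ p)
          ≈⟨ ⟦⟧-cong l (λ k → conj-ι (p k)) ⟩
        product a ∎)
        where
        point = generic n l nonzero
        p = proj₁ point
        p-good = proj₂ (proj₂ point)
        a b : Fin n → Carrier
        a i = ⟨ l i , ι ∘ p ⟩
        b i = ⟨ l i , conj ∘ c ⟩
        translate : ∀ φ s x → ⟨ φ , (λ k → ι (p k) + s * x k) ⟩ ≈ ⟨ φ , ι ∘ p ⟩ + s * ⟨ φ , x ⟩
        translate φ s x = trans (⟨⟩-+ʳ φ (ι ∘ p) (λ k → s * x k)) (+-congˡ (⟨⟩-*ʳ φ s x))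

      -- Twice the real part of c serves unless it vanishes; then c is purely imaginary and 𝕚 c is
      -- real. Both inherit the zeros of c.
      real-kernel : ∀ c → (¬ ∀ j → c j ≈ 0#) → (∀ i → ⟨ l i , c ⟩ ≈ 0#) →
        ∃[ w ] (∀ j → conj (w j) ≈ w j) × (¬ ∀ j → w j ≈ 0#) × (∀ i → ⟨ l i , w ⟩ ≈ 0#) ×
          (∀ j → c j ≈ 0# → w j ≈ 0#)
      real-kernel c c≉0 lc≈0 with em {∀ j → c j + conj (c j) ≈ 0#}
      ... | no re≉0 = (λ j → c j + conj (c j)) ,
        (λ j → trans (conj-+ _ _) (trans (+-congˡ (conj-involutive _)) (+-comm _ _))) ,
        re≉0 ,
        (λ i → trans (⟨⟩-+ʳ (l i) c (conj ∘ c)) (trans (+-cong (lc≈0 i) (conj-kernel c lc≈0 i)) (+-identityˡ 0#))) ,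
        (λ j cj≈0 → trans (+-cong cj≈0 (trans (conj-cong cj≈0) conj-0)) (+-identityˡ 0#))
      ... | yes re≈0 = (λ j → 𝕚 * c j) ,
        (λ j → trans (conj-* _ _) (trans (*-cong conj-𝕚 (c̄ j))
          (solve 2 (λ x y → (:- x) :* (:- y) := x :* y) refl 𝕚 (c j)))) ,
        (λ 𝕚c≈0 → c≉0 λ j → cancel 𝕚≉0 (𝕚c≈0 j)) ,
        (λ i → trans (⟨⟩-*ʳ (l i) 𝕚 c) (trans (*-congˡ (lc≈0 i)) (zeroʳ 𝕚))) ,
        (λ j cj≈0 → trans (*-congˡ cj≈0) (zeroʳ 𝕚))
        where
        open Solver
        c̄ : ∀ j → conj (c j) ≈ - c j
        c̄ j = trans (solve 2 (λ x y → y := (x :+ y) :- x) refl (c j) (conj (c j)))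
          (trans (+-congʳ (re≈0 j)) (+-identityˡ _))
        𝕚≉0 : ¬ 𝕚 ≈ 0#
        𝕚≉0 𝕚≈0 = 1≉0 (trans (sym (-‿involutive 1#)) (trans (-‿cong (trans (sym 𝕚*𝕚) (trans (*-congʳ 𝕚≈0) (zeroˡ 𝕚)))) -0#≈0#))

      module _ (w : Fin m → Carrier) (w-real : ∀ j → conj (w j) ≈ w j) (lw≈0 : ∀ i → ⟨ l i , w ⟩ ≈ 0#) where

        open Approximation w w-real

        -- The integer approximations v of multiples of w have v j = 0, so p + r p_j v stays in
        -- the orbit of p, and the values there approach the value at p without reaching it.
        flat-kernel-vector : ∀ j → w j ≈ 0# → (¬ ∀ k → w k ≈ 0#) →
          ¬ (∀ v → (∀ k → w k ≈ 0# → v k ≡ 0ℤ) → (∀ i → ⟨ l i , ι ∘ v ⟩ ≈ 0#) → ∀ k → v k ≡ 0ℤ)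
        flat-kernel-vector j wj≈0 w≉0 inj = no-approach (product a) z
          (λ K → Z-shear j (u K) Zp (≡.trans (≡.cong ((ℤ.+ toℕ (r K)) ℤ.*_) (supported K j wj≈0)) (ℤ.*-zeroʳ (ℤ.+ toℕ (r K)))))
          (λ K e → proj₂ (choice K) (trans (sym (value K)) e))
          (O-cong (λ K → +-congʳ (sym (value K)))
            (O-product a λ i → O-* (λ K → ι (ℤ.+ toℕ (r K))) (suc n)
              (λ K → bounded-ι (Fin.toℕ<n (r K)))
              (O-scale (ι (p j)) (O-shift K₀ (O-pairing (l i) (lw≈0 i))))))
          where
          Λ : Fin (suc n) → Fin m → Carrier
          -- The added form is the coordinate j, which secures p j ≠ 0.
          Λ zero = 1ᴹ j
          Λ (suc i) = l i
          point = generic (suc n) Λ λ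
            { zero e → 1≉0 (trans (sym (1ᴹ-diagonal j)) (e j))
            ; (suc i) → nonzero i }
          p = proj₁ point
          Zp = proj₁ (proj₂ point)
          pj≉0 : ¬ ι (p j) ≈ 0#
          pj≉0 e = proj₂ (proj₂ point) zero (trans (⟨1ᴹ,⟩ j (ι ∘ p)) e)
          a : Fin n → Carrier
          a i = ⟨ l i , ι ∘ p ⟩
          -- An integer approximating a zero coordinate of w is eventually 0. Thus v inherits the
          -- zeros of w, as `inj` demands.
          support : Eventually (λ K → ∀ k → w k ≈ 0# → v K k ≡ 0ℤ)
          support = eventually-all λ k → entry k em
            where
            entry : ∀ k → Dec (w k ≈ 0#) → Eventually (λ K → w k ≈ 0# → v K k ≡ 0ℤ)
            entry k (yes wk≈0) = let K₀ , q = entry≡0 k wk≈0 in K₀ , λ K l _ → q K l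
            entry k (no wk≉0) = 0 , λ _ _ wk≈0 → ⊥-elim (wk≉0 wk≈0)
          i₀ = ¬∀⇒∃¬ w≉0
          good = eventually-× support (entry≢0 (proj₁ i₀) (proj₂ i₀))
          K₀ = proj₁ good
          v′ : ℕ → Fin m → ℤ
          v′ K = v (K₀ ℕ.+ K)
          supported : ∀ K k → w k ≈ 0# → v′ K k ≡ 0ℤ
          supported K = proj₁ (proj₂ good (K₀ ℕ.+ K) (ℕ.m≤m+n K₀ K))
          -- Since v is eventually nonzero at i₀, `inj` yields some form that does not vanish at v;
          -- one such form is enough for `product-moves`.
          outside : ∀ K → ∃[ i ] ¬ ⟨ l i , ι ∘ v′ K ⟩ ≈ 0#
          outside K = ¬∀⇒∃¬ λ lv≈0 → proj₂ (proj₂ good (K₀ ℕ.+ K) (ℕ.m≤m+n K₀ K))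
            (inj (v′ K) (supported K) lv≈0 (proj₁ i₀))
          b : ℕ → Fin n → Carrier
          b K i = ι (p j) * ⟨ l i , ι ∘ v′ K ⟩
          choice : ∀ K → ∃[ r ] ¬ (product (λ i → a i + ι (ℤ.+ toℕ {suc n} r) * b K i) ≈ product a)
          choice K = ¬∀⇒∃¬ (product-moves a (b K) (λ i → proj₂ (proj₂ point) (suc i))
            (proj₁ (outside K)) (*≉0 pj≉0 (proj₂ (outside K))))
          r : ℕ → Fin (suc n)
          r K = proj₁ (choice K)
          u z : ℕ → Fin m → ℤ
          u K k = (ℤ.+ toℕ (r K)) ℤ.* v′ K k
          z K k = p k ℤ.+ u K k ℤ.* p j
          value : ∀ K → ⟦ l ⟧ (ι ∘ z K) ≈ product (λ i → a i + ι (ℤ.+ toℕ (r K)) * b K i)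
          value K = product-cong {n} λ i → begin
            ⟨ l i , ι ∘ z K ⟩
              ≈⟨ ⟨⟩-congʳ {m} (λ k → trans (+-homo _ _) (+-congˡ
                   (trans (*-homo _ _) (trans (*-congʳ (*-homo _ _))
                     (solve 3 (λ x y z → x :* y :* z := x :* z :* y) refl _ _ _))))) ⟩
            ⟨ l i , (λ k → ι (p k) + R * ι (p j) * ι (v′ K k)) ⟩
              ≈⟨ ⟨⟩-+ʳ (l i) (ι ∘ p) (λ k → R * ι (p j) * ι (v′ K k)) ⟩
            a i + ⟨ l i , (λ k → R * ι (p j) * ι (v′ K k)) ⟩
              ≈⟨ +-congˡ (trans (⟨⟩-*ʳ (l i) (R * ι (p j)) (ι ∘ v′ K)) (*-assoc _ _ _)) ⟩
            a i + R * b K i ∎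
            where
            open Solver
            R = ι (ℤ.+ toℕ (r K))

        -- Here the primitive parts u of the approximations give values tending to 0; a factor
        -- that vanished at u would make a rational form vanish at w.
        oblique-kernel-vector : (∀ φ → ⟨ ι ∘ φ , w ⟩ ≈ 0# → ∀ k → φ k ≡ 0ℤ) →
          ¬ (∀ v → (∀ i → ⟨ l i , ι ∘ v ⟩ ≈ 0#) → ∀ k → v k ≡ 0ℤ)
        -- The limit 0 is written as a product of zeros so that `O-product` applies; `i₀` ensures
        -- that the product has a factor.
        oblique-kernel-vector rational⇒0 inj = no-approach (product {n} (const 0#)) u
          (λ K → Z-acts (os K ⁻*) (Z-acts (proj₁ straight) (proj₂ Z-nonempty)))
          (λ K e → product≉0 (λ i → ⟨ l i , ι ∘ u K ⟩) (lu≉0 K) (trans e (product-zero {n} (const 0#) i₀ refl)))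
          (O-cong (λ K → +-congʳ (product-cong {n} λ i → +-identityˡ _))
            (O-product (const 0#) λ i →
              let a , bound = O-scale (ι d) (O-shift K₀ (O-pairing (l i) (lw≈0 i)))
              in a , λ K → bounded-unscaleℤ (d′ K) (d′≢0 K) (bounded-cong
                (trans (*-congˡ (sym (lu K i))) (solve 3 (λ x y z → x :* (y :* z) := y :* (x :* z)) refl _ _ _))
                (bound K))))
          where
          open Solver hiding (Op)
          z₀ = proj₁ Z-nonempty
          t₀ = proj₁ (¬∀⇒∃¬ (Z-nonzero (proj₂ Z-nonempty)))
          -- Without any form, the vector of ones would contradict `inj`.
          i₀ : Fin n
          i₀ = by-contradiction λ ¬i → one≢0 (inj (const ℤ.1ℤ) (λ i → ⊥-elim (¬i i)) t₀)
            where
            one≢0 : ℤ.1ℤ ≢ 0ℤ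
            one≢0 ()
          -- The orbit contains d times the unit vector at t₀, with d ≠ 0.
          straight = euclid-everywhere z₀ t₀
          z₁ = ℤLA.acts (proj₁ straight) z₀
          d = z₁ t₀
          d≢0 : d ≢ 0ℤ
          d≢0 d≡0 = Z-nonzero (Z-acts (proj₁ straight) (proj₂ Z-nonempty)) λ k → entry k (k Fin.≟ t₀)
            where
            entry : ∀ k → Dec (k ≡ t₀) → z₁ k ≡ 0ℤ
            entry k (yes ≡.refl) = d≡0
            entry k (no k≢t₀) = proj₂ straight k k≢t₀
          good = eventually-all {P = λ i K → ¬ ⟨ l i , ι ∘ v K ⟩ ≈ 0#} λ i →
            let φ , φ≢0 , kills = integer-form m (l i) (nonzero i)
                K₀ , p = pairing≉0 (ι ∘ φ) (λ e → φ≢0 (rational⇒0 φ e))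
            in K₀ , λ K l e → p K l (kills (v K) e)
          K₀ = proj₁ good
          v′ : ℕ → Fin m → ℤ
          v′ K = v (K₀ ℕ.+ K)
          os : ℕ → List (Op Everywhere)
          os K = proj₁ (euclid-everywhere (v′ K) t₀)
          d′ : ℕ → ℤ
          d′ K = ℤLA.acts (os K) (v′ K) t₀
          -- With e the unit vector at t₀, the inverse operations take d′ e to v and d e to u. So d′
          -- u = d v, and u is d times a primitive vector on the line of v.
          u : ℕ → Fin m → ℤ
          u K = ℤLA.acts (os K ⁻*) z₁
          d′u≡dv : ∀ K k → d′ K ℤ.* u K k ≡ d ℤ.* v′ K k
          d′u≡dv K k = ≡.trans (≡.sym (ℤLA.acts-* (os K ⁻*) (d′ K) z₁ k))
            (≡.trans (ℤLA.acts-cong (os K ⁻*) (λ j → entry j (j Fin.≟ t₀)) k)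
              (≡.trans (ℤLA.acts-* (os K ⁻*) d (ℤLA.acts (os K) (v′ K)) k)
                (≡.cong (d ℤ.*_) (ℤLA.acts-⁻ (os K) (v′ K) k))))
            where
            entry : ∀ j → Dec (j ≡ t₀) → d′ K ℤ.* z₁ j ≡ d ℤ.* ℤLA.acts (os K) (v′ K) j
            entry j (yes ≡.refl) = ℤ.*-comm (d′ K) d
            entry j (no j≢t₀) = ≡.trans (≡.cong (d′ K ℤ.*_) (proj₂ straight j j≢t₀))
              (≡.trans (ℤ.*-zeroʳ (d′ K)) (≡.sym (≡.trans
                (≡.cong (d ℤ.*_) (proj₂ (euclid-everywhere (v′ K) t₀) j j≢t₀)) (ℤ.*-zeroʳ d))))
          lu : ∀ K i → ι (d′ K) * ⟨ l i , ι ∘ u K ⟩ ≈ ι d * ⟨ l i , ι ∘ v′ K ⟩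
          lu K i = trans (sym (⟨⟩-*ʳ (l i) (ι (d′ K)) (ι ∘ u K))) (trans
            (⟨⟩-congʳ {m} (λ k → trans (sym (*-homo _ _)) (trans (ι-cong (d′u≡dv K k)) (*-homo _ _))))
            (⟨⟩-*ʳ (l i) (ι d) (ι ∘ v′ K)))
          dlv≉0 : ∀ K i → ¬ ι d * ⟨ l i , ι ∘ v′ K ⟩ ≈ 0#
          dlv≉0 K i = *≉0 (d≢0 ∘ ι-injective) (proj₂ good (K₀ ℕ.+ K) (ℕ.m≤m+n K₀ K) i)
          lu≉0 : ∀ K i → ¬ ⟨ l i , ι ∘ u K ⟩ ≈ 0#
          lu≉0 K i e = dlv≉0 K i (trans (sym (lu K i)) (trans (*-congˡ e) (zeroʳ _)))
          d′≢0 : ∀ K → d′ K ≢ 0ℤ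
          d′≢0 K e = dlv≉0 K i₀ (trans (sym (lu K i₀))
            (trans (*-congʳ (trans (ι-cong e) 0-homo)) (zeroˡ _)))

      -- The coordinates from k on are imposed as m - k further linear equations; n + (m - k) < m
      -- because n < k.
      truncated-kernel : ∀ k → n < k → k ≤ m →
        ∃[ c ] (¬ ∀ j → c j ≈ 0#) × (∀ i → ⟨ l i , c ⟩ ≈ 0#) × (∀ j → k ≤ toℕ j → c j ≈ 0#)
      truncated-kernel k n<k k≤m =
        let c , c≉0 , Λc≈0 = kernel (n ℕ.+ (m ℕ.∸ k)) m enough Λ
        in c , c≉0 ,
           (λ i → trans (reflexive (≡.cong (λ φ → ⟨ φ , c ⟩) (≡.sym (Λ-form i)))) (Λc≈0 (i ↑ˡ (m ℕ.∸ k)))) ,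
           (λ j k≤j → trans (sym (⟨1ᴹ,⟩ j c)) (trans
             (reflexive (≡.cong (λ φ → ⟨ φ , c ⟩) (≡.sym (Λ-entry j k≤j)))) (Λc≈0 (n ↑ʳ fromℕ< (ℕ.∸-monoˡ-< (Fin.toℕ<n j) k≤j)))))
        where
        inside : ∀ (r : Fin (m ℕ.∸ k)) → k ℕ.+ toℕ r < m
        inside r = ℕ.<-≤-trans (ℕ.+-monoʳ-< k (Fin.toℕ<n r)) (ℕ.≤-reflexive (ℕ.m+[n∸m]≡n k≤m))
        enough : n ℕ.+ (m ℕ.∸ k) < m
        enough = ℕ.<-≤-trans (ℕ.+-monoˡ-< (m ℕ.∸ k) n<k) (ℕ.≤-reflexive (ℕ.m+[n∸m]≡n k≤m))
        Λ : Fin (n ℕ.+ (m ℕ.∸ k)) → Fin m → Carrier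
        Λ i = [ l , (λ r → 1ᴹ (fromℕ< (inside r))) ]′ (splitAt n i)
        Λ-form : ∀ i → Λ (i ↑ˡ (m ℕ.∸ k)) ≡ l i
        Λ-form i = ≡.cong [ l , (λ r → 1ᴹ (fromℕ< (inside r))) ]′ (Fin.splitAt-↑ˡ n i (m ℕ.∸ k))
        Λ-entry : ∀ j (k≤j : k ≤ toℕ j) → Λ (n ↑ʳ fromℕ< (ℕ.∸-monoˡ-< (Fin.toℕ<n j) k≤j)) ≡ 1ᴹ j
        Λ-entry j k≤j = ≡.trans
          (≡.cong [ l , (λ r → 1ᴹ (fromℕ< (inside r))) ]′ (Fin.splitAt-↑ʳ n (m ℕ.∸ k) r))
          (≡.cong 1ᴹ (Fin.toℕ-injective (≡.trans (Fin.toℕ-fromℕ< (inside r))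
            (≡.trans (≡.cong (k ℕ.+_) (Fin.toℕ-fromℕ< _)) (ℕ.m+[n∸m]≡n k≤j)))))
          where r = fromℕ< (ℕ.∸-monoˡ-< (Fin.toℕ<n j) k≤j)

    -- A rational relation φ among the entries of w is straightened to w′ j = 0 by a change of basis.
    related-kernel-vector : ∀ {n} {l : Fin n → Fin m → Carrier} → Config l →
      ∀ w → (∀ j → conj (w j) ≈ w j) → (¬ ∀ j → w j ≈ 0#) → (∀ i → ⟨ l i , w ⟩ ≈ 0#) →
      ∀ φ → ⟨ ι ∘ φ , w ⟩ ≈ 0# → (¬ ∀ k → φ k ≡ 0ℤ) →
      ¬ (∀ v → (∀ i → ⟨ l i , ι ∘ v ⟩ ≈ 0#) → ∀ k → v k ≡ 0ℤ)
    related-kernel-vector {l = l} config w w-real w≉0 lw≈0 φ φw≈0 φ≢0 inj =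
      flat-kernel-vector (transported config os) w′
        (λ k → trans (conj-acts ((os ᵀ*) ⁻*) w k) (acts-cong ((os ᵀ*) ⁻*) w-real k))
        (λ i → trans (acts-adjoint os (l i) w′) (trans (⟨⟩-congʳ {m} w-back) (lw≈0 i)))
        j w′j≈0
        (λ w′≈0 → w≉0 λ k → trans (sym (w-back k)) (acts-0 (os ᵀ*) w′≈0 k))
        (λ v _ lv≈0 k → ≡.trans (≡.sym (ℤLA.acts-⁻ (os ᵀ*) v k)) (ℤLA.acts-0 ((os ᵀ*) ⁻*)
          (inj (ℤLA.acts (os ᵀ*) v) λ i → trans (⟨⟩-congʳ {m} (ι-acts (os ᵀ*) v))
            (trans (sym (acts-adjoint os (l i) (ι ∘ v))) (lv≈0 i))) k))
      where
      j = proj₁ (¬∀⇒∃¬ φ≢0)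
      straight = euclid-everywhere φ j
      os = proj₁ straight
      ψ = ℤLA.acts os φ
      -- Moving w contragrediently to φ preserves the pairing: ψ(w′) = φ(w) = 0. As ψ is a nonzero
      -- multiple of the j-th coordinate, w′ j = 0.
      w′ = acts ((os ᵀ*) ⁻*) w
      w-back : ∀ k → acts (os ᵀ*) w′ k ≈ w k
      w-back = ⁻-acts (os ᵀ*) w
      ψj≢0 : ψ j ≢ 0ℤ
      ψj≢0 ψj≡0 = φ≢0 λ k → ≡.trans (≡.sym (ℤLA.acts-⁻ os φ k))
        (ℤLA.acts-0 (os ⁻*) (λ i → entry i (i Fin.≟ j)) k)
        where
        entry : ∀ i → Dec (i ≡ j) → ψ i ≡ 0ℤ
        entry i (yes ≡.refl) = ψj≡0
        entry i (no i≢j) = proj₂ straight i i≢j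
      w′j≈0 : w′ j ≈ 0#
      w′j≈0 = cancel (ψj≢0 ∘ ι-injective) (begin
        ι (ψ j) * w′ j
          ≈⟨ ⟨⟩-single w′ ψ j (proj₂ straight) ⟨
        ⟨ w′ , ι ∘ ψ ⟩
          ≈⟨ ⟨⟩-comm w′ (ι ∘ ψ) ⟩
        ⟨ ι ∘ ψ , w′ ⟩
          ≈⟨ ⟨⟩-cong {m} (ι-acts os φ) (λ _ → refl) ⟩
        ⟨ acts os (ι ∘ φ) , w′ ⟩
          ≈⟨ acts-adjoint os (ι ∘ φ) w′ ⟩
        ⟨ ι ∘ φ , acts (os ᵀ*) w′ ⟩
          ≈⟨ ⟨⟩-congʳ {m} w-back ⟩
        ⟨ ι ∘ φ , w ⟩
          ≈⟨ φw≈0 ⟩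
        0# ∎)

    -- For k < m the truncation already supplies a zero coordinate of w. For k = m it imposes
    -- nothing, and the existence of a rational relation among the entries of w decides between the
    -- two remaining cases.
    integer-kernel-vector : ∀ {n} {l : Fin n → Fin m → Carrier} → Config l → ∀ k → n < k → k ≤ m →
      ∃[ v ] (¬ ∀ j → v j ≡ 0ℤ) × (∀ j → k ≤ toℕ j → v j ≡ 0ℤ) × (∀ i → ⟨ l i , ι ∘ v ⟩ ≈ 0#)
    integer-kernel-vector {n} {l} config k n<k k≤m = by-contradiction λ none →
      let c , c≉0 , lc≈0 , c-support = truncated-kernel config k n<k k≤m
          w , w-real , w≉0 , lw≈0 , w≈0 = real-kernel config c c≉0 lc≈0
          inj : ∀ v → (∀ j → k ≤ toℕ j → v j ≡ 0ℤ) → (∀ i → ⟨ l i , ι ∘ v ⟩ ≈ 0#) → ∀ j → v j ≡ 0ℤ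
          inj v v-support lv≈0 = by-contradiction λ v≢0 → none (v , v≢0 , v-support , lv≈0)
      in cases w w-real w≉0 lw≈0 (λ j k≤j → w≈0 j (c-support j k≤j)) inj (ℕ.m≤n⇒m<n∨m≡n k≤m)
      where
      cases : ∀ w → (∀ j → conj (w j) ≈ w j) → (¬ ∀ j → w j ≈ 0#) → (∀ i → ⟨ l i , w ⟩ ≈ 0#) →
        (∀ j → k ≤ toℕ j → w j ≈ 0#) →
        (∀ v → (∀ j → k ≤ toℕ j → v j ≡ 0ℤ) → (∀ i → ⟨ l i , ι ∘ v ⟩ ≈ 0#) → ∀ j → v j ≡ 0ℤ) →
        k < m ⊎ k ≡ m → ⊥
      cases w w-real w≉0 lw≈0 w-support inj (inj₁ k<m) =
        flat-kernel-vector config w w-real lw≈0 (fromℕ< k<m)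
          (w-support _ (ℕ.≤-reflexive (≡.sym (Fin.toℕ-fromℕ< k<m)))) w≉0
          λ v supported → inj v λ j k≤j → supported j (w-support j k≤j)
      cases w w-real w≉0 lw≈0 w-support inj (inj₂ ≡.refl)
        with em {∃[ φ ] ⟨ ι ∘ φ , w ⟩ ≈ 0# × ¬ (∀ k → φ k ≡ 0ℤ)}
      ... | yes (φ , φw≈0 , φ≢0) =
        related-kernel-vector config w w-real w≉0 lw≈0 φ φw≈0 φ≢0 λ v → inj v (unsupported v)
        where
        unsupported : ∀ v j → m ≤ toℕ j → v j ≡ 0ℤ
        unsupported v j m≤j = ⊥-elim (ℕ.<⇒≱ (Fin.toℕ<n j) m≤j)
      ... | no none = oblique-kernel-vector config w w-real lw≈0
        (λ φ φw≈0 → by-contradiction λ φ≢0 → none (φ , φw≈0 , φ≢0))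
        λ v → inj v λ j m≤j → ⊥-elim (ℕ.<⇒≱ (Fin.toℕ<n j) m≤j)

    -- Successive reductions have different supports; forgetting them makes the lists concatenable.
    weaken : ∀ {S : Fin m → Set} → List (Op S) → List (Op (Everywhere {m}))
    weaken = List.map λ (mkOp s t _ _ s≢t c) → mkOp s t tt tt s≢t c

    acts-weaken : ∀ {S : Fin m → Set} (os : List (Op S)) x i → acts (weaken os) x i ≡ acts os x i
    acts-weaken [] x i = ≡.refl
    acts-weaken (o ∷ os) x i = acts-weaken os (act o x) i

    -- Downward induction on the number k of columns that may be nonzero, stopping at n.
    -- Discreteness is used afresh for each column, through `transported`.
    reduce-columns : ∀ {n} k → k ≤ m → (l : Fin n → Fin m → Carrier) → Config l →
      (∀ i j → k ≤ toℕ j → l i j ≈ 0#) →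
      Σ[ os ∈ List (Op (Everywhere {m})) ] (∀ i j → n ≤ toℕ j → acts os (l i) j ≈ 0#)
    reduce-columns {n} zero _ l config zeros = [] , λ i j _ → zeros i j ℕ.z≤n
    reduce-columns {n} (suc k) k<m l config zeros with suc k ℕ.≤? n
    ... | yes k<n = [] , λ i j n≤j → zeros i j (ℕ.≤-trans k<n n≤j)
    ... | no k≮n =
      let ps , done = reduce-columns k (ℕ.<⇒≤ k<m) l′ (transported config rs) zeros′
      in weaken rs ++ ps , λ i j n≤j → trans (reflexive (acts-++ (weaken rs) ps (l i) j))
           (trans (acts-cong ps (λ j → reflexive (acts-weaken rs (l i) j)) j) (done i j n≤j))
      where
      found = integer-kernel-vector config (suc k) (ℕ.≰⇒> k≮n) k<m
      v = proj₁ found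
      lv≈0 = proj₂ (proj₂ (proj₂ found))
      S : Fin m → Set
      S j = toℕ j < suc k
      t = fromℕ< k<m
      toℕt : toℕ t ≡ k
      toℕt = Fin.toℕ-fromℕ< k<m
      straight = euclid S (λ j → toℕ j ℕ.<? suc k) v (λ j j≮k → proj₁ (proj₂ (proj₂ found)) j (ℕ.≮⇒≥ j≮k))
        t (ℕ.s≤s (ℕ.≤-reflexive toℕt))
      os = proj₁ straight
      u = ℤLA.acts os v
      -- The forms move contragrediently to v, so the new forms at u have the values of the old ones
      -- at v, namely 0.
      rs = (os ⁻*) ᵀ*
      l′ : Fin n → Fin m → Carrier
      l′ i = acts rs (l i)
      ut≢0 : u t ≢ 0ℤ
      ut≢0 ut≡0 = proj₁ (proj₂ found) λ k → ≡.trans (≡.sym (ℤLA.acts-⁻ os v k))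
        (ℤLA.acts-0 (os ⁻*) (λ i → entry i (i Fin.≟ t)) k)
        where
        entry : ∀ i → Dec (i ≡ t) → u i ≡ 0ℤ
        entry i (yes ≡.refl) = ut≡0
        entry i (no i≢t) = proj₂ straight i i≢t
      zeros-t : ∀ i → l′ i t ≈ 0#
      zeros-t i = cancel (ut≢0 ∘ ι-injective) (begin
        ι (u t) * l′ i t
          ≈⟨ ⟨⟩-single (l′ i) u t (proj₂ straight) ⟨
        ⟨ l′ i , ι ∘ u ⟩
          ≈⟨ acts-adjointʳ (os ⁻*) (l i) (ι ∘ u) ⟩
        ⟨ l i , acts (os ⁻*) (ι ∘ u) ⟩
          ≈⟨ ⟨⟩-congʳ {m} (λ j → trans (acts-cong (os ⁻*) (ι-acts os v) j) (acts-⁻ os (ι ∘ v) j)) ⟩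
        ⟨ l i , ι ∘ v ⟩
          ≈⟨ lv≈0 i ⟩
        0# ∎)
      zeros′ : ∀ i j → k ≤ toℕ j → l′ i j ≈ 0#
      zeros′ i j k≤j with ℕ.m≤n⇒m<n∨m≡n k≤j
      -- `rs` touches only the first k + 1 columns.
      ... | inj₁ k<j = trans (reflexive (acts-outside rs (l i) (ℕ.≤⇒≯ k<j))) (zeros i j k<j)
      ... | inj₂ k≡j = trans (reflexive (≡.cong (l′ i) (Fin.toℕ-injective (≡.trans (≡.sym k≡j) (≡.sym toℕt))))) (zeros-t i)

-- Estimates for rational numbers.

module Rationals where

  open import Data.Rational.Base
  open import Data.Rational.Properties
  open import Relation.Binary.PropositionalEquality

  open Data.Rational.Solver.+-*-Solver

  <⇒≱ : ∀ {p q} → p < q → ¬ q ≤ p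
  <⇒≱ p<q q≤p = <-irrefl refl (<-≤-trans p<q q≤p)

  ≤∧≢⇒< : ∀ {p q} → p ≤ q → p ≢ q → p < q
  ≤∧≢⇒< p≤q p≢q = ≰⇒> λ q≤p → p≢q (≤-antisym p≤q q≤p)

  int : ℤ → ℚ
  int z = z / 1

  private
    toℚᵘ-int : ∀ z → toℚᵘ (int z) ℚᵘ.≃ ℚᵘ.mkℚᵘ z 0
    toℚᵘ-int z = toℚᵘ-fromℚᵘ (ℚᵘ.mkℚᵘ z 0)

  int-+ : ∀ a b → int (a ℤ.+ b) ≡ int a + int b
  int-+ a b = toℚᵘ-injective (ℚᵘ.≃-trans (toℚᵘ-int (a ℤ.+ b)) (ℚᵘ.≃-trans
    (ℚᵘ.*≡* (cong₂ (λ x y → (x ℤ.+ y) ℤ.* ℤ.1ℤ) (sym (ℤ.*-identityʳ a)) (sym (ℤ.*-identityʳ b))))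
    (ℚᵘ.≃-sym (ℚᵘ.≃-trans (toℚᵘ-homo-+ (int a) (int b)) (ℚᵘ.+-cong (toℚᵘ-int a) (toℚᵘ-int b))))))

  int-* : ∀ a b → int (a ℤ.* b) ≡ int a * int b
  int-* a b = toℚᵘ-injective (ℚᵘ.≃-trans (toℚᵘ-int (a ℤ.* b)) (ℚᵘ.≃-sym
    (ℚᵘ.≃-trans (toℚᵘ-homo-* (int a) (int b)) (ℚᵘ.*-cong (toℚᵘ-int a) (toℚᵘ-int b)))))

  int-neg : ∀ a → int (ℤ.- a) ≡ - int a
  int-neg a = toℚᵘ-injective (ℚᵘ.≃-trans (toℚᵘ-int (ℤ.- a)) (ℚᵘ.≃-sym
    (ℚᵘ.≃-trans (toℚᵘ-homo‿- (int a)) (ℚᵘ.-‿cong (toℚᵘ-int a)))))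

  int-mono-≤ : ∀ {a b} → a ℤ.≤ b → int a ≤ int b
  int-mono-≤ {a} {b} a≤b = toℚᵘ-cancel-≤ (ℚᵘ.≤-trans (ℚᵘ.≤-reflexive (toℚᵘ-int a))
    (ℚᵘ.≤-trans (ℚᵘ.*≤* (subst₂ ℤ._≤_ (sym (ℤ.*-identityʳ a)) (sym (ℤ.*-identityʳ b)) a≤b))
      (ℚᵘ.≤-reflexive (ℚᵘ.≃-sym (toℚᵘ-int b)))))

  int-cancel-< : ∀ {a b} → int a < int b → a ℤ.< b
  int-cancel-< {a} {b} a<b with a ℤ.<? b
  ... | yes l = l
  ... | no ¬l with () ← <⇒≱ a<b (int-mono-≤ (ℤ.≮⇒≥ ¬l))

  int-injective : ∀ {a b} → int a ≡ int b → a ≡ b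
  int-injective {a} {b} e = ℤ.≤-antisym (reflect a b (≤-reflexive e)) (reflect b a (≤-reflexive (sym e)))
    where
    reflect : ∀ a b → int a ≤ int b → a ℤ.≤ b
    reflect a b p = ℤ.≮⇒≥ λ l → <⇒≱ (≤∧≢⇒< (int-mono-≤ (ℤ.<⇒≤ l)) (strict b a l)) p
      where
      strict : ∀ a b → a ℤ.< b → int a ≢ int b
      strict a b l e with ℚᵘ.*≡* e′ ← ℚᵘ.≃-trans (ℚᵘ.≃-sym (toℚᵘ-int a))
          (ℚᵘ.≃-trans (toℚᵘ-cong e) (toℚᵘ-int b)) =
        ℤ.<⇒≢ l (trans (sym (ℤ.*-identityʳ a)) (trans e′ (ℤ.*-identityʳ b)))

  int-mono-< : ∀ {a b} → a ℤ.< b → int a < int b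
  int-mono-< {a} {b} l = ≤∧≢⇒< (int-mono-≤ (ℤ.<⇒≤ l)) λ e → ℤ.<⇒≢ l (int-injective {a} {b} e)

  nat : ℕ → ℚ
  nat n = int (ℤ.+ n)

  nat-+ : ∀ a b → nat (a ℕ.+ b) ≡ nat a + nat b
  nat-+ a b = int-+ (ℤ.+ a) (ℤ.+ b)

  nat-* : ∀ a b → nat (a ℕ.* b) ≡ nat a * nat b
  nat-* a b = trans (cong int (ℤ.pos-* a b)) (int-* (ℤ.+ a) (ℤ.+ b))

  nat-mono-≤ : ∀ a b → a ℕ.≤ b → nat a ≤ nat b
  nat-mono-≤ a b l = int-mono-≤ {ℤ.+ a} {ℤ.+ b} (ℤ.+≤+ l)

  nat-mono-< : ∀ a b → a ℕ.< b → nat a < nat b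
  nat-mono-< a b l = int-mono-< {ℤ.+ a} {ℤ.+ b} (ℤ.+<+ l)

  0≤nat : ∀ a → 0ℚ ≤ nat a
  0≤nat a = nat-mono-≤ 0 a ℕ.z≤n

  0<nat : ∀ a → 0ℚ < nat (suc a)
  0<nat a = nat-mono-< 0 (suc a) (ℕ.s≤s ℕ.z≤n)

  ∣nat∣ : ∀ a → ∣ nat a ∣ ≡ nat a
  ∣nat∣ a = 0≤p⇒∣p∣≡p (0≤nat a)

  ∣int∣ : ∀ z → ∣ int z ∣ ≡ nat ℤ.∣ z ∣
  ∣int∣ (ℤ.+ n) = ∣nat∣ n
  ∣int∣ ℤ.-[1+ n ] = trans (cong ∣_∣ (int-neg (ℤ.+ suc n))) (trans (∣-p∣≡∣p∣ (nat (suc n))) (∣nat∣ (suc n)))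

  *-monoʳ : ∀ {r p q} → 0ℚ ≤ r → p ≤ q → r * p ≤ r * q
  *-monoʳ {r} 0≤r = *-monoˡ-≤-nonNeg r {{nonNegative 0≤r}}

  *-monoˡ : ∀ {r p q} → 0ℚ ≤ r → p ≤ q → p * r ≤ q * r
  *-monoˡ {r} 0≤r = *-monoʳ-≤-nonNeg r {{nonNegative 0≤r}}

  *-strictʳ : ∀ {r p q} → 0ℚ < r → p < q → r * p < r * q
  *-strictʳ {r} 0<r = *-monoʳ-<-pos r {{positive 0<r}}

  *-cancelˡ-< : ∀ {r p q} → 0ℚ ≤ r → r * p < r * q → p < q
  *-cancelˡ-< {r} 0≤r = *-cancelˡ-<-nonNeg r {{nonNegative 0≤r}}

  *-pos : ∀ {p q} → 0ℚ < p → 0ℚ < q → 0ℚ < p * q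
  *-pos {p} {q} 0<p 0<q = subst (_< p * q) (*-zeroʳ p) (*-strictʳ 0<p 0<q)

  reciprocal : ∀ {p} → 0ℚ < p → ∃[ t ] 0ℚ < t × p * t ≡ 1ℚ
  reciprocal {p} 0<p = 1/ p , positive⁻¹ (1/ p) {{1/pos⇒pos p}} , *-inverseʳ p
    where instance
      _ = positive 0<p
      _ = pos⇒nonZero p

  below-nat : ∀ p → ∃[ n ] p < nat n
  below-nat p@(mkℚ k d _) = suc ℤ.∣ k ∣ , ≤-<-trans
    (toℚᵘ-cancel-≤ (ℚᵘ.≤-trans (ℚᵘ.*≤* bound) (ℚᵘ.≤-reflexive (ℚᵘ.≃-sym (toℚᵘ-int (ℤ.+ ℤ.∣ k ∣))))))
    (nat-mono-< ℤ.∣ k ∣ (suc ℤ.∣ k ∣) (ℕ.n<1+n ℤ.∣ k ∣))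
    where
    bound : k ℤ.* ℤ.1ℤ ℤ.≤ (ℤ.+ ℤ.∣ k ∣) ℤ.* (ℤ.+ suc d)
    bound = ℤ.≤-trans (ℤ.≤-reflexive (ℤ.*-identityʳ k)) (ℤ.≤-trans (i≤∣i∣ k)
      (ℤ.≤-trans (ℤ.+≤+ (ℕ.m≤m*n ℤ.∣ k ∣ (suc d))) (ℤ.≤-reflexive (ℤ.pos-* ℤ.∣ k ∣ (suc d)))))
      where
      i≤∣i∣ : ∀ i → i ℤ.≤ ℤ.+ ℤ.∣ i ∣
      i≤∣i∣ (ℤ.+ n) = ℤ.≤-refl
      i≤∣i∣ ℤ.-[1+ n ] = ℤ.-≤+

  archimedes : ∀ {ε} p → 0ℚ < ε → ∃[ K ] p < nat (suc K) * ε
  archimedes {ε} p 0<ε =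
    let t , 0<t , εt≡1 = reciprocal 0<ε
        n , pt<n = below-nat (p * t)
    in n , subst₂ _<_
      (trans (solve 3 (λ ε p t → ε :* (p :* t) := p :* (ε :* t)) refl ε p t)
        (trans (cong (p *_) εt≡1) (*-identityʳ p)))
      (*-comm ε (nat (suc n)))
      (*-strictʳ 0<ε (<-trans pt<n (nat-mono-< n (suc n) (ℕ.n<1+n n))))

  -- Divide the numerator by the denominator with remainder; the error is the remainder over the
  -- denominator.
  near-integer : ∀ p → ∃[ a ] ∣ p - int a ∣ ≤ 1ℚ
  near-integer p@(mkℚ k d _) = a , subst (_≤ 1ℚ) (sym (0≤p⇒∣p∣≡p (≮⇒≥ nonneg))) (≮⇒≥ below)
    where
    a = k ℤ./ℕ suc d
    D = nat (suc d)
    r = nat (k ℤ.%ℕ suc d)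
    pD : p * D ≡ int k
    pD = toℚᵘ-injective (ℚᵘ.≃-trans (toℚᵘ-homo-* p D) (ℚᵘ.≃-trans
      (ℚᵘ.*-congˡ {toℚᵘ p} (toℚᵘ-int (ℤ.+ suc d)))
      (ℚᵘ.≃-trans (ℚᵘ.*≡* (trans (ℤ.*-identityʳ (k ℤ.* (ℤ.+ suc d)))
        (cong (λ n → k ℤ.* (ℤ.+ n)) (sym (ℕ.*-identityʳ (suc d)))))) (ℚᵘ.≃-sym (toℚᵘ-int k)))))
    remainder : D * (p - int a) ≡ r
    remainder = begin
      D * (p - int a)
        ≡⟨ solve 3 (λ D p a → D :* (p :- a) := p :* D :- a :* D) refl D p (int a) ⟩
      p * D - int a * D
        ≡⟨ cong₂ _-_ (trans pD (trans (cong int (ℤ.a≡a%ℕn+[a/ℕn]*n k (suc d))) (int-+ (ℤ.+ (k ℤ.%ℕ suc d)) (a ℤ.* (ℤ.+ suc d)))))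
             (sym (int-* a (ℤ.+ suc d))) ⟩
      (r + int (a ℤ.* (ℤ.+ suc d))) - int (a ℤ.* (ℤ.+ suc d))
        ≡⟨ solve 2 (λ r x → (r :+ x) :- x := r) refl r _ ⟩
      r ∎
      where open ≡-Reasoning
    nonneg : ¬ p - int a < 0ℚ
    nonneg l = <⇒≱ (subst₂ _<_ remainder (*-zeroʳ D) (*-strictʳ (0<nat d) l)) (0≤nat (k ℤ.%ℕ suc d))
    below : ¬ 1ℚ < p - int a
    below l = <-asym (subst₂ _<_ (*-identityʳ D) remainder (*-strictʳ (0<nat d) l))
      (nat-mono-< (k ℤ.%ℕ suc d) (suc d) (ℤ.n%ℕd<d k (suc d)))

  triangle : ∀ p q r → ∣ p - r ∣ ≤ ∣ p - q ∣ + ∣ q - r ∣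
  triangle p q r = subst (λ x → ∣ x ∣ ≤ ∣ p - q ∣ + ∣ q - r ∣)
    (solve 3 (λ p q r → (p :- q) :+ (q :- r) := p :- r) refl p q r) (∣p+q∣≤∣p∣+∣q∣ (p - q) (q - r))

  ∣p-q∣-comm : ∀ p q → ∣ p - q ∣ ≡ ∣ q - p ∣
  ∣p-q∣-comm p q = trans (sym (∣-p∣≡∣p∣ (p - q))) (cong ∣_∣ (solve 2 (λ p q → :- (p :- q) := q :- p) refl p q))

  halve : ∀ {ε} → 0ℚ < ε → 0ℚ < ε * ½
  halve 0<ε = *-pos 0<ε (positive⁻¹ ½)

  half+half : ∀ ε → ε * ½ + ε * ½ ≡ ε
  half+half ε = trans (sym (*-distribˡ-+ ε ½ ½)) (*-identityʳ ε)

-- Null sequences, bounds, and the rings ℝ and ℂ.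

module RealAndComplexRings where

  open Rationals
  open import Data.Rational.Base using (ℚ; 0ℚ; 1ℚ; ½; ∣_∣; _<_; _≤_; _+_; _*_; -_; _-_)
  open import Data.Rational.Properties
  open import Relation.Binary.PropositionalEquality
  open Data.Rational.Solver.+-*-Solver

  Ev : (ℕ → Set) → Set
  Ev P = ∃[ N ] (∀ {n} → N ℕ.≤ n → P n)

  ev-map : ∀ {P Q : ℕ → Set} → (∀ n → P n → Q n) → Ev P → Ev Q
  ev-map f (N , p) = N , λ {n} l → f n (p l)

  ev-zip : ∀ {P Q R : ℕ → Set} → (∀ n → P n → Q n → R n) → Ev P → Ev Q → Ev R
  ev-zip f (M , p) (N , q) = M ℕ.⊔ N , λ {n} l →
    f n (p (ℕ.m⊔n≤o⇒m≤o M N l)) (q (ℕ.m⊔n≤o⇒n≤o M N l))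

  ev-always : ∀ {P : ℕ → Set} → (∀ n → P n) → Ev P
  ev-always p = 0 , λ {n} _ → p n

  ev-witness : ∀ {P : ℕ → Set} → Ev P → ∃[ n ] P n
  ev-witness (N , p) = N , p ℕ.≤-refl

  Null : (ℕ → ℚ) → Set
  Null a = ∀ ε → 0ℚ < ε → Ev (λ n → ∣ a n ∣ < ε)

  -- For a Cauchy sequence this says that the limit is below q in absolute value. The slack between
  -- q′ and q makes it independent of the representing sequence.
  Below : (ℕ → ℚ) → ℚ → Set
  Below a q = ∃[ q′ ] q′ < q × Ev (λ n → ∣ a n ∣ ≤ q′)

  null-resp : ∀ {a b} → (∀ n → a n ≡ b n) → Null a → Null b
  null-resp e p ε 0<ε = ev-map (λ n → subst (λ x → ∣ x ∣ < ε) (e n)) (p ε 0<ε)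

  null-0 : ∀ {a} → (∀ n → a n ≡ 0ℚ) → Null a
  null-0 e ε 0<ε = ev-always λ n → subst (λ x → ∣ x ∣ < ε) (sym (e n)) 0<ε

  null-+ : ∀ {a b} → Null a → Null b → Null (λ n → a n + b n)
  null-+ {a} {b} p q ε 0<ε = ev-zip
    (λ n u v → ≤-<-trans (∣p+q∣≤∣p∣+∣q∣ (a n) (b n)) (subst (∣ a n ∣ + ∣ b n ∣ <_) (half+half ε) (+-mono-< u v)))
    (p (ε * ½) (halve 0<ε)) (q (ε * ½) (halve 0<ε))

  null-neg : ∀ {a} → Null a → Null (λ n → - a n)
  null-neg {a} p ε 0<ε = ev-map (λ n → subst (_< ε) (sym (∣-p∣≡∣p∣ (a n)))) (p ε 0<ε)

  null-* : ∀ {a b q} → Below b q → Null a → Null (λ n → b n * a n)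
  null-* {a} {b} {q} (q′ , q′<q , bound) p ε 0<ε =
    let t , 0<t , qt≡1 = reciprocal 0<q
    in ev-zip (λ n u v → begin-strict
         ∣ b n * a n ∣      ≡⟨ ∣p*q∣≡∣p∣*∣q∣ (b n) (a n) ⟩
         ∣ b n ∣ * ∣ a n ∣  ≤⟨ *-monoˡ (0≤∣p∣ (a n)) (≤-trans u (<⇒≤ q′<q)) ⟩
         q * ∣ a n ∣        <⟨ *-strictʳ 0<q v ⟩
         q * (ε * t)        ≡⟨ solve 3 (λ q ε t → q :* (ε :* t) := ε :* (q :* t)) refl q ε t ⟩
         ε * (q * t)        ≡⟨ cong (ε *_) qt≡1 ⟩
         ε * 1ℚ             ≡⟨ *-identityʳ ε ⟩
         ε                  ∎) bound (p (ε * t) (*-pos 0<ε 0<t))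
    where
    open ≤-Reasoning
    0<q : 0ℚ < q
    0<q = let n , u = ev-witness bound in ≤-<-trans (≤-trans (0≤∣p∣ (b n)) u) q′<q

  below-bound : ∀ {a q} → Below a q → 0ℚ < q
  below-bound {a} (q′ , q′<q , bound) = let n , u = ev-witness bound in ≤-<-trans (≤-trans (0≤∣p∣ (a n)) u) q′<q

  -- A bound r strictly between q′ and q absorbs the null difference.
  below-resp : ∀ {a b q} → Null (λ n → a n - b n) → Below a q → Below b q
  below-resp {a} {b} {q} e (q′ , q′<q , bound) =
    let r , q′<r , r<q = <-dense q′<q
    in r , r<q , ev-zip (λ n u v → begin
         ∣ b n ∣                    ≡⟨ cong ∣_∣ (solve 2 (λ a b → b := (b :- a) :+ a) refl (a n) (b n)) ⟩
         ∣ (b n - a n) + a n ∣      ≤⟨ ∣p+q∣≤∣p∣+∣q∣ (b n - a n) (a n) ⟩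
         ∣ b n - a n ∣ + ∣ a n ∣    ≡⟨ cong (_+ ∣ a n ∣) (∣p-q∣-comm (b n) (a n)) ⟩
         ∣ a n - b n ∣ + ∣ a n ∣    ≤⟨ +-mono-≤ (<⇒≤ v) u ⟩
         (r - q′) + q′              ≡⟨ solve 2 (λ r q → (r :- q) :+ q := r) refl r q′ ⟩
         r                          ∎) bound (e (r - q′) (subst (_< r - q′) (+-inverseʳ q′) (+-monoˡ-< (- q′) q′<r)))
    where open ≤-Reasoning

  below-≡ : ∀ {a b q} → (∀ n → a n ≡ b n) → Below a q → Below b q
  below-≡ {a} e (q′ , l , bound) = q′ , l , ev-map (λ n → subst (λ x → ∣ x ∣ ≤ q′) (e n)) bound

  below-≤ : ∀ {a p q} → p ≤ q → Below a p → Below a q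
  below-≤ p≤q (q′ , l , bound) = q′ , <-≤-trans l p≤q , bound

  below-+ : ∀ {a b p q} → Below a p → Below b q → Below (λ n → a n + b n) (p + q)
  below-+ {a} {b} (p′ , p′<p , u) (q′ , q′<q , v) = p′ + q′ , +-mono-< p′<p q′<q ,
    ev-zip (λ n x y → ≤-trans (∣p+q∣≤∣p∣+∣q∣ (a n) (b n)) (+-mono-≤ x y)) u v

  below-neg : ∀ {a q} → Below a q → Below (λ n → - a n) q
  below-neg {a} (q′ , l , bound) = q′ , l , ev-map (λ n → subst (_≤ q′) (sym (∣-p∣≡∣p∣ (a n)))) bound

  below-* : ∀ {a b p q} → Below a p → Below b q → Below (λ n → a n * b n) (p * q)
  below-* {a} {b} {p} {q} A@(p′ , p′<p , u) B@(q′ , q′<q , v) = p * q′ , *-strictʳ (below-bound A) q′<q ,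
    ev-zip (λ n x y → begin
      ∣ a n * b n ∣      ≡⟨ ∣p*q∣≡∣p∣*∣q∣ (a n) (b n) ⟩
      ∣ a n ∣ * ∣ b n ∣  ≤⟨ *-monoˡ (0≤∣p∣ (b n)) (≤-trans x (<⇒≤ p′<p)) ⟩
      p * ∣ b n ∣        ≤⟨ *-monoʳ (<⇒≤ (below-bound A)) y ⟩
      p * q′             ∎) u v
    where open ≤-Reasoning

  abstract
    below-cauchy : ∀ x → ∃[ a ] Below (seq x) (nat a)
    below-cauchy x =
      let N , close = cauchy x 1ℚ (0<nat 0)
          a , l = below-nat (1ℚ + ∣ seq x N ∣)
      in a , 1ℚ + ∣ seq x N ∣ , l , N , λ {n} N≤n → begin
           ∣ seq x n ∣
             ≡⟨ cong ∣_∣ (solve 2 (λ a b → b := (b :- a) :+ a) refl (seq x N) (seq x n)) ⟩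
           ∣ (seq x n - seq x N) + seq x N ∣
             ≤⟨ ∣p+q∣≤∣p∣+∣q∣ (seq x n - seq x N) (seq x N) ⟩
           ∣ seq x n - seq x N ∣ + ∣ seq x N ∣
             ≤⟨ +-monoˡ-≤ ∣ seq x N ∣ (<⇒≤ (close N≤n ℕ.≤-refl)) ⟩
           1ℚ + ∣ seq x N ∣ ∎
      where open ≤-Reasoning

  below-shrink : ∀ {x : ℕ → ℚ} {c} a b → a ℕ.≤ b → Below (λ n → nat b * x n) c → Below (λ n → nat a * x n) c
  below-shrink {x} a b a≤b (q , q<c , bound) = q , q<c , ev-map (λ n u → ≤-trans (begin
      ∣ nat a * x n ∣        ≡⟨ ∣p*q∣≡∣p∣*∣q∣ (nat a) (x n) ⟩
      ∣ nat a ∣ * ∣ x n ∣    ≡⟨ cong (_* ∣ x n ∣) (∣nat∣ a) ⟩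
      nat a * ∣ x n ∣        ≤⟨ *-monoˡ (0≤∣p∣ (x n)) (nat-mono-≤ a b a≤b) ⟩
      nat b * ∣ x n ∣        ≡⟨ cong (_* ∣ x n ∣) (∣nat∣ b) ⟨
      ∣ nat b ∣ * ∣ x n ∣    ≡⟨ ∣p*q∣≡∣p∣*∣q∣ (nat b) (x n) ⟨
      ∣ nat b * x n ∣        ∎) u) bound
    where open ≤-Reasoning

  below-divide : ∀ {x : ℕ → ℚ} {c s} → 0ℚ < s → Below (λ n → s * x n) (s * c) → Below x c
  below-divide {x} {c} {s} 0<s (q , q<sc , bound) =
    let t , 0<t , st≡1 = reciprocal 0<s
        unscale : ∀ y → t * (s * y) ≡ y
        unscale y = trans (solve 3 (λ t s y → t :* (s :* y) := (s :* t) :* y) refl t s y)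
          (trans (cong (_* y) st≡1) (*-identityˡ y))
    in t * q , subst (t * q <_) (unscale c) (*-strictʳ 0<t q<sc) , ev-map (λ n u → begin
         ∣ x n ∣                   ≡⟨ unscale ∣ x n ∣ ⟨
         t * (s * ∣ x n ∣)         ≡⟨ cong (λ y → t * (y * ∣ x n ∣)) (0≤p⇒∣p∣≡p (<⇒≤ 0<s)) ⟨
         t * (∣ s ∣ * ∣ x n ∣)     ≡⟨ cong (t *_) (∣p*q∣≡∣p∣*∣q∣ s (x n)) ⟨
         t * ∣ s * x n ∣           ≤⟨ *-monoʳ (<⇒≤ 0<t) u ⟩
         t * q                     ∎) bound
    where open ≤-Reasoning

  -- Choose K with c < (K + 1) ε and divide by K + 1.
  null-archimedean : ∀ {x : ℕ → ℚ} {c} → (∀ K → Below (λ n → nat (suc K) * x n) c) → Null x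
  null-archimedean {x} {c} p ε 0<ε =
    let K , c<Kε = archimedes c 0<ε
        q , q<Kε , bound = below-divide {x} {ε} {nat (suc K)} (0<nat K) (below-≤ (<⇒≤ c<Kε) (p K))
    in ev-map (λ n u → ≤-<-trans u q<Kε) bound

  ≈-≡ : ∀ {x y : ℝ} → (∀ n → seq x n ≡ seq y n) → x ≈ℝ y
  ≈-≡ {x} {y} e = null-0 λ n → trans (cong (_- seq y n) (e n)) (+-inverseʳ (seq y n))

  ≈-refl : ∀ x → x ≈ℝ x
  ≈-refl x = ≈-≡ {x} {x} λ _ → refl

  ≈-sym : ∀ {x y} → x ≈ℝ y → y ≈ℝ x
  ≈-sym {x} {y} p = null-resp (λ n → solve 2 (λ a b → :- (a :- b) := b :- a) refl (seq x n) (seq y n)) (null-neg p)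

  ≈-trans : ∀ {x y z} → x ≈ℝ y → y ≈ℝ z → x ≈ℝ z
  ≈-trans {x} {y} {z} p q = null-resp
    (λ n → solve 3 (λ a b c → (a :- b) :+ (b :- c) := a :- c) refl (seq x n) (seq y n) (seq z n)) (null-+ p q)

  +-congℝ : ∀ {x y z w} → x ≈ℝ y → z ≈ℝ w → x +ℝ z ≈ℝ y +ℝ w
  +-congℝ {x} {y} {z} {w} p q = null-resp
    (λ n → solve 4 (λ a b c d → (a :- b) :+ (c :- d) := (a :+ c) :- (b :+ d)) refl
      (seq x n) (seq y n) (seq z n) (seq w n)) (null-+ p q)

  neg-congℝ : ∀ {x y} → x ≈ℝ y → -ℝ x ≈ℝ -ℝ y
  neg-congℝ {x} {y} p = null-resp
    (λ n → solve 2 (λ a b → :- (a :- b) := (:- a) :- (:- b)) refl (seq x n) (seq y n)) (null-neg p)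

  *-congℝ : ∀ {x y z w} → x ≈ℝ y → z ≈ℝ w → x *ℝ z ≈ℝ y *ℝ w
  *-congℝ {x} {y} {z} {w} p q = null-resp
    (λ n → solve 4 (λ a b c d → a :* (c :- d) :+ d :* (a :- b) := a :* c :- b :* d) refl
      (seq x n) (seq y n) (seq z n) (seq w n))
    (null-+ (null-* (proj₂ (below-cauchy x)) q) (null-* (proj₂ (below-cauchy w)) p))

  abstract
    ℝ-isCommutativeRing : IsCommutative ℝ-rawRing
    ℝ-isCommutativeRing = record
        { isRing = record
          { +-isAbelianGroup = record
            { isGroup = record
              { isMonoid = record
                { isSemigroup = record
                  { isMagma = record
                    { isEquivalence = record
                      { refl = λ {x} → ≈-≡ {x} {x} (λ _ → refl)
                      ; sym = λ {x} {y} → ≈-sym {x} {y}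
                      ; trans = λ {x} {y} {z} → ≈-trans {x} {y} {z} }
                    ; ∙-cong = λ {x} {y} {z} {w} → +-congℝ {x} {y} {z} {w} }
                  ; assoc = λ x y z → ≈-≡ {(x +ℝ y) +ℝ z} {x +ℝ (y +ℝ z)} λ n → +-assoc (seq x n) (seq y n) (seq z n) }
                ; identity = (λ x → ≈-≡ {0ℝ +ℝ x} {x} λ n → +-identityˡ _) , λ x → ≈-≡ {x +ℝ 0ℝ} {x} λ n → +-identityʳ _ }
              ; inverse = (λ x → ≈-≡ {(-ℝ x) +ℝ x} {0ℝ} λ n → +-inverseˡ (seq x n)) ,
                          (λ x → ≈-≡ {x +ℝ (-ℝ x)} {0ℝ} λ n → +-inverseʳ (seq x n))
              ; ⁻¹-cong = λ {x} {y} → neg-congℝ {x} {y} }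
            ; comm = λ x y → ≈-≡ {x +ℝ y} {y +ℝ x} λ n → +-comm (seq x n) (seq y n) }
          ; *-cong = λ {x} {y} {z} {w} → *-congℝ {x} {y} {z} {w}
          ; *-assoc = λ x y z → ≈-≡ {(x *ℝ y) *ℝ z} {x *ℝ (y *ℝ z)} λ n → *-assoc (seq x n) (seq y n) (seq z n)
          ; *-identity = (λ x → ≈-≡ {1ℝ *ℝ x} {x} λ n → *-identityˡ _) , λ x → ≈-≡ {x *ℝ 1ℝ} {x} λ n → *-identityʳ _
          ; distrib = (λ x y z → ≈-≡ {x *ℝ (y +ℝ z)} {x *ℝ y +ℝ x *ℝ z} λ n → *-distribˡ-+ (seq x n) (seq y n) (seq z n)) ,
                      (λ x y z → ≈-≡ {(y +ℝ z) *ℝ x} {y *ℝ x +ℝ z *ℝ x} λ n → *-distribʳ-+ (seq x n) (seq y n) (seq z n)) }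
        ; *-comm = λ x y → ≈-≡ {x *ℝ y} {y *ℝ x} λ n → *-comm (seq x n) (seq y n) }


  ℤ→ℝ : ℤ.+-*-rawRing -Raw-AlmostCommutative⟶ fromCommutativeRing (bundle ℝ-rawRing ℝ-isCommutativeRing)
  ℤ→ℝ = record
    { ⟦_⟧ = fromℤ
    ; +-homo = λ a b → ≈-≡ {fromℤ (a ℤ.+ b)} {fromℤ a +ℝ fromℤ b} λ _ → int-+ a b
    ; *-homo = λ a b → ≈-≡ {fromℤ (a ℤ.* b)} {fromℤ a *ℝ fromℤ b} λ _ → int-* a b
    ; -‿homo = λ a → ≈-≡ {fromℤ (ℤ.- a)} { -ℝ fromℤ a} λ _ → int-neg a
    ; 0-homo = ≈-≡ {fromℤ 0ℤ} {0ℝ} λ _ → refl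
    ; 1-homo = ≈-≡ {fromℤ ℤ.1ℤ} {1ℝ} λ _ → refl }

  private
    module R = CommutativeRing (bundle ℝ-rawRing ℝ-isCommutativeRing)
    module C = RawRing ℂ-rawRing

    reℂ* imℂ* : ℂ → ℂ → ℝ
    reℂ* z w = re z *ℝ re w -ℝ im z *ℝ im w
    imℂ* z w = re z *ℝ im w +ℝ im z *ℝ re w

  abstract
    ℂ-isCommutativeRing : IsCommutative ℂ-rawRing
    ℂ-isCommutativeRing = record
        { isRing = record
          { +-isAbelianGroup = record
            { isGroup = record
              { isMonoid = record
                { isSemigroup = record
                  { isMagma = record
                    { isEquivalence = record
                      { refl = λ {z} → R.refl {re z} , R.refl {im z}
                      ; sym = λ {z} {w} (p , q) → R.sym {re z} {re w} p , R.sym {im z} {im w} q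
                      ; trans = λ {z} {w} {v} (p , q) (p′ , q′) →
                          R.trans {re z} {re w} {re v} p p′ , R.trans {im z} {im w} {im v} q q′ }
                    ; ∙-cong = λ {z} {w} {u} {v} (p , q) (p′ , q′) →
                        +-congℝ {re z} {re w} {re u} {re v} p p′ , +-congℝ {im z} {im w} {im u} {im v} q q′ }
                  ; assoc = λ z w v → R.+-assoc (re z) (re w) (re v) , R.+-assoc (im z) (im w) (im v) }
                ; identity = (λ z → R.+-identityˡ (re z) , R.+-identityˡ (im z)) ,
                             (λ z → R.+-identityʳ (re z) , R.+-identityʳ (im z)) }
              ; inverse = (λ z → R.-‿inverseˡ (re z) , R.-‿inverseˡ (im z)) ,
                          (λ z → R.-‿inverseʳ (re z) , R.-‿inverseʳ (im z))
              ; ⁻¹-cong = λ {z} {w} (p , q) → neg-congℝ {re z} {re w} p , neg-congℝ {im z} {im w} q }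
            ; comm = λ z w → R.+-comm (re z) (re w) , R.+-comm (im z) (im w) }
          ; *-cong = λ {z} {w} {u} {v} (p , q) (p′ , q′) →
              +-congℝ {re z *ℝ re u} {re w *ℝ re v} { -ℝ (im z *ℝ im u)} { -ℝ (im w *ℝ im v)}
                (*-congℝ {re z} {re w} {re u} {re v} p p′)
                (neg-congℝ {im z *ℝ im u} {im w *ℝ im v} (*-congℝ {im z} {im w} {im u} {im v} q q′)) ,
              +-congℝ {re z *ℝ im u} {re w *ℝ im v} {im z *ℝ re u} {im w *ℝ re v}
                (*-congℝ {re z} {re w} {im u} {im v} p q′) (*-congℝ {im z} {im w} {re u} {re v} q p′)
          ; *-assoc = λ z w v →
              ≈-≡ {reℂ* (z C.* w) v} {reℂ* z (w C.* v)} (λ n →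
                solve 6 (λ a b c d e f → (a :* c :- b :* d) :* e :- (a :* d :+ b :* c) :* f
                  := a :* (c :* e :- d :* f) :- b :* (c :* f :+ d :* e)) refl
                  (seq (re z) n) (seq (im z) n) (seq (re w) n) (seq (im w) n) (seq (re v) n) (seq (im v) n)) ,
              ≈-≡ {imℂ* (z C.* w) v} {imℂ* z (w C.* v)} (λ n →
                solve 6 (λ a b c d e f → (a :* c :- b :* d) :* f :+ (a :* d :+ b :* c) :* e
                  := a :* (c :* f :+ d :* e) :+ b :* (c :* e :- d :* f)) refl
                  (seq (re z) n) (seq (im z) n) (seq (re w) n) (seq (im w) n) (seq (re v) n) (seq (im v) n))
          ; *-identity =
              (λ z → ≈-≡ {reℂ* C.1# z} {re z} (λ n →
                       solve 2 (λ a b → con 1ℚ :* a :- con 0ℚ :* b := a) refl (seq (re z) n) (seq (im z) n)) ,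
                     ≈-≡ {imℂ* C.1# z} {im z} (λ n →
                       solve 2 (λ a b → con 1ℚ :* b :+ con 0ℚ :* a := b) refl (seq (re z) n) (seq (im z) n))) ,
              (λ z → ≈-≡ {reℂ* z C.1#} {re z} (λ n →
                       solve 2 (λ a b → a :* con 1ℚ :- b :* con 0ℚ := a) refl (seq (re z) n) (seq (im z) n)) ,
                     ≈-≡ {imℂ* z C.1#} {im z} (λ n →
                       solve 2 (λ a b → a :* con 0ℚ :+ b :* con 1ℚ := b) refl (seq (re z) n) (seq (im z) n)))
          ; distrib =
              (λ z w v →
                ≈-≡ {reℂ* z (w C.+ v)} {reℂ* z w +ℝ reℂ* z v} (λ n →
                  solve 6 (λ a b c d e f → a :* (c :+ e) :- b :* (d :+ f)
                    := (a :* c :- b :* d) :+ (a :* e :- b :* f)) refl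
                    (seq (re z) n) (seq (im z) n) (seq (re w) n) (seq (im w) n) (seq (re v) n) (seq (im v) n)) ,
                ≈-≡ {imℂ* z (w C.+ v)} {imℂ* z w +ℝ imℂ* z v} (λ n →
                  solve 6 (λ a b c d e f → a :* (d :+ f) :+ b :* (c :+ e)
                    := (a :* d :+ b :* c) :+ (a :* f :+ b :* e)) refl
                    (seq (re z) n) (seq (im z) n) (seq (re w) n) (seq (im w) n) (seq (re v) n) (seq (im v) n))) ,
              (λ z w v →
                ≈-≡ {reℂ* (w C.+ v) z} {reℂ* w z +ℝ reℂ* v z} (λ n →
                  solve 6 (λ a b c d e f → (c :+ e) :* a :- (d :+ f) :* b
                    := (c :* a :- d :* b) :+ (e :* a :- f :* b)) refl
                    (seq (re z) n) (seq (im z) n) (seq (re w) n) (seq (im w) n) (seq (re v) n) (seq (im v) n)) ,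
                ≈-≡ {imℂ* (w C.+ v) z} {imℂ* w z +ℝ imℂ* v z} (λ n →
                  solve 6 (λ a b c d e f → (c :+ e) :* b :+ (d :+ f) :* a
                    := (c :* b :+ d :* a) :+ (e :* b :+ f :* a)) refl
                    (seq (re z) n) (seq (im z) n) (seq (re w) n) (seq (im w) n) (seq (re v) n) (seq (im v) n))) }
        ; *-comm = λ z w →
            ≈-≡ {reℂ* z w} {reℂ* w z} (λ n →
              solve 4 (λ a b c d → a :* c :- b :* d := c :* a :- d :* b) refl
                (seq (re z) n) (seq (im z) n) (seq (re w) n) (seq (im w) n)) ,
            ≈-≡ {imℂ* z w} {imℂ* w z} (λ n →
              solve 4 (λ a b c d → a :* d :+ b :* c := c :* b :+ d :* a) refl
                (seq (re z) n) (seq (im z) n) (seq (re w) n) (seq (im w) n)) }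


  ιℂ : ℤ → ℂ
  ιℂ z = realℂ (fromℤ z)

  ℤ→ℂ : ℤ.+-*-rawRing -Raw-AlmostCommutative⟶ fromCommutativeRing (bundle ℂ-rawRing ℂ-isCommutativeRing)
  ℤ→ℂ = record
    { ⟦_⟧ = ιℂ
    ; +-homo = λ a b → ≈-≡ {fromℤ (a ℤ.+ b)} {fromℤ a +ℝ fromℤ b} (λ _ → int-+ a b) ,
        ≈-≡ {0ℝ} {0ℝ +ℝ 0ℝ} (λ _ → refl)
    ; *-homo = λ a b →
        ≈-≡ {fromℤ (a ℤ.* b)} {reℂ* (ιℂ a) (ιℂ b)} (λ _ → trans (int-* a b)
          (solve 2 (λ a b → a :* b := a :* b :- con 0ℚ :* con 0ℚ) refl (int a) (int b))) ,
        ≈-≡ {0ℝ} {imℂ* (ιℂ a) (ιℂ b)} (λ _ →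
          solve 2 (λ a b → con 0ℚ := a :* con 0ℚ :+ con 0ℚ :* b) refl (int a) (int b))
    ; -‿homo = λ a → ≈-≡ {fromℤ (ℤ.- a)} { -ℝ fromℤ a} (λ _ → int-neg a) , ≈-≡ {0ℝ} { -ℝ 0ℝ} (λ _ → refl)
    ; 0-homo = ≈-≡ {fromℤ 0ℤ} {0ℝ} (λ _ → refl) , ≈-≡ {0ℝ} {0ℝ} (λ _ → refl)
    ; 1-homo = ≈-≡ {fromℤ ℤ.1ℤ} {1ℝ} (λ _ → refl) , ≈-≡ {0ℝ} {0ℝ} (λ _ → refl) }

-- Dirichlet approximation, bounds and zero divisors in ℂ.

module ComplexNumbers where

  open Rationals
  open RealAndComplexRings
  open import Data.Rational.Base using (ℚ; 0ℚ; 1ℚ; ½; ∣_∣; _<_; _≤_; _+_; _*_; -_; _-_)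
  open import Data.Rational.Properties
  open import Relation.Binary.PropositionalEquality
  open Data.Rational.Solver.+-*-Solver

  fromℤ-injective : ∀ {z} → fromℤ z ≈ℝ 0ℝ → z ≡ 0ℤ
  fromℤ-injective {z} e =
    let _ , l = ev-witness (e 1ℚ (0<nat 0))
    in ∣z∣<1⇒z≡0 (ℤ.drop‿+<+ (int-cancel-< {ℤ.+ ℤ.∣ z ∣} {ℤ.+ 1} (subst (_< 1ℚ)
         (trans (cong ∣_∣ (+-identityʳ (int z))) (∣int∣ z)) l)))
    where
    ∣z∣<1⇒z≡0 : ∀ {z} → ℤ.∣ z ∣ ℕ.< 1 → z ≡ 0ℤ
    ∣z∣<1⇒z≡0 l = ℤ.∣i∣≡0⇒i≡0 (ℕ.n<1⇒n≡0 l)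

  -- If ε ≤ |a n|, then ε² ≤ a n² + b n².
  square-null : ∀ {a b : ℕ → ℚ} → Null (λ n → a n * a n + b n * b n) → Null a
  square-null {a} {b} p ε 0<ε = ev-map (λ n l → ≰⇒> λ ε≤a → <⇒≱ l (begin
      ε * ε                          ≤⟨ *-monoʳ (<⇒≤ 0<ε) ε≤a ⟩
      ε * ∣ a n ∣                    ≤⟨ *-monoˡ (0≤∣p∣ (a n)) ε≤a ⟩
      ∣ a n ∣ * ∣ a n ∣              ≡⟨ ∣p*q∣≡∣p∣*∣q∣ (a n) (a n) ⟨
      ∣ a n * a n ∣                  ≡⟨ 0≤p⇒∣p∣≡p (square (a n)) ⟩
      a n * a n                      ≡⟨ +-identityʳ (a n * a n) ⟨
      a n * a n + 0ℚ                 ≤⟨ +-monoʳ-≤ (a n * a n) (square (b n)) ⟩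
      a n * a n + b n * b n          ≡⟨ 0≤p⇒∣p∣≡p (≤-trans (≤-reflexive (sym (+-identityʳ 0ℚ))) (+-mono-≤ (square (a n)) (square (b n)))) ⟨
      ∣ a n * a n + b n * b n ∣      ∎)) (p (ε * ε) (*-pos 0<ε 0<ε))
    where
    open ≤-Reasoning
    square : ∀ q → 0ℚ ≤ q * q
    square q = subst (0ℚ ≤_) (square-abs q) (subst (_≤ ∣ q ∣ * ∣ q ∣) (*-zeroʳ ∣ q ∣) (*-monoʳ (0≤∣p∣ q) (0≤∣p∣ q)))
      where
      square-abs : ∀ q → ∣ q ∣ * ∣ q ∣ ≡ q * q
      square-abs q with ∣p∣≡p∨∣p∣≡-p q
      ... | inj₁ e = cong (λ x → x * x) e
      ... | inj₂ e = trans (cong (λ x → x * x) e) (solve 1 (λ q → (:- q) :* (:- q) := q :* q) refl q)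

  half<1 : ½ < 1ℚ
  half<1 = subst₂ _<_ (+-identityˡ ½) refl (+-monoˡ-< ½ (positive⁻¹ ½))

  abstract
    round : ∀ x → ∃[ a ] Below (λ n → seq x n - int a) (nat 2)
    round x =
      let N , close = cauchy x ½ (positive⁻¹ ½)
          a , near = near-integer (seq x N)
      -- ½ comes from the Cauchy tail and 1 from rounding; the total leaves the slack below 2 that
      -- `Below` asks for.
      in a , ½ + 1ℚ , +-monoˡ-< 1ℚ half<1 , N , λ {n} N≤n →
        ≤-trans (triangle (seq x n) (seq x N) (int a)) (+-mono-≤ (<⇒≤ (close N≤n ℕ.≤-refl)) near)

  private
    cancel-remainder : ∀ r q q′ k → (r + q′ * k) - (r + q * k) ≡ k * (q′ - q)
    cancel-remainder = solve 4 (λ r q q′ k → (r :+ q′ :* k) :- (r :+ q :* k) := k :* (q′ :- q)) refl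

    subtract-roundings : ∀ k s′ s x a′ a →
      (k * (s′ * x) - a′) + - (k * (s * x) - a) ≡ k * ((s′ - s) * x) - (a′ - a)
    subtract-roundings = solve 6 (λ k s′ s x a′ a → (k :* (s′ :* x) :- a′) :+ :- (k :* (s :* x) :- a)
      := k :* ((s′ :- s) :* x) :- (a′ :- a)) refl

    factor : ∀ k T x V → k * (T * x) - k * V ≡ k * (T * x - V)
    factor = solve 4 (λ k T x V → k :* (T :* x) :- k :* V := k :* (T :* x :- V)) refl

    add-subtract : ∀ d s → d ≡ (d + s) - s
    add-subtract = solve 2 (λ d s → d := (d :+ s) :- s) refl

  int-quotients : ∀ (a′ a : ℤ) k .{{_ : ℕ.NonZero k}} → a ℤ.%ℕ k ≡ a′ ℤ.%ℕ k →
    int a′ - int a ≡ nat k * int (a′ ℤ./ℕ k ℤ.- a ℤ./ℕ k)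
  int-quotients a′ a k same = begin
    int a′ - int a
      ≡⟨ cong₂ _-_ (decompose a′) (trans (decompose a) (cong (λ r → nat r + int (a ℤ./ℕ k) * nat k) same)) ⟩
    (nat (a′ ℤ.%ℕ k) + int (a′ ℤ./ℕ k) * nat k) - (nat (a′ ℤ.%ℕ k) + int (a ℤ./ℕ k) * nat k)
      ≡⟨ cancel-remainder (nat (a′ ℤ.%ℕ k)) (int (a ℤ./ℕ k)) (int (a′ ℤ./ℕ k)) (nat k) ⟩
    nat k * (int (a′ ℤ./ℕ k) - int (a ℤ./ℕ k))
      ≡⟨ cong (nat k *_) (trans (int-+ (a′ ℤ./ℕ k) (ℤ.- (a ℤ./ℕ k)))
           (cong (λ y → int (a′ ℤ./ℕ k) + y) (int-neg (a ℤ./ℕ k)))) ⟨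
    nat k * int (a′ ℤ./ℕ k ℤ.- a ℤ./ℕ k) ∎
    where
    open ≡-Reasoning
    decompose : ∀ a → int a ≡ nat (a ℤ.%ℕ k) + int (a ℤ./ℕ k) * nat k
    decompose a = trans (cong int (ℤ.a≡a%ℕn+[a/ℕn]*n a k))
      (trans (int-+ (ℤ.+ (a ℤ.%ℕ k)) (a ℤ./ℕ k ℤ.* (ℤ.+ k)))
        (cong (λ y → nat (a ℤ.%ℕ k) + y) (int-* (a ℤ./ℕ k) (ℤ.+ k))))

  nat-suc-pred-∸ : ∀ {s s′} → s ℕ.< s′ → nat (suc (ℕ.pred (s′ ℕ.∸ s))) ≡ nat s′ - nat s
  nat-suc-pred-∸ {s} {s′} s<s′ = begin
    nat (suc (ℕ.pred (s′ ℕ.∸ s)))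
      ≡⟨ cong nat (ℕ.suc-pred (s′ ℕ.∸ s) {{ℕ.>-nonZero (ℕ.m<n⇒0<n∸m s<s′)}}) ⟩
    nat (s′ ℕ.∸ s)
      ≡⟨ add-subtract (nat (s′ ℕ.∸ s)) (nat s) ⟩
    (nat (s′ ℕ.∸ s) + nat s) - nat s
      ≡⟨ cong (_- nat s) (trans (sym (nat-+ (s′ ℕ.∸ s) s)) (cong nat (ℕ.m∸n+n≡m (ℕ.<⇒≤ s<s′)))) ⟩
    nat s′ - nat s ∎
    where open ≡-Reasoning

  -- Subtract the two roundings: the errors add up to 2 + 2 = 4, and since k divides a′ - a, the
  -- factor k can be pulled out of the whole difference.
  equal-residues : ∀ (x : ℕ → ℚ) k .{{_ : ℕ.NonZero k}} {s s′} → s ℕ.< s′ → ∀ a a′ → a ℤ.%ℕ k ≡ a′ ℤ.%ℕ k →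
    Below (λ n → nat k * (nat s * x n) - int a) (nat 2) →
    Below (λ n → nat k * (nat s′ * x n) - int a′) (nat 2) →
    Below (λ n → nat k * (nat (suc (ℕ.pred (s′ ℕ.∸ s))) * x n - int (a′ ℤ./ℕ k ℤ.- a ℤ./ℕ k))) (nat 4)
  equal-residues x k {s} {s′} s<s′ a a′ same p p′ = below-≡ (λ n → begin
      (nat k * (nat s′ * x n) - int a′) + - (nat k * (nat s * x n) - int a)
        ≡⟨ subtract-roundings (nat k) (nat s′) (nat s) (x n) (int a′) (int a) ⟩
      nat k * ((nat s′ - nat s) * x n) - (int a′ - int a)
        ≡⟨ cong₂ (λ T V → nat k * (T * x n) - V) (sym (nat-suc-pred-∸ s<s′)) (int-quotients a′ a k same) ⟩
      nat k * (T * x n) - nat k * V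
        ≡⟨ factor (nat k) T (x n) V ⟩
      nat k * (T * x n - V) ∎)
    (below-+ p′ (below-neg p))
    where
    open ≡-Reasoning
    T V : ℚ
    T = nat (suc (ℕ.pred (s′ ℕ.∸ s)))
    V = int (a′ ℤ./ℕ k ℤ.- a ℤ./ℕ k)

  -- Pigeonhole on the residues modulo k = K + 1 of the integer parts of k s x, s = 0, …, kᵐ.
  abstract
    dirichlet : ∀ {m} (x : Fin m → ℝ) K → Σ[ t ∈ ℕ ] Σ[ v ∈ (Fin m → ℤ) ]
      (∀ i → Below (λ n → nat (suc K) * (nat (suc t) * seq (x i) n - int (v i))) (nat 4))
    dirichlet {m} x K = conclude (Fin.pigeonhole (ℕ.n<1+n (suc K ℕ.^ m)) (λ s → funToFin (residue s)))
      where
      rounded : ∀ s i → ∃[ a ] Below (λ n → nat (suc K) * (nat s * seq (x i) n) - int a) (nat 2)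
      rounded s i = round (fromℚ (nat (suc K)) *ℝ (fromℚ (nat s) *ℝ x i))
      a : Fin (suc (suc K ℕ.^ m)) → Fin m → ℤ
      a s i = proj₁ (rounded (toℕ s) i)
      residue : Fin (suc (suc K ℕ.^ m)) → Fin m → Fin (suc K)
      residue s i = fromℕ< (ℤ.n%ℕd<d (a s i) (suc K))
      same-residue : ∀ s s′ → funToFin (residue s) ≡ funToFin (residue s′) → ∀ i → a s i ℤ.%ℕ suc K ≡ a s′ i ℤ.%ℕ suc K
      same-residue s s′ same i = begin
        a s i ℤ.%ℕ suc K           ≡⟨ Fin.toℕ-fromℕ< (ℤ.n%ℕd<d (a s i) (suc K)) ⟨
        toℕ (residue s i)      ≡⟨ cong toℕ (trans (sym (Fin.finToFun-funToFin (residue s) i))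
                                    (trans (cong (λ f → finToFun f i) same) (Fin.finToFun-funToFin (residue s′) i))) ⟩
        toℕ (residue s′ i)     ≡⟨ Fin.toℕ-fromℕ< (ℤ.n%ℕd<d (a s′ i) (suc K)) ⟩
        a s′ i ℤ.%ℕ suc K          ∎
        where open ≡-Reasoning
      conclude : (∃[ s ] ∃[ s′ ] s Fin.< s′ × funToFin (residue s) ≡ funToFin (residue s′)) →
        Σ[ t ∈ ℕ ] Σ[ v ∈ (Fin m → ℤ) ]
          (∀ i → Below (λ n → nat (suc K) * (nat (suc t) * seq (x i) n - int (v i))) (nat 4))
      conclude (s , s′ , s<s′ , same) =
        ℕ.pred (toℕ s′ ℕ.∸ toℕ s) , (λ i → a s′ i ℤ./ℕ suc K ℤ.- a s i ℤ./ℕ suc K) , λ i →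
          equal-residues (seq (x i)) (suc K) s<s′ (a s i) (a s′ i) (same-residue s s′ same i)
            (proj₂ (rounded (toℕ s) i)) (proj₂ (rounded (toℕ s′) i))

  private
    module C = CommutativeRing (bundle ℂ-rawRing ℂ-isCommutativeRing)

  brahmagupta : ∀ a b c d →
    (a * c - b * d) * (a * c - b * d) + (a * d + b * c) * (a * d + b * c) ≡ (a * a + b * b) * (c * c + d * d)
  brahmagupta = solve 4 (λ a b c d →
    (a :* c :- b :* d) :* (a :* c :- b :* d) :+ (a :* d :+ b :* c) :* (a :* d :+ b :* c)
      := (a :* a :+ b :* b) :* (c :* c :+ d :* d)) refl

  conj : ℂ → ℂ
  conj z = re z +i (-ℝ im z)

  Bounded : ℂ → ℕ → Set
  Bounded z a = Below (seq (re z)) (nat a) × Below (seq (im z)) (nat a)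

  bounded-cong : ∀ {z w a} → z C.≈ w → Bounded z a → Bounded w a
  bounded-cong (p , q) (b , c) = below-resp p b , below-resp q c

  Real⇒im-null : ∀ z → conj z C.≈ z → Null (seq (im z))
  Real⇒im-null z (_ , q) = null-resp
    (λ n → solve 1 (λ x → con (- ½) :* (:- x :- x) := x) refl (seq (im z) n))
    (null-* {q = 1ℚ} (½ , half<1 , ev-always λ _ → ≤-refl) q)

  norm : ℂ → ℝ
  norm z = re z *ℝ re z +ℝ im z *ℝ im z

  norm≈0⇒≈0 : ∀ z → norm z ≈ℝ 0ℝ → z C.≈ C.0#
  norm≈0⇒≈0 z e =
    let e′ = null-resp (λ n → +-identityʳ (seq (norm z) n)) e
        a = seq (re z)
        b = seq (im z)
    in null-resp (λ n → sym (+-identityʳ (a n))) (square-null {a} {b} e′) ,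
       null-resp (λ n → sym (+-identityʳ (b n)))
         (square-null {b} {a} (null-resp (λ n → +-comm (a n * a n) (b n * b n)) e′))

  scale : ℤ → ℂ → ℂ
  scale c z = (fromℤ c *ℝ re z) +i (fromℤ c *ℝ im z)

  -- Multiplication by a real integer leaves terms 0 · y in the complex product. Without them,
  -- bounds can be treated in each component separately.
  ι* : ∀ c (z : ℂ) → (ιℂ c C.* z) C.≈ scale c z
  ι* c z =
    ≈-≡ {re (ιℂ c C.* z)} {fromℤ c *ℝ re z} (λ n →
      solve 3 (λ c x y → c :* x :- con 0ℚ :* y := c :* x) refl (int c) (seq (re z) n) (seq (im z) n)) ,
    ≈-≡ {im (ιℂ c C.* z)} {fromℤ c *ℝ im z} (λ n →
      solve 3 (λ c x y → c :* y :+ con 0ℚ :* x := c :* y) refl (int c) (seq (re z) n) (seq (im z) n))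

  im-identity : ∀ t x y → t * y ≡ t * y + 0ℚ * x + - 0ℚ
  im-identity = solve 3 (λ t x y → t :* y := t :* y :+ con 0ℚ :* x :+ :- con 0ℚ) refl
  re-identity : ∀ t x y v → t * x - v ≡ t * x - 0ℚ * y - v
  re-identity = solve 4 (λ t x y v → t :* x :- v := t :* x :- con 0ℚ :* y :- v) refl
  double : ∀ a b → nat (2 ℕ.* (a ℕ.* b)) ≡ nat a * nat b + nat a * nat b
  double a b = trans (nat-* 2 (a ℕ.* b)) (trans (cong (nat 2 *_) (nat-* a b))
    (trans (*-distribʳ-+ (nat a * nat b) 1ℚ 1ℚ) (cong₂ _+_ (*-identityˡ (nat a * nat b)) (*-identityˡ (nat a * nat b)))))
  constant-below : ∀ a → Below (λ _ → nat a) (nat (suc a))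
  constant-below a = nat a , nat-mono-< a (suc a) (ℕ.n<1+n a) , ev-always λ _ → ≤-reflexive (∣nat∣ a)

  abstract

    bounded-≤ : ∀ {z a b} → a ℕ.≤ b → Bounded z a → Bounded z b
    bounded-≤ {z} {a} {b} a≤b (p , q) = below-≤ (nat-mono-≤ a b a≤b) p , below-≤ (nat-mono-≤ a b a≤b) q

    bounded-+ : ∀ {z w a b} → Bounded z a → Bounded w b → Bounded (z C.+ w) (a ℕ.+ b)
    bounded-+ {z} {w} {a} {b} (p , q) (p′ , q′) =
      subst (Below (seq (re (z C.+ w)))) (sym (nat-+ a b)) (below-+ p p′) ,
      subst (Below (seq (im (z C.+ w)))) (sym (nat-+ a b)) (below-+ q q′)

    bounded-neg : ∀ {z a} → Bounded z a → Bounded (C.- z) a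
    bounded-neg (p , q) = below-neg p , below-neg q

    -- Each component of a product is a sum or difference of two products, whence the factor 2.
    bounded-* : ∀ {z w a b} → Bounded z a → Bounded w b → Bounded (z C.* w) (2 ℕ.* (a ℕ.* b))
    bounded-* {z} {w} {a} {b} (p , q) (p′ , q′) =
      subst (Below (seq (re (z C.* w)))) (sym (double a b)) (below-+ (below-* p p′) (below-neg (below-* q q′))) ,
      subst (Below (seq (im (z C.* w)))) (sym (double a b)) (below-+ (below-* p q′) (below-* q p′))

    bounded : ∀ z → ∃[ a ] Bounded z a
    bounded z =
      let a , p = below-cauchy (re z) ; b , q = below-cauchy (im z)
      in a ℕ.⊔ b , below-≤ (nat-mono-≤ a (a ℕ.⊔ b) (ℕ.m≤m⊔n a b)) p , below-≤ (nat-mono-≤ b (a ℕ.⊔ b) (ℕ.m≤n⊔m a b)) q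

    bounded-ι : ∀ {z a} → ℤ.∣ z ∣ ℕ.< a → Bounded (ιℂ z) a
    bounded-ι {z} {a} l =
      (nat ℤ.∣ z ∣ , nat-mono-< ℤ.∣ z ∣ a l , ev-always λ _ → ≤-reflexive (∣int∣ z)) ,
      (0ℚ , nat-mono-< 0 a (ℕ.≤-<-trans ℕ.z≤n l) , ev-always λ _ → ≤-refl)

    bounded-ι⁻¹ : ∀ {z} → Bounded (ιℂ z) 1 → z ≡ 0ℤ
    bounded-ι⁻¹ {z} ((q , q<1 , bound) , _) =
      let _ , l = ev-witness bound
      in ℤ.∣i∣≡0⇒i≡0 (ℕ.n<1⇒n≡0 (ℤ.drop‿+<+ (int-cancel-< {ℤ.+ ℤ.∣ z ∣} {ℤ.+ 1}
           (≤-<-trans (subst (_≤ q) (∣int∣ z) l) q<1))))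

    unscale : ∀ {z a} c → Bounded (ιℂ c C.* z) a → Bounded (scale c z) a
    unscale {z} {a} c = bounded-cong {ιℂ c C.* z} {scale c z} {a} (ι* c z)

    rescale : ∀ {z a} c → Bounded (scale c z) a → Bounded (ιℂ c C.* z) a
    rescale {z} {a} c = bounded-cong {scale c z} {ιℂ c C.* z} {a} (C.sym {ιℂ c C.* z} {scale c z} (ι* c z))

    bounded-shrink : ∀ {a b z c} → a ℕ.≤ b → Bounded (ιℂ (ℤ.+ b) C.* z) c → Bounded (ιℂ (ℤ.+ a) C.* z) c
    bounded-shrink {a} {b} {z} {c} a≤b p =
      let p′ , q′ = unscale {z} {c} (ℤ.+ b) p
      in rescale {z} {c} (ℤ.+ a) (below-shrink {seq (re z)} a b a≤b p′ , below-shrink {seq (im z)} a b a≤b q′)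

    bounded-divide : ∀ {a z b} → Bounded (ιℂ (ℤ.+ suc a) C.* z) (suc a ℕ.* b) → Bounded z b
    bounded-divide {a} {z} {b} p =
      let p′ , q′ = unscale {z} {suc a ℕ.* b} (ℤ.+ suc a) p
      in below-divide {seq (re z)} (0<nat a) (subst (Below (λ n → nat (suc a) * seq (re z) n)) (nat-* (suc a) b) p′) ,
         below-divide {seq (im z)} (0<nat a) (subst (Below (λ n → nat (suc a) * seq (im z) n)) (nat-* (suc a) b) q′)

    archimedean : ∀ {z a} → (∀ K → Bounded (ιℂ (ℤ.+ suc K) C.* z) a) → z C.≈ C.0#
    archimedean {z} {a} p =
      null-resp (λ n → sym (+-identityʳ (seq (re z) n))) (null-archimedean {seq (re z)} λ K → proj₁ (unscale {z} {a} (ℤ.+ suc K) (p K))) ,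
      null-resp (λ n → sym (+-identityʳ (seq (im z) n))) (null-archimedean {seq (im z)} λ K → proj₂ (unscale {z} {a} (ℤ.+ suc K) (p K)))

    dirichletℂ : ∀ {m} (w : Fin m → ℂ) → (∀ i → conj (w i) C.≈ w i) → ∀ K →
      Σ[ t ∈ ℕ ] Σ[ v ∈ (Fin m → ℤ) ]
        (∀ i → Bounded (ιℂ (ℤ.+ suc K) C.* (ιℂ (ℤ.+ suc t) C.* w i C.- ιℂ (v i))) 4)
    dirichletℂ w w-real K =
      let t , v , close = dirichlet (re ∘ w) K
      in t , v , λ i → close-enough (w i) (w-real i) t (v i) (close i)
      where
      close-enough : ∀ w → conj w C.≈ w → ∀ t v →
        Below (λ n → nat (suc K) * (nat (suc t) * seq (re w) n - int v)) (nat 4) →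
        Bounded (ιℂ (ℤ.+ suc K) C.* (ιℂ (ℤ.+ suc t) C.* w C.- ιℂ v)) 4
      close-enough w w-real t v close = rescale {z} {4} (ℤ.+ suc K)
        (below-≡ (λ n → cong (nat (suc K) *_) (re-identity (nat (suc t)) (seq (re w) n) (seq (im w) n) (int v))) close ,
         -- Realness makes the imaginary sequence null rather than zero, so it is compared with the
         -- zero sequence.
         below-resp {λ _ → 0ℚ} {seq (im scaled)}
           (null-resp (λ n → sym (+-identityˡ (- seq (im scaled) n))) (null-neg scaled-im))
           (0ℚ , 0<nat 3 , ev-always λ _ → ≤-refl))
        where
        z scaled : ℂ
        z = ιℂ (ℤ.+ suc t) C.* w C.- ιℂ v
        scaled = scale (ℤ.+ suc K) z
        im-z : Null (seq (im z))
        im-z = null-resp (λ n → im-identity (nat (suc t)) (seq (re w) n) (seq (im w) n))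
          (null-* (constant-below (suc t)) (Real⇒im-null w w-real))
        scaled-im : Null (seq (im scaled))
        scaled-im = null-* (constant-below (suc K)) im-z

  module Classical (em : {P : Set} → Dec P) where

    -- If no q bounds the sequence away from 0, there are arbitrarily late terms below ε/2, and the
    -- Cauchy property spreads this to all late terms.
    apart : ∀ {x} → ¬ x ≈ℝ 0ℝ → ∃[ q ] 0ℚ < q × Ev (λ n → q ≤ ∣ seq x n ∣)
    apart {x} x≉0 with em {∃[ q ] 0ℚ < q × Ev (λ n → q ≤ ∣ seq x n ∣)}
    ... | yes found = found
    ... | no none = ⊥-elim (x≉0 (null-resp (λ n → sym (+-identityʳ (seq x n))) λ ε 0<ε →
      let N , close = cauchy x (ε * ½) (halve 0<ε)
          M , N≤M , small = find N 0<ε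
      in N , λ {n} N≤n → begin-strict
        ∣ seq x n ∣
          ≡⟨ cong ∣_∣ (solve 2 (λ a b → a := (a :- b) :+ b) refl (seq x n) (seq x M)) ⟩
        ∣ (seq x n - seq x M) + seq x M ∣
          ≤⟨ ∣p+q∣≤∣p∣+∣q∣ (seq x n - seq x M) (seq x M) ⟩
        ∣ seq x n - seq x M ∣ + ∣ seq x M ∣
          <⟨ +-mono-< (close N≤n N≤M) small ⟩
        ε * ½ + ε * ½
          ≡⟨ half+half ε ⟩
        ε ∎))
      where
      open ≤-Reasoning
      find : ∀ N {ε} → 0ℚ < ε → ∃[ M ] N ℕ.≤ M × ∣ seq x M ∣ < ε * ½
      find N {ε} 0<ε with em {∃[ M ] N ℕ.≤ M × ∣ seq x M ∣ < ε * ½}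
      ... | yes p = p
      ... | no ¬p = ⊥-elim (none (ε * ½ , halve 0<ε , N , λ {n} N≤n → ≮⇒≥ λ l → ¬p (n , N≤n , l)))

    -- If x is not 0, it is eventually at least some q > 0 in absolute value, and q can be cancelled
    -- from the estimate for x y.
    ℝ-domain : ∀ {x y} → x *ℝ y ≈ℝ 0ℝ → x ≈ℝ 0ℝ ⊎ y ≈ℝ 0ℝ
    ℝ-domain {x} {y} xy≈0 with em {x ≈ℝ 0ℝ}
    ... | yes x≈0 = inj₁ x≈0
    ... | no x≉0 =
      let q , 0<q , far = apart {x} x≉0
      in inj₂ (null-resp (λ n → sym (+-identityʳ (seq y n))) λ ε 0<ε →
        ev-zip (λ n u v → *-cancelˡ-< (<⇒≤ 0<q) (begin-strict
          q * ∣ seq y n ∣             ≤⟨ *-monoˡ (0≤∣p∣ (seq y n)) u ⟩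
          ∣ seq x n ∣ * ∣ seq y n ∣   ≡⟨ ∣p*q∣≡∣p∣*∣q∣ (seq x n) (seq y n) ⟨
          ∣ seq x n * seq y n ∣       ≡⟨ cong ∣_∣ (+-identityʳ (seq x n * seq y n)) ⟨
          ∣ seq x n * seq y n - 0ℚ ∣  <⟨ v ⟩
          q * ε                       ∎)) far (xy≈0 (q * ε) (*-pos 0<q 0<ε)))
      where open ≤-Reasoning

    -- The norm is multiplicative and vanishes only at 0, which reduces the claim to ℝ.
    ℂ-domain : ∀ {z w} → z C.* w C.≈ C.0# → z C.≈ C.0# ⊎ w C.≈ C.0#
    ℂ-domain {z} {w} (p , q) =
      Sum.map (norm≈0⇒≈0 z) (norm≈0⇒≈0 w) (ℝ-domain {norm z} {norm w} norms)
      where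
      P Q : ℕ → ℚ
      P = seq (re (z C.* w))
      Q = seq (im (z C.* w))
      P-null : Null P
      P-null = null-resp {λ n → P n - 0ℚ} (λ n → +-identityʳ (P n)) p
      Q-null : Null Q
      Q-null = null-resp {λ n → Q n - 0ℚ} (λ n → +-identityʳ (Q n)) q
      squares : Null (λ n → P n * P n + Q n * Q n)
      squares = null-+ {λ n → P n * P n} {λ n → Q n * Q n}
        (null-* {P} {P} (proj₂ (below-cauchy (re (z C.* w)))) P-null)
        (null-* {Q} {Q} (proj₂ (below-cauchy (im (z C.* w)))) Q-null)
      norms : norm z *ℝ norm w ≈ℝ 0ℝ
      norms = null-resp {λ n → P n * P n + Q n * Q n} {λ n → seq (norm z *ℝ norm w) n - 0ℚ}
        (λ n → trans (brahmagupta (seq (re z) n) (seq (im z) n) (seq (re w) n) (seq (im w) n))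
          (sym (+-identityʳ (seq (norm z *ℝ norm w) n)))) squares

    setting : Setting ℂ-rawRing
    setting = record
      { isCommutativeRing = ℂ-isCommutativeRing
      ; morphism = ℤ→ℂ
      ; domain = λ {z} {w} → ℂ-domain {z} {w}
      ; ι-injective = λ {z} (p , _) → fromℤ-injective {z} p
      ; conj = conj
      ; conj-cong = λ {z} {w} (p , q) → p , neg-congℝ {im z} {im w} q
      ; conj-+ = λ z w → ≈-≡ {re z +ℝ re w} {re z +ℝ re w} (λ _ → refl) ,
          ≈-≡ {im (conj (z C.+ w))} {im (conj z C.+ conj w)} (λ n → neg-distrib-+ (seq (im z) n) (seq (im w) n))
      ; conj-* = λ z w →
          ≈-≡ {re (conj (z C.* w))} {re (conj z C.* conj w)} (λ n →
            solve 4 (λ a b c d → a :* c :- b :* d := a :* c :- (:- b) :* (:- d)) refl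
              (seq (re z) n) (seq (im z) n) (seq (re w) n) (seq (im w) n)) ,
          ≈-≡ {im (conj (z C.* w))} {im (conj z C.* conj w)} (λ n →
            solve 4 (λ a b c d → :- (a :* d :+ b :* c) := a :* (:- d) :+ (:- b) :* c) refl
              (seq (re z) n) (seq (im z) n) (seq (re w) n) (seq (im w) n))
      ; conj-ι = λ z → ≈-≡ {fromℤ z} {fromℤ z} (λ _ → refl) , ≈-≡ { -ℝ 0ℝ} {0ℝ} (λ _ → refl)
      ; conj-involutive = λ z → ≈-≡ {re z} {re z} (λ _ → refl) ,
          ≈-≡ { -ℝ (-ℝ im z)} {im z} (λ n → solve 1 (λ x → :- (:- x) := x) refl (seq (im z) n))
      ; 𝕚 = 0ℝ +i 1ℝ
      ; conj-𝕚 = ≈-≡ {0ℝ} { -ℝ 0ℝ} (λ _ → refl) , ≈-≡ { -ℝ 1ℝ} { -ℝ 1ℝ} (λ _ → refl)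
      ; 𝕚*𝕚 = ≈-≡ {0ℝ *ℝ 0ℝ -ℝ 1ℝ *ℝ 1ℝ} { -ℝ 1ℝ} (λ _ → refl) ,
          ≈-≡ {0ℝ *ℝ 1ℝ +ℝ 1ℝ *ℝ 0ℝ} { -ℝ 0ℝ} (λ _ → refl)
      ; Bounded = Bounded
      ; bounded-cong = λ {z} {w} {a} → bounded-cong {z} {w} {a}
      ; bounded-≤ = λ {z} {a} {b} → bounded-≤ {z} {a} {b}
      ; bounded-+ = λ {z} {w} {a} {b} → bounded-+ {z} {w} {a} {b}
      ; bounded-neg = λ {z} {a} → bounded-neg {z} {a}
      ; bounded-* = λ {z} {w} {a} {b} → bounded-* {z} {w} {a} {b}
      ; bounded = bounded
      ; bounded-ι = λ {z} {a} → bounded-ι {z} {a}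
      ; bounded-ι⁻¹ = λ {z} → bounded-ι⁻¹ {z}
      ; bounded-shrink = λ {a} {b} {z} {c} → bounded-shrink {a} {b} {z} {c}
      ; bounded-divide = λ {a} {z} {b} → bounded-divide {a} {z} {b}
      ; archimedean = λ {z} {a} → archimedean {z} {a}
      ; dirichlet = dirichletℂ
      }

-- From values back to polynomials.

module EvaluationHomomorphism (R S : CommutativeRing 0ℓ 0ℓ) where

  private
    module R = CommutativeRing R
    module S = CommutativeRing S
    module R* = Algebra.Definitions.RawSemiring (RawRing.rawSemiring R.rawRing)
    module S* = Algebra.Definitions.RawSemiring (RawRing.rawSemiring S.rawRing)

  module _ (h : R.Carrier → S.Carrier)
    (h-+ : ∀ x y → h (x R.+ y) S.≈ h x S.+ h y) (h-* : ∀ x y → h (x R.* y) S.≈ h x S.* h y)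
    (h-0 : h R.0# S.≈ S.0#) (h-1 : h R.1# S.≈ S.1#) where

    h-^ : ∀ x k → h (x R*.^ k) S.≈ h x S*.^ k
    h-^ x zero = h-1
    h-^ x (suc k) = S.trans (h-* _ _) (S.*-congˡ (h-^ x k))

    h-product : ∀ {n} {f : Fin n → R.Carrier} {g : Fin n → S.Carrier} →
      (∀ i → h (f i) S.≈ g i) → h (R*.product f) S.≈ S*.product g
    h-product {zero} e = h-1
    h-product {suc n} e = S.trans (h-* _ _) (S.*-cong (e zero) (h-product (e ∘ suc)))

    -- Serves both for carrying real values into ℂ and for conjugation, which fixes the coefficients
    -- of f.
    h-evaluateIn : ∀ {A : Set} {m} (φ : A → R.Carrier) (ψ : A → S.Carrier) → (∀ a → h (φ a) S.≈ ψ a) →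
      ∀ (p : Poly A m) xs →
      h (evaluateIn (RawRing.rawSemiring R.rawRing) φ xs p) S.≈ evaluateIn (RawRing.rawSemiring S.rawRing) ψ (h ∘ xs) p
    h-evaluateIn φ ψ e [] xs = h-0
    h-evaluateIn {m = m} φ ψ e ((c , α) ∷ p) xs = S.trans (h-+ _ _) (S.+-cong
      (S.trans (h-* _ _) (S.*-cong (e c) (h-product {m} λ i → h-^ (xs i) (lookup α i))))
      (h-evaluateIn φ ψ e p xs))

evaluate-mapCoefficients : ∀ {A : Set} {m} (R : RawRing 0ℓ 0ℓ) (φ : A → RawRing.Carrier R) (p : Poly A m) xs →
  Polynomials.evaluate R (mapCoefficients φ p) xs ≡ evaluateIn (RawRing.rawSemiring R) φ xs p
evaluate-mapCoefficients R φ [] xs = ≡.refl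
evaluate-mapCoefficients R φ ((c , α) ∷ p) xs =
  ≡.cong (RawRing._+_ R _) (evaluate-mapCoefficients R φ p xs)

module Factorization (C : CommutativeRing 0ℓ 0ℓ)
  (ψ : ℤ.+-*-rawRing -Raw-AlmostCommutative⟶ fromCommutativeRing C) where

  open CommutativeRing C hiding (zero)
  open LinearAlgebraOver C ψ using (⟨_,_⟩)
  open PolynomialsOver C ψ
  open RawRing rawRing using (rawSemiring)
  open Algebra.Definitions.RawSemiring rawSemiring using (product)
  open Polynomials rawRing

  factored : ∀ {A : Set} {m n} (φ : A → Carrier) (f : Poly A m) (l : Fin n → Fin m → Carrier) →
    mapCoefficients φ f ≈ₚ productₚ (λ i → linearForm (l i)) →
    ∀ xs → evaluateIn rawSemiring φ xs f ≈ product λ i → ⟨ l i , xs ⟩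
  factored {m = m} {n} φ f l e xs = trans (reflexive (≡.sym (evaluate-mapCoefficients rawRing φ f xs)))
    (trans (evaluate-≈ₚ (mapCoefficients φ f) (productₚ λ i → linearForm (l i)) e xs)
      (trans (evaluate-product (λ i → linearForm (l i)) xs)
        (product-cong {n} λ i → evaluate-linearForm (l i) xs)))

module Descent
  (Q : CommutativeRing 0ℓ 0ℓ) (φQ : ℤ.+-*-rawRing -Raw-AlmostCommutative⟶ fromCommutativeRing Q)
  (R : CommutativeRing 0ℓ 0ℓ) (φR : ℤ.+-*-rawRing -Raw-AlmostCommutative⟶ fromCommutativeRing R)
  (C : CommutativeRing 0ℓ 0ℓ) (φC : ℤ.+-*-rawRing -Raw-AlmostCommutative⟶ fromCommutativeRing C)
  where

  private
    module Q = CommutativeRing Q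
    module R = CommutativeRing R
    module C = CommutativeRing C
    module QL = LinearAlgebraOver Q φQ
    module RL = LinearAlgebraOver R φR
    module CL = LinearAlgebraOver C φC
    module RP = PolynomialsOver R φR
    module CP = PolynomialsOver C φC
    module ∑ = Algebra.Properties.CommutativeMonoid.Sum C.+-commutativeMonoid
    module C* = Algebra.Definitions.RawSemiring (RawRing.rawSemiring C.rawRing)
  open Polynomials R.rawRing
  open Algebra.Properties.Semiring.Sum C.semiring using (*-distribʳ-sum)

  module _
    (domain : ∀ {x y} → x R.* y R.≈ R.0# → x R.≈ R.0# ⊎ y R.≈ R.0#)
    (ι-injective : ∀ {z} → RL.ι z R.≈ R.0# → z ≡ 0ℤ)
    (q : Q.Carrier → R.Carrier) (e : R.Carrier → C.Carrier)
    (e-+ : ∀ x y → e (x R.+ y) C.≈ e x C.+ e y) (e-* : ∀ x y → e (x R.* y) C.≈ e x C.* e y)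
    (e-0 : e R.0# C.≈ C.0#) (e-cong : ∀ {x y} → x R.≈ y → e x C.≈ e y)
    (e-injective : ∀ {x y} → e x C.≈ e y → x R.≈ y)
    (eq-shear : ∀ x c y → e (q (x Q.+ QL.ι c Q.* y)) C.≈ e (q x) C.+ CL.ι c C.* e (q y))
    (eq-0 : e (q Q.0#) C.≈ C.0#) (eq-1 : e (q Q.1#) C.≈ C.1#) where

    module _ {m n} {S : Fin m → Set} (f : Poly R.Carrier m) (l : Fin n → Fin m → C.Carrier)
      (factored : ∀ x → e (evaluate f x) C.≈ C*.product λ i → CL.⟨ l i , e ∘ x ⟩)
      (os : List (Op S)) (zeros : ∀ i j → n ℕ.≤ toℕ j → CL.acts os (l i) j C.≈ C.0#) where

      private
        H : Fin m → Fin m → R.Carrier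
        H i j = q (QL.matrixOf os i j)

        p : Poly R.Carrier m
        p = substitute (λ i → linearForm (H i)) f

        transformed : (Fin m → R.Carrier) → Fin m → R.Carrier
        transformed x i = RL.⟨ H i , x ⟩

        e-H : ∀ i j → e (H i j) C.≈ CL.matrixOf os i j
        e-H i j = C.trans
          (ActsHomomorphism.acts-homo Q φQ C φC (e ∘ q) eq-shear os (LinearAlgebra.1ᴹ Q.rawRing i) j)
          (CL.acts-cong os identity j)
          where
          identity : ∀ j → e (q (LinearAlgebra.1ᴹ Q.rawRing i j)) C.≈ LinearAlgebra.1ᴹ C.rawRing i j
          identity j with i Fin.≟ j
          ... | yes _ = eq-1
          ... | no _ = eq-0

        e-⟨⟩ : ∀ {k} (a x : Fin k → R.Carrier) → e RL.⟨ a , x ⟩ C.≈ CL.⟨ e ∘ a , e ∘ x ⟩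
        e-⟨⟩ {zero} a x = e-0
        e-⟨⟩ {suc k} a x = C.trans (e-+ _ _) (C.+-cong (e-* _ _) (e-⟨⟩ (a ∘ suc) (x ∘ suc)))

        -- Interchanging the two sums turns a substitution in the point into an operation on the
        -- coefficients.
        pulled-back : ∀ i x → CL.⟨ l i , e ∘ transformed x ⟩ C.≈ CL.⟨ CL.acts os (l i) , e ∘ x ⟩
        pulled-back i x = begin
          C*.sum (λ j → l i j C.* e (transformed x j))
            ≈⟨ CL.sum-cong {m} (λ j → C.*-congˡ (C.trans (e-⟨⟩ (H j) x) (CL.⟨⟩-cong {m} (e-H j) λ _ → C.refl))) ⟩
          C*.sum (λ j → l i j C.* CL.⟨ M j , e ∘ x ⟩)
            ≈⟨ CL.sum-cong {m} (λ j → CL.⟨⟩-*ˡ (l i j) (M j) (e ∘ x)) ⟩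
          C*.sum (λ j → C*.sum (λ k → (l i j C.* M j k) C.* e (x k)))
            ≈⟨ ∑.∑-comm (λ j k → (l i j C.* M j k) C.* e (x k)) ⟩
          C*.sum (λ k → C*.sum (λ j → (l i j C.* M j k) C.* e (x k)))
            ≈⟨ CL.sum-cong {m} (λ k → C.sym (*-distribʳ-sum (e (x k)) (λ j → l i j C.* M j k))) ⟩
          C*.sum (λ k → C*.sum (λ j → l i j C.* M j k) C.* e (x k))
            ≈⟨ CL.sum-cong {m} (λ k → C.*-congʳ (CL.acts-matrixOf os (l i) k)) ⟩
          CL.⟨ CL.acts os (l i) , e ∘ x ⟩ ∎
          where
          open import Relation.Binary.Reasoning.Setoid C.setoid
          M = CL.matrixOf os

        evaluate-p : ∀ x → e (evaluate p x) C.≈ C*.product λ i → CL.⟨ CL.acts os (l i) , e ∘ x ⟩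
        evaluate-p x = C.trans
          (e-cong (R.trans (RP.evaluate-substitute (λ i → linearForm (H i)) f x)
            (RP.evaluate-cong f {λ i → evaluate (linearForm (H i)) x} {transformed x} λ i → RP.evaluate-linearForm (H i) x)))
          (C.trans (factored (transformed x)) (CP.product-cong {n} λ i → pulled-back i x))

        σ : Fin m → Poly R.Carrier m
        σ i = if does (toℕ i ℕ.<? n) then var i else []

        agree : ∀ i x j → CL.acts os (l i) j C.* e (x j) C.≈ CL.acts os (l i) j C.* e (evaluate (σ j) x)
        agree i x j = compare (toℕ j ℕ.<? n)
          where
          vanish : n ℕ.≤ toℕ j → ∀ y → CL.acts os (l i) j C.* y C.≈ C.0#
          vanish n≤j y = C.trans (C.*-congʳ (zeros i j n≤j)) (C.zeroˡ y)
          compare : (d : Dec (toℕ j ℕ.< n)) → CL.acts os (l i) j C.* e (x j) C.≈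
            CL.acts os (l i) j C.* e (evaluate (if does d then var j else []) x)
          compare (yes _) = C.*-congˡ (e-cong (R.sym (RP.evaluate-var j x)))
          compare (no j≮n) = C.trans (vanish (ℕ.≮⇒≥ j≮n) _) (C.sym (vanish (ℕ.≮⇒≥ j≮n) _))

      -- The transformed forms do not see the variables from n on, so both polynomials have the same
      -- values in ℂ and hence in ℝ; over an infinite domain values determine coefficients.
      inFirstVariables : InFirstVariables n p
      inFirstVariables = RP.Domain.evaluate⇒≈ₚ domain ι-injective p (substitute σ p) λ x →
        e-injective (C.trans (evaluate-p x) (C.trans
          (CP.product-cong {n} λ i → CL.sum-cong {m} (agree i x))
          (C.sym (C.trans (e-cong (RP.evaluate-substitute σ p x)) (evaluate-p (λ i → evaluate (σ i) x))))))

open import Relation.Binary.PropositionalEquality using (refl; sym; trans; cong; subst)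

-- Orbits of the integral special linear group, and assembly.

module SLℤ-Orbit {m} (𝒵 : Pred (Vec ℤ m) 0ℓ) (invariant : SLℤ-Invariant 𝒵)
  (nonzero : ∀ {z} → 𝒵 z → z ≢ replicate m 0ℤ) where

  Z : (Fin m → ℤ) → Set
  Z z = 𝒵 (tabulate z)

  Z-resp : ∀ {y z} → (∀ i → y i ≡ z i) → Z y → Z z
  Z-resp e = subst 𝒵 (Vec.tabulate-cong e)

  Z-nonzero : ∀ {z} → Z z → ¬ (∀ i → z i ≡ 0ℤ)
  Z-nonzero {z} Zz z≡0 = nonzero Zz (trans
    (Vec.tabulate-cong λ i → trans (z≡0 i) (sym (Vec.lookup-replicate i 0ℤ)))
    (Vec.tabulate∘lookup (replicate m 0ℤ)))

  Z-act : ∀ {S : Fin m → Set} (o : Op S) {z} → Z z → Z (ℤLA.act o z)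
  Z-act o {z} Zz = Z-resp applied (invariant (ℤLA.toSL ps) Zz)
    where
    ps : List _
    -- `toSL` inverts the list, and a matrix acts on columns through the transposed list. The
    -- inverse transpose undoes both, up to a double negation of the coefficient.
    ps = ((o ᵀ) ⁻) ∷ []
    applied : ∀ i → ℤLA.⟨ ℤLA.matrixOf (ps ⁻*) i , lookup (tabulate z) ⟩ ≡ ℤLA.act o z i
    applied i = trans (ℤLA.⟨matrixOf,⟩ (ps ⁻*) (lookup (tabulate z)) i) (trans
      (ℤLA.acts-cong ((ps ⁻*) ᵀ*) (Vec.lookup∘tabulate z) i)
      (cong (λ c → ℤLA.act (record o { coefficient = c }) z i) (ℤ.neg-involutive (Op.coefficient o))))

module Conclusion (rawC : RawRing 0ℓ 0ℓ) (setting : Setting rawC) (em : {P : Set} → Dec P)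
  (rawQ : RawRing 0ℓ 0ℓ) (isQ : IsCommutative rawQ)
  (φQ : ℤ.+-*-rawRing -Raw-AlmostCommutative⟶ fromCommutativeRing (bundle rawQ isQ))
  (rawR : RawRing 0ℓ 0ℓ) (isR : IsCommutative rawR)
  (φR : ℤ.+-*-rawRing -Raw-AlmostCommutative⟶ fromCommutativeRing (bundle rawR isR))
  where

  open Setting setting

  private
    Q = bundle rawQ isQ
    R = bundle rawR isR
    module Q = CommutativeRing Q
    module R = CommutativeRing R
    module C = CommutativeRing commutativeRing
    module QL = LinearAlgebraOver Q φQ
    module RL = LinearAlgebraOver R φR
    module CL = LinearAlgebraOver commutativeRing morphism
    module CP = PolynomialsOver commutativeRing morphism
    module C* = Algebra.Definitions.RawSemiring (RawRing.rawSemiring C.rawRing)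
    module A = Argument setting em
    open CL using (ι)

  module _
    (domainR : ∀ {x y} → x R.* y R.≈ R.0# → x R.≈ R.0# ⊎ y R.≈ R.0#)
    (ι-injectiveR : ∀ {z} → RL.ι z R.≈ R.0# → z ≡ 0ℤ)
    (q : Q.Carrier → R.Carrier) (e : R.Carrier → C.Carrier)
    (e-+ : ∀ x y → e (x R.+ y) C.≈ e x C.+ e y) (e-* : ∀ x y → e (x R.* y) C.≈ e x C.* e y)
    (e-0 : e R.0# C.≈ C.0#) (e-1 : e R.1# C.≈ C.1#) (fromInteger : ℤ → R.Carrier) (e-fromInteger : ∀ z → e (fromInteger z) C.≈ ι z)
    (e-cong : ∀ {x y} → x R.≈ y → e x C.≈ e y) (e-injective : ∀ {x y} → e x C.≈ e y → x R.≈ y)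
    (conj-e : ∀ x → conj (e x) C.≈ e x)
    (eq-shear : ∀ x c y → e (q (x Q.+ QL.ι c Q.* y)) C.≈ e (q x) C.+ ι c C.* e (q y))
    (eq-0 : e (q Q.0#) C.≈ C.0#) (eq-1 : e (q Q.1#) C.≈ C.1#) where

    module _ {m n} (f : Poly R.Carrier m) (l : Fin n → Fin m → C.Carrier)
      (independent : LinearAlgebra.LinearlyIndependent rawC l)
      (factorization : Polynomials._≈ₚ_ rawC (mapCoefficients e f)
        (Polynomials.productₚ rawC λ i → Polynomials.linearForm rawC (l i)))
      (𝒵 : Pred (Vec ℤ m) 0ℓ) (inhabitant : ∃[ z ] 𝒵 z) (z≢0 : ∀ {z} → 𝒵 z → z ≢ replicate m 0ℤ)
      (invariant : SLℤ-Invariant 𝒵)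
      (Y : Pred R.Carrier 0ℓ) (values : ∀ {z} → 𝒵 z → Y (Polynomials.evaluate rawR f λ i → fromInteger (lookup z i)))
      (discrete : ∀ x → ¬ (∀ K → ∃[ y ] Y y × ¬ (e y C.≈ x) × Bounded (ι (ℤ.+ suc K) C.* (e y C.- x)) 1)) where

      open SLℤ-Orbit 𝒵 invariant z≢0
      open A.Orbit Z (lookup (proj₁ inhabitant) , subst 𝒵 (sym (Vec.tabulate∘lookup _)) (proj₂ inhabitant))
        Z-nonzero Z-resp Z-act

      private
        complexValue : (Fin m → C.Carrier) → C.Carrier
        complexValue x = evaluateIn (RawRing.rawSemiring C.rawRing) e x f

        complexValue≈ : ∀ x → complexValue x C.≈ A.⟦ l ⟧ x
        complexValue≈ = Factorization.factored commutativeRing morphism e f l factorization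

        value : ∀ x → e (Polynomials.evaluate R.rawRing f x) C.≈ A.⟦ l ⟧ (e ∘ x)
        value x = C.trans
          (EvaluationHomomorphism.h-evaluateIn R commutativeRing e e-+ e-* e-0 e-1 id e (λ _ → C.refl) f x)
          (complexValue≈ (e ∘ x))

        conj-1 : conj C.1# C.≈ C.1#
        conj-1 = C.trans (conj-cong (C.sym CL.1-homo)) (C.trans (conj-ι ℤ.1ℤ) CL.1-homo)

        config : Config l
        config = record
          -- If l i were zero, the i-th unit vector would be a nontrivial linear relation.
          { nonzero = λ i li≈0 → PolynomialsOver.Domain.1≉0 commutativeRing morphism domain ι-injective
              (C.trans (C.sym (CL.1ᴹ-diagonal i)) (independent (LinearAlgebra.1ᴹ C.rawRing i)
                (λ j → C.trans (CL.⟨1ᴹ,⟩ i (λ i → l i j)) (li≈0 j)) i))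
          ; real = λ x → C.trans (C.sym (complexValue≈ (conj ∘ x))) (C.trans
              (C.sym (EvaluationHomomorphism.h-evaluateIn commutativeRing commutativeRing conj conj-+ conj-*
                A.conj-0 conj-1 e e conj-e f x))
              (conj-cong (complexValue≈ x)))
          ; discrete = λ x approach → discrete x λ K →
              let z , Zz , z≉x , close = approach K
                  same = C.trans (value (fromInteger ∘ lookup (tabulate z)))
                    (A.⟦⟧-cong l λ i → C.trans (e-fromInteger _) (CL.ι-cong (Vec.lookup∘tabulate z i)))
              in _ , values Zz , (λ eq → z≉x (C.trans (C.sym same) eq)) ,
                 bounded-cong (C.*-congˡ (C.+-congʳ (C.sym same))) close
          }

        reduced = reduce-columns m ℕ.≤-refl l config λ i j m≤j → ⊥-elim (ℕ.<⇒≱ (Fin.toℕ<n j) m≤j)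

      conclusion : Σ[ g ∈ SL rawQ m ] Polynomials.InFirstVariables rawR n
        (Polynomials.substitute rawR
          (λ i → Polynomials.linearForm rawR (λ j → q (SL.inverse g i j))) f)
      conclusion = QL.toSL (proj₁ reduced) ,
        Descent.inFirstVariables Q φQ R φR commutativeRing morphism domainR ι-injectiveR q e
          e-+ e-* e-0 e-cong e-injective eq-shear eq-0 eq-1 f l value (proj₁ reduced) (proj₂ reduced)

-- Specialization to the real and complex numbers.

open Rationals
open RealAndComplexRings
open ComplexNumbers
open import Axiom.ExcludedMiddle using (ExcludedMiddle)
open import Data.Nat using (_≤_)
open import Data.Rational.Base as ℚ using (ℚ; 0ℚ; 1ℚ; ∣_∣)
open import Relation.Unary using (Satisfiable)

private
  module R = CommutativeRing (bundle ℝ-rawRing ℝ-isCommutativeRing)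
  module C = CommutativeRing (bundle ℂ-rawRing ℂ-isCommutativeRing)

ℤ→ℚ : ℤ.+-*-rawRing -Raw-AlmostCommutative⟶ fromCommutativeRing (bundle ℚ.+-*-rawRing ℚ.+-*-isCommutativeRing)
ℤ→ℚ = record
  { ⟦_⟧ = int ; +-homo = int-+ ; *-homo = int-* ; -‿homo = int-neg ; 0-homo = refl ; 1-homo = refl }

realℂ-+ : ∀ x y → realℂ (x +ℝ y) C.≈ realℂ x C.+ realℂ y
realℂ-+ x y = R.refl {x +ℝ y} , ≈-≡ {0ℝ} {0ℝ +ℝ 0ℝ} (λ _ → refl)

realℂ-* : ∀ x y → realℂ (x *ℝ y) C.≈ realℂ x C.* realℂ y
realℂ-* x y =
  ≈-≡ {x *ℝ y} {x *ℝ y -ℝ 0ℝ *ℝ 0ℝ} (λ n → re-part (seq x n) (seq y n)) ,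
  ≈-≡ {0ℝ} {x *ℝ 0ℝ +ℝ 0ℝ *ℝ y} (λ n → im-part (seq x n) (seq y n))
  where
  open Data.Rational.Solver.+-*-Solver
  re-part : ∀ a b → a ℚ.* b ≡ a ℚ.* b ℚ.- 0ℚ ℚ.* 0ℚ
  re-part = solve 2 (λ a b → a :* b := a :* b :- con 0ℚ :* con 0ℚ) refl
  im-part : ∀ a b → 0ℚ ≡ a ℚ.* 0ℚ ℚ.+ 0ℚ ℚ.* b
  im-part = solve 2 (λ a b → con 0ℚ := a :* con 0ℚ :+ con 0ℚ :* b) refl

realℂ-cong : ∀ {x y} → x ≈ℝ y → realℂ x C.≈ realℂ y
realℂ-cong e = e , R.refl {0ℝ}

realℂ-fromℚ-shear : ∀ x c y → realℂ (fromℚ (x ℚ.+ int c ℚ.* y)) C.≈ realℂ (fromℚ x) C.+ ιℂ c C.* realℂ (fromℚ y)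
realℂ-fromℚ-shear x c y = C.trans
  {realℂ (fromℚ (x ℚ.+ int c ℚ.* y))} {realℂ (fromℚ x) C.+ realℂ (fromℤ c *ℝ fromℚ y)}
  {realℂ (fromℚ x) C.+ ιℂ c C.* realℂ (fromℚ y)}
  (≈-≡ {fromℚ (x ℚ.+ int c ℚ.* y)} {fromℚ x +ℝ fromℤ c *ℝ fromℚ y} (λ _ → refl) , ≈-≡ {0ℝ} {0ℝ +ℝ 0ℝ} (λ _ → refl))
  (C.+-congˡ {realℂ (fromℚ x)} {realℂ (fromℤ c *ℝ fromℚ y)} {ιℂ c C.* realℂ (fromℚ y)} (realℂ-* (fromℤ c) (fromℚ y)))

conj-realℂ : ∀ x → conj (realℂ x) C.≈ realℂ x
conj-realℂ x = R.refl {x} , ≈-≡ { -ℝ 0ℝ} {0ℝ} (λ _ → refl)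

module _ (em : {P : Set} → Dec P) where

  open Classical em

  -- The imaginary part of x is forced to vanish, and re x is an accumulation point.
  discrete-in-ℂ : (Y : Pred ℝ 0ℓ) → DiscreteInℝ Y →
    ∀ x → ¬ (∀ K → ∃[ y ] Y y × ¬ (realℂ y C.≈ x) × Bounded (ιℂ (ℤ.+ ℕ.suc K) C.* (realℂ y C.- x)) 1)
  discrete-in-ℂ Y discrete x approach = discrete (re x) accumulation
    where
    im-x : im x ≈ℝ 0ℝ
    im-x = null-resp {λ n → ℚ.- (0ℚ ℚ.- seq (im x) n)} (λ n → double-negative (seq (im x) n))
      (null-neg {λ n → 0ℚ ℚ.- seq (im x) n} (null-archimedean {λ n → 0ℚ ℚ.- seq (im x) n} {nat 1} λ K →
        let y , _ , _ , close = approach K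
        in proj₂ (unscale {realℂ y C.- x} {1} (ℤ.+ ℕ.suc K) close)))
      where
      open Data.Rational.Solver.+-*-Solver
      double-negative : ∀ a → ℚ.- (0ℚ ℚ.- a) ≡ a ℚ.- 0ℚ
      double-negative = solve 1 (λ a → :- (con 0ℚ :- a) := a :- con 0ℚ) refl
    accumulation : AccumulationPoint Y (re x)
    accumulation ε (e , 0<e , far) =
      -- The rational e bounds ε from below. With 1 < (K + 1) e the approach at K puts y eventually
      -- within some q < e of re x.
      let K , 1<Ke = archimedes 1ℚ 0<e
          y , Yy , y≉x , close = approach K
          q , q<e , bound = below-divide {λ n → seq y n ℚ.- seq (re x) n} {e} {nat (ℕ.suc K)} (0<nat K)
            (below-≤ (ℚ.<⇒≤ 1<Ke) (proj₁ (unscale {realℂ y C.- x} {1} (ℤ.+ ℕ.suc K) close)))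
          -- The order on ℝ demands a uniform gap; e - q is what is left on either side.
          gap = e ℚ.- q
          0<gap = subst (ℚ._< gap) (ℚ.+-inverseʳ q) (ℚ.+-monoˡ-< (ℚ.- q) q<e)
      in y , Yy ,
         (λ y≈x → y≉x (y≈x , R.sym {im x} {0ℝ} im-x)) ,
         (gap , 0<gap , ev-zip (λ n → above (seq y n) (seq (re x) n) (seq ε n) e q) far bound) ,
         (gap , 0<gap , ev-zip (λ n → beneath (seq y n) (seq (re x) n) (seq ε n) e q) far bound)
      where
      open Data.Rational.Solver.+-*-Solver
      open ℚ.≤-Reasoning
      p≤∣p∣ : ∀ p → p ℚ.≤ ∣ p ∣
      p≤∣p∣ p = ℚ.≮⇒≥ λ l → <⇒≱ l (positive-case l)
        where
        positive-case : ∣ p ∣ ℚ.< p → p ℚ.≤ ∣ p ∣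
        positive-case l = ℚ.≤-reflexive (sym (ℚ.0≤p⇒∣p∣≡p (ℚ.≤-trans (ℚ.0≤∣p∣ p) (ℚ.<⇒≤ l))))
      beneath : ∀ y x ε e q → 0ℚ ℚ.+ e ℚ.≤ ε → ∣ y ℚ.- x ∣ ℚ.≤ q → y ℚ.+ (e ℚ.- q) ℚ.≤ x ℚ.+ ε
      beneath y x ε e q e≤ε close = begin
        y ℚ.+ (e ℚ.- q)
          ≡⟨ solve 4 (λ y x e q → y :+ (e :- q) := (y :- x) :+ (x :+ (e :- q))) refl y x e q ⟩
        (y ℚ.- x) ℚ.+ (x ℚ.+ (e ℚ.- q))
          ≤⟨ ℚ.+-monoˡ-≤ (x ℚ.+ (e ℚ.- q)) (ℚ.≤-trans (p≤∣p∣ (y ℚ.- x)) close) ⟩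
        q ℚ.+ (x ℚ.+ (e ℚ.- q))
          ≡⟨ solve 3 (λ x e q → q :+ (x :+ (e :- q)) := x :+ (con 0ℚ :+ e)) refl x e q ⟩
        x ℚ.+ (0ℚ ℚ.+ e)
          ≤⟨ ℚ.+-monoʳ-≤ x e≤ε ⟩
        x ℚ.+ ε ∎
      above : ∀ y x ε e q → 0ℚ ℚ.+ e ℚ.≤ ε → ∣ y ℚ.- x ∣ ℚ.≤ q → (x ℚ.- ε) ℚ.+ (e ℚ.- q) ℚ.≤ y
      above y x ε e q e≤ε close = begin
        (x ℚ.- ε) ℚ.+ (e ℚ.- q)
          ≡⟨ solve 4 (λ x ε e q → (x :- ε) :+ (e :- q) := (x :+ (con 0ℚ :+ e)) :+ (:- ε :- q)) refl x ε e q ⟩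
        (x ℚ.+ (0ℚ ℚ.+ e)) ℚ.+ (ℚ.- ε ℚ.- q)
          ≤⟨ ℚ.+-monoˡ-≤ (ℚ.- ε ℚ.- q) (ℚ.+-monoʳ-≤ x e≤ε) ⟩
        (x ℚ.+ ε) ℚ.+ (ℚ.- ε ℚ.- q)
          ≡⟨ solve 4 (λ y x ε q → (x :+ ε) :+ (:- ε :- q) := (x :- y) :+ (y :- q)) refl y x ε q ⟩
        (x ℚ.- y) ℚ.+ (y ℚ.- q)
          ≤⟨ ℚ.+-monoˡ-≤ (y ℚ.- q) (ℚ.≤-trans (p≤∣p∣ (x ℚ.- y))
               (ℚ.≤-trans (ℚ.≤-reflexive (∣p-q∣-comm x y)) close)) ⟩
        q ℚ.+ (y ℚ.- q)
          ≡⟨ solve 2 (λ y q → q :+ (y :- q) := y) refl y q ⟩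
        y ∎

value∈image : ∀ {m} (f : Poly ℝ m) (𝒵 : Pred (Vec ℤ m) 0ℓ) {z} → 𝒵 z →
  image f 𝒵 (ℝ[x].evaluate f λ i → fromℤ (lookup z i))
value∈image f 𝒵 {z} 𝒵z = z , 𝒵z , ≈-refl (ℝ[x].evaluate f λ i → fromℤ (lookup z i))

theorem1p1 : (∀ {ℓ} → ExcludedMiddle ℓ) →
    (m n : ℕ) → 2 ≤ m →
    (f : Poly ℝ m) → IsForm n f →
    (𝒵 : Pred (Vec ℤ m) 0ℓ) → Satisfiable 𝒵 →
    (∀ {z} → 𝒵 z → z ≢ replicate m 0ℤ) →
    SLℤ-Invariant 𝒵 →
    DiscreteInℝ (image f 𝒵) →
    ℚ-EquivalentToFormIn n f
theorem1p1 em m n _ f (_ , l , independent , factorization) 𝒵 inhabitant nonzero invariant discrete =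
  Conclusion.conclusion ℂ-rawRing (Classical.setting em) em
    ℚ.+-*-rawRing ℚ.+-*-isCommutativeRing ℤ→ℚ ℝ-rawRing ℝ-isCommutativeRing ℤ→ℝ
    (λ {x} {y} → Classical.ℝ-domain em {x} {y}) (λ {z} → fromℤ-injective {z}) fromℚ realℂ realℂ-+ realℂ-*
    (C.refl {C.0#}) (C.refl {C.1#}) fromℤ (λ z → C.refl {ιℂ z}) (λ {x} {y} → realℂ-cong {x} {y}) proj₁
    conj-realℂ realℂ-fromℚ-shear (C.refl {C.0#}) (C.refl {C.1#})
    f l independent factorization 𝒵 inhabitant nonzero invariant
    (image f 𝒵) (λ {z} → value∈image f 𝒵 {z})
    (discrete-in-ℂ em (image f 𝒵) discrete)
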